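{- Let $k\geq1$. The following problem is in $\mathsf{TC}^k$ and it is hard for $\mathsf{AC}^k$ under $\mathsf{AC}^0$-Turing reductions. Input: a power circuit $(\Pi,\delta_\Pi)$ with $\mathrm{depth}(\Pi)\leq\log^k|\Pi|$ and nodes $A,B\in\Pi$ such that for all $P\in\Pi$ the marking $\Lambda_P$ is compact and for all $P\neq Q$ in $\Pi$, $\varepsilon(P)\neq\varepsilon(Q)$. Question: is $\varepsilon(A)\leq\varepsilon(B)$?
   Context: Power circuits. Let $\Gamma$ be a finite set and $\delta\colon\Gamma\times\Gamma\to\{ -1,0,1\}$ such that the directed graph on $\Gamma$ with edge set $\{(P,Q):\delta(P,Q)\neq 0\}$ is acyclic (a dag). A marking on $\Gamma$ is a map $M\colon\Gamma\to\{ -1,0,1\}$ with support $\sigma(M)=\{P:M(P)\neq0\}$. The successor marking of $P\in\Gamma$ is $\Lambda_P\colon Q\mapsto\delta(P,Q)$. The evaluation is defined bottom-up by $\varepsilon(P)=2^{\varepsilon(\Lambda_P)}$ for nodes and $\varepsilon(M)=\sum_{P}M(P)\varepsilon(P)$ for markings (the empty sum is $0$). $(\Gamma,\delta)$ is a power circuit if every node evaluates to an element of $\{2^n:n\in\mathbb{N}\}$. Size is $|\Gamma|$; depth is the number of edges of a longest path. A marking $M$ is compact if $|\varepsilon(\Lambda_P)-\varepsilon(\Lambda_Q)|\geq2$ for all $P\neq Q$ in $\sigma(M)$. Encoding: the matrix of $\delta$. Inputs are promised to satisfy the stated conditions. $\mathsf{AC}^k$ (resp. $\mathsf{TC}^k$)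 is the non-uniform class of problems decided by polynomial-size circuits of depth $O(\log^kn)$ with unbounded fan-in And, Or, Not (resp. And, Or, Not, Majority) gates. A problem $K$ is $\mathsf{AC}^0$-Turing reducible to $L$ if $K$ is decided by polynomial-size, constant-depth circuits with unbounded fan-in And, Or, Not gates and oracle gates for $L$. $\log$ is to base $2$ and $\log^k x=(\log x)^k$. -}

module Defs where

open import Data.Bool.Base using (Bool; true; false; not; _∧_; _∨_)
open import Data.Bool.Properties using (T?)
open import Data.Empty using (⊥)
open import Data.Fin.Base using (Fin)
import Data.Fin.Properties as Fin
open import Data.Fin.Induction using (spo-noetherian)
open import Data.Integer.Base as ℤ using (ℤ; +_; -[1+_]; ∣_∣)
import Data.Integer.Properties as ℤ
open import Data.Nat.Base using (ℕ; zero; suc; _+_; _*_; _^_; _≤_; _≥_; _≤ᵇ_; _⊔_)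
open import Data.Product.Base using (_×_; ∃; ∃₂; ∃-syntax; Σ-syntax)
open import Data.Unit.Base using (⊤)
open import Data.Vec.Base
  using (Vec; []; _∷_; _++_; lookup; map; foldr; replicate; tabulate; concat; count)
open import Function.Base using (flip)
open import Function.Bundles using (_⇔_)
open import Induction.WellFounded
  using (WellFounded; WfRec; module All; module FixPoint; module Subrelation)
open import Level using (0ℓ)
open import Relation.Binary.Construct.Closure.ReflexiveTransitive using (Star; fold)
open import Relation.Binary.Construct.Closure.Transitive as Plus using (TransClosure)
open import Relation.Binary.PropositionalEquality
  using (_≡_; _≢_; refl; cong; isEquivalence; resp₂)
open import Relation.Nullary using (¬_; Dec; yes; no; does)

open import Algebra.Properties.Monoid.Sum ℤ.+-0-monoid using (sum-syntax; sum-cong-≗)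

-- d ≤ c · (log₂ n)^k over the reals, for n ≥ 1.  The rationals p/q with
-- log₂ n ≤ p/q are exactly those with n^q ≤ 2^p, and c · (log₂ n)^k is the
-- infimum of c · (p/q)^k over them.
_≤_·log^_⟨_⟩ : ℕ → ℕ → ℕ → ℕ → Set
d ≤ c ·log^ k ⟨ n ⟩ = ∀ p q → q ≥ 1 → n ^ q ≤ 2 ^ p → d * q ^ k ≤ c * p ^ k

Polynomial : (ℕ → ℕ) → Set
Polynomial f = ∃[ c ] ∃[ e ] ∃[ n₀ ] (∀ n → n ≥ n₀ → f n ≤ c * n ^ e)

O[log^_] : ℕ → (ℕ → ℕ) → Set
O[log^ k ] f = ∃[ c ] ∃[ n₀ ] (∀ n → n ≥ n₀ → f n ≤ c ·log^ k ⟨ n ⟩)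

-- X is the set of additional kinds of gates, each of unbounded fan-in
-- (majority gates, oracle gates); w is the number of available wires.
data Gate (X : Set) (w : ℕ) : Set where
  And Or : ∀ {a} → Vec (Fin w) a → Gate X w
  Not    : Fin w → Gate X w
  Extra  : ∀ {a} → X → Vec (Fin w) a → Gate X w

-- s gates over n inputs in topological order.  As in Vec, the most recently
-- added gate drives wire 0; the inputs are the last n of the s + n wires.
data Gates (X : Set) (n : ℕ) : ℕ → Set where
  []  : Gates X n 0
  _▷_ : ∀ {s} → Gates X n s → Gate X (s + n) → Gates X n (suc s)

record Circuit (X : Set) (n : ℕ) : Set where
  field
    {gateCount} : ℕ
    gates       : Gates X n gateCount
    output      : Fin (gateCount + n)

Interpretation : Set → Set
Interpretation X = X → ∀ {a} → Vec Bool a → Bool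

max : ∀ {a} → Vec ℕ a → ℕ
max = foldr _ _⊔_ 0

module _ {X : Set} where

  evalGate : Interpretation X → ∀ {w} → Gate X w → Vec Bool w → Bool
  evalGate I (And is)     v = foldr _ _∧_ true  (map (lookup v) is)
  evalGate I (Or is)      v = foldr _ _∨_ false (map (lookup v) is)
  evalGate I (Not i)      v = not (lookup v i)
  evalGate I (Extra x is) v = I x (map (lookup v) is)

  evalGates : Interpretation X → ∀ {n s} → Gates X n s → Vec Bool n → Vec Bool (s + n)
  evalGates I []       v = v
  evalGates I (gs ▷ g) v = evalGate I g (evalGates I gs v) ∷ evalGates I gs v

  eval : Interpretation X → ∀ {n} → Circuit X n → Vec Bool n → Bool
  eval I C v = lookup (evalGates I gates v) output
    where open Circuit C

  fanIn : ∀ {w} → Gate X w → ℕ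
  fanIn (And {a} _)     = a
  fanIn (Or {a} _)      = a
  fanIn (Not _)         = 1
  fanIn (Extra {a} _ _) = a

  -- Number of gates plus number of wires.  Counting the wires matters because
  -- a gate may read the same wire several times.
  gatesSize : ∀ {n s} → Gates X n s → ℕ
  gatesSize []       = 0
  gatesSize (gs ▷ g) = suc (fanIn g) + gatesSize gs

  size : ∀ {n} → Circuit X n → ℕ
  size C = gatesSize (Circuit.gates C)

  gateDepth : ∀ {w} → Gate X w → Vec ℕ w → ℕ
  gateDepth (And is)     ds = suc (max (map (lookup ds) is))
  gateDepth (Or is)      ds = suc (max (map (lookup ds) is))
  gateDepth (Not i)      ds = suc (lookup ds i)
  gateDepth (Extra _ is) ds = suc (max (map (lookup ds) is))

  wireDepths : ∀ {n s} → Gates X n s → Vec ℕ (s + n)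
  wireDepths []       = replicate _ 0
  wireDepths (gs ▷ g) = gateDepth g (wireDepths gs) ∷ wireDepths gs

  depth : ∀ {n} → Circuit X n → ℕ
  depth C = max (wireDepths (Circuit.gates C))

Family : Set → Set
Family X = ∀ n → Circuit X n

record Bounded {X : Set} (C : Family X) (k : ℕ) : Set where
  field
    polynomialSize : Polynomial (λ n → size (C n))
    logDepth       : O[log^ k ] (λ n → depth (C n))

-- A (promise) problem: only instances satisfying the promise are elements of
-- Instance, and nothing is required of a decision procedure on other words.
record Problem : Set₁ where
  field
    Instance : Set
    length   : Instance → ℕ
    encode   : (i : Instance) → Vec Bool (length i)
    Question : Instance → Set

Decides : (∀ {n} → Vec Bool n → Bool) → Problem → Set
Decides f K = (i : Instance) → f (encode i) ≡ true ⇔ Question i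
  where open Problem K

DecidesWith : ∀ {X} → Interpretation X → Family X → Problem → Set
DecidesWith I C = Decides (λ {n} → eval I (C n))

noGates : Interpretation ⊥
noGates ()

majority : Interpretation ⊤
majority _ {a} v = a ≤ᵇ 2 * count T? v

AC : ℕ → Problem → Set
AC k K = Σ[ C ∈ Family ⊥ ] Bounded C k × DecidesWith noGates C K

TC : ℕ → Problem → Set
TC k K = Σ[ C ∈ Family ⊤ ] Bounded C k × DecidesWith majority C K

-- The same circuits have to work with every oracle deciding L, whatever it
-- answers on words which violate the promise of L.
infix 4 _≤AC⁰_
_≤AC⁰_ : Problem → Problem → Set
K ≤AC⁰ L = Σ[ C ∈ Family ⊤ ] Bounded C 0 ×
  ((oracle : ∀ {n} → Vec Bool n → Bool) → Decides oracle L →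
   DecidesWith (λ _ → oracle) C K)

ACHard : ℕ → Problem → Set₁
ACHard k L = (K : Problem) → AC k K → K ≤AC⁰ L

data Coefficient : Set where
  −𝟏 𝟎 𝟏 : Coefficient

⟦_⟧ : Coefficient → ℤ
⟦ −𝟏 ⟧ = -[1+ 0 ]
⟦ 𝟎  ⟧ = + 0
⟦ 𝟏  ⟧ = + 1

isZero? : (c : Coefficient) → Dec (c ≡ 𝟎)
isZero? −𝟏 = no λ ()
isZero? 𝟎  = yes refl
isZero? 𝟏  = no λ ()

Marking : ℕ → Set
Marking m = Fin m → Coefficient

-- ∑_Q M(Q) · v(Q)
combine : ∀ {m} → Marking m → (Fin m → ℤ) → ℤ
combine {m} M v = ∑[ Q < m ] (⟦ M Q ⟧ ℤ.* v Q)

-- For a negative exponent the value is junk: 2^z lies strictly between 0 and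
-- 1 then, and a graph with a node of such a value is not a power circuit.
-- Before such a node is met, all markings evaluate to integers.
2^_ : ℤ → ℤ
2^ (+ n)    = + (2 ^ n)
2^ -[1+ _ ] = + 0

Edge : ∀ {m} → (Fin m → Marking m) → Fin m → Fin m → Set
Edge δ P Q = δ P Q ≢ 𝟎

-- Finite sets are represented as Fin m.
record Dag : Set where
  field
    ∣Γ∣     : ℕ
    δ       : Fin ∣Γ∣ → Marking ∣Γ∣
    acyclic : ∀ {P} → ¬ TransClosure (Edge δ) P P

  Node : Set
  Node = Fin ∣Γ∣

  Λ : Node → Marking ∣Γ∣
  Λ P = δ P

  noetherian : WellFounded (flip (Edge δ))
  noetherian = Subrelation.wellFounded Plus.[_] (spo-noetherian record
    { isEquivalence = isEquivalence
    ; irrefl        = λ { refl → acyclic }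
    ; trans         = Plus._++_
    ; <-resp-≈      = resp₂ _
    })

  private
    -- The value of Q is only available if Q is a successor of P; otherwise
    -- its coefficient in Λ P is zero.
    successorValue : ∀ {P Q} → (δ P Q ≢ 𝟎 → ℤ) → Dec (δ P Q ≡ 𝟎) → ℤ
    successorValue v (yes _) = + 0
    successorValue v (no  e) = v e

    step : ∀ P → WfRec (flip (Edge δ)) (λ _ → ℤ) P → ℤ
    step P rec = 2^ combine (Λ P) λ Q →
      successorValue {P} {Q} (λ e → rec e) (isZero? (δ P Q))

    step-ext : ∀ P {r s : WfRec (flip (Edge δ)) (λ _ → ℤ) P} →
               (∀ {Q} (e : Edge δ P Q) → r e ≡ s e) → step P r ≡ step P s
    step-ext P {r} {s} r≡s =
      cong 2^_ (sum-cong-≗ λ Q → cong (⟦ δ P Q ⟧ ℤ.*_) (lemma Q (isZero? (δ P Q))))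
      where
      lemma : ∀ Q (d : Dec (δ P Q ≡ 𝟎)) →
              successorValue {P} {Q} (λ e → r e) d ≡ successorValue {P} {Q} (λ e → s e) d
      lemma Q (yes _) = refl
      lemma Q (no  e) = r≡s e

  ε : Node → ℤ
  ε = All.wfRec noetherian 0ℓ (λ _ → ℤ) step

  εᴹ : Marking ∣Γ∣ → ℤ
  εᴹ M = combine M ε

  ε-unfold : ∀ P → ε P ≡ 2^ εᴹ (Λ P)
  ε-unfold P rewrite FixPoint.unfold-wfRec noetherian (λ _ → ℤ) step step-ext {P} =
    cong 2^_ (sum-cong-≗ λ Q → lemma Q (isZero? (δ P Q)))
    where
    lemma : ∀ Q (d : Dec (δ P Q ≡ 𝟎)) →
            ⟦ δ P Q ⟧ ℤ.* successorValue {P} {Q} (λ _ → ε Q) d ≡ ⟦ δ P Q ⟧ ℤ.* ε Q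
    lemma Q (yes δ≡𝟎) rewrite δ≡𝟎 = refl
    lemma Q (no  _)   = refl

  IsPowerCircuit : Set
  IsPowerCircuit = ∀ P → ∃[ n ] ε P ≡ + (2 ^ n)

  pathLength : ∀ {P Q} → Star (Edge δ) P Q → ℕ
  pathLength = fold (λ _ _ → ℕ) (λ _ → suc) 0

  IsDepth : ℕ → Set
  IsDepth d =
    (∃₂ λ P Q → Σ[ π ∈ Star (Edge δ) P Q ] pathLength π ≡ d) ×
    (∀ {P Q} (π : Star (Edge δ) P Q) → pathLength π ≤ d)

  Compact : Marking ∣Γ∣ → Set
  Compact M = ∀ {P Q} → M P ≢ 𝟎 → M Q ≢ 𝟎 → P ≢ Q → ∣ εᴹ (Λ P) ℤ.- εᴹ (Λ Q) ∣ ≥ 2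

-- First bit: non-zero; second bit: negative.
bits : Coefficient → Vec Bool 2
bits −𝟏 = true  ∷ true  ∷ []
bits 𝟎  = false ∷ false ∷ []
bits 𝟏  = true  ∷ false ∷ []

oneHot : ∀ {m} → Fin m → Vec Bool m
oneHot P = tabulate λ Q → does (Q Fin.≟ P)

record ComparisonInstance (k : ℕ) : Set where
  field
    Π : Dag
  open Dag Π public
  field
    A B            : Node
    isPowerCircuit : IsPowerCircuit
    depthBound     : ∃[ d ] IsDepth d × d ≤ 1 ·log^ k ⟨ ∣Γ∣ ⟩
    compact        : ∀ P → Compact (Λ P)
    distinct       : ∀ {P Q} → P ≢ Q → ε P ≢ ε Q

Comparison : ℕ → Problem
Comparison k = record
  { Instance = ComparisonInstance k
  ; length   = λ i → let open ComparisonInstance i in ∣Γ∣ * (∣Γ∣ * 2) + (∣Γ∣ + ∣Γ∣)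
  ; encode   = λ i → let open ComparisonInstance i in
      concat (tabulate λ P → concat (tabulate λ Q → bits (δ P Q))) ++ (oneHot A ++ oneHot B)
  ; Question = λ i → let open ComparisonInstance i in ε A ℤ.≤ ε B
  }

{-# OPTIONS --safe #-}

-- Membership.  Compact markings over nodes with distinct values are signed digit
-- expansions without adjacent digits, so that the largest node in which two of them
-- differ decides which one is smaller.  This turns the comparison of all nodes of
-- height t into the comparison of all nodes of height t + 1 by unbounded fan-in
-- gates of constant depth, and log^k rounds suffice.
--
-- Hardness.  A circuit becomes a network of negated disjunctions which is run
-- synchronously for a number of rounds proportional to its depth; each round is a
-- layer of a power circuit in which the truth of a vertex is its comparison with
-- a threshold node.  Every bit of the encoding depends on one input bit only.
-- Padding the number of nodes to a power of the input length bounds the depth by log^k.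
module Submission where

open import Defs
open import Data.Bool.Base using (Bool; true; false; not; _∧_; _∨_; if_then_else_; T)
open import Data.Fin.Base as Fin using (Fin; zero; suc; toℕ)
import Data.Fin.Properties as Fin
open import Data.Integer.Base as ℤ using (ℤ; +_; -[1+_]; ∣_∣)
import Data.Integer.Properties as ℤ
open import Data.Nat.Base
import Data.Nat.Properties as ℕ
open import Data.Nat.Tactic.RingSolver using (solve-∀)
import Data.Integer.Tactic.RingSolver as ℤSolver
open import Data.Product.Base using (_×_; _,_; proj₁; proj₂; uncurry; ∃; ∃₂; ∃-syntax; Σ-syntax)
open import Data.Sum.Base using (_⊎_; inj₁; inj₂; [_,_]′; swap)
import Data.Sum.Base as Sum
open import Data.Empty using (⊥; ⊥-elim)
open import Data.Unit.Base using (⊤; tt)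
open import Function.Base using (_∘_; case_of_)
open import Function.Bundles using (_⇔_; mk⇔; Equivalence)
open import Relation.Binary.PropositionalEquality
open import Relation.Binary.Definitions using (tri<; tri≈; tri>)
open import Relation.Nullary using (¬_; Dec; yes; no; does; contradiction)
open import Relation.Nullary.Decidable using (¬?; _×-dec_)
open import Data.Vec.Base as Vec using (Vec; []; _∷_; lookup; tabulate)
import Data.Vec.Properties as Vec
open import Relation.Binary.Construct.Closure.ReflexiveTransitive as Star using (Star; _◅_)
open import Relation.Binary.Construct.Closure.Transitive as Plus using (TransClosure)
open import Data.Nat.Divisibility using (_∣_; divides)
open import Data.Integer.Divisibility.Signed using (∣m∣n⇒∣m+n; ∣n⇒∣m*n; ∣⇒∣ᵤ; ∣ᵤ⇒∣) renaming (_∣_ to _∣ᶻ_; divides to dividesᶻ)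
import Data.Fin.Induction as Fin using (<-weakInduction)
open import Function.Construct.Composition using (_⇔-∘_)

-- Signed digit expansions

-- On the hardness side the obstacle is the promise: for every input, all markings must be compact
-- and all nodes must have different values. Parity reduces the first demand to the second. A
-- marking supported on nodes with positive exponents evaluates to an even number. Outside the chain
-- no marking uses the two lowest nodes of the chain, with exponents 0 and 1, so all exponents met
-- in such supports are even, and distinct even numbers differ by at least 2. Distinctness is
-- enforced by writing the number of each node into its own marking. The digits sit on the chain,
-- whose nodes are smaller than those of every layer, so they cannot disturb the comparison of a
-- vertex with a threshold, which a larger node decides.
--
-- The number is written in base 3 because a coefficient has three values, and this matters for k =
-- 1: on 3^b nodes the chain has b + 4 nodes while a depth of log(3^b), about 1.58 b, is allowed.
-- Binary digits on 2^b nodes would use up the whole depth and leave nothing for the layers.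

private
  module ℤSum where
    open import Algebra.Properties.CommutativeMonoid.Sum ℤ.+-0-commutativeMonoid public

open ℤSum using (sum; sum-cong-≗; ∑-distrib-+; sum-replicate-zero)

combine-cong : ∀ {m} {M N : Marking m} (v : Fin m → ℤ) → (∀ P → M P ≡ N P) →
               combine M v ≡ combine N v
combine-cong v M≗N = sum-cong-≗ λ P → cong (λ c → ⟦ c ⟧ ℤ.* v P) (M≗N P)

combine-congʳ : ∀ {m} (M : Marking m) {v w : Fin m → ℤ} → (∀ P → M P ≢ 𝟎 → v P ≡ w P) →
                combine M v ≡ combine M w
combine-congʳ M {v} {w} v≗w = sum-cong-≗ λ P → lemma P (isZero? (M P))
  where
  lemma : ∀ P → Dec (M P ≡ 𝟎) → ⟦ M P ⟧ ℤ.* v P ≡ ⟦ M P ⟧ ℤ.* w P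
  lemma P (yes MP≡𝟎) rewrite MP≡𝟎 = refl
  lemma P (no  MP≢𝟎) = cong (⟦ M P ⟧ ℤ.*_) (v≗w P MP≢𝟎)

combine-zero : ∀ {m} {M : Marking m} (v : Fin m → ℤ) → (∀ P → M P ≡ 𝟎) → combine M v ≡ + 0
combine-zero {m} v M≗𝟎 = trans (combine-cong v M≗𝟎) (sum-replicate-zero m)

infixl 7 _↾_

_↾_ : ∀ {m} → Marking m → (Fin m → Bool) → Marking m
(M ↾ p) P = if p P then M P else 𝟎

↾-support : ∀ {m} (M : Marking m) p {P} → (M ↾ p) P ≢ 𝟎 → p P ≡ true × M P ≢ 𝟎
↾-support M p {P} ≢𝟎 with p P
... | true  = refl , ≢𝟎
... | false = contradiction refl ≢𝟎

combine-partition : ∀ {m} (M : Marking m) p v →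
                    combine M v ≡ combine (M ↾ p) v ℤ.+ combine (M ↾ (not ∘ p)) v
combine-partition M p v = trans (sum-cong-≗ λ P → lemma P (p P)) (∑-distrib-+ (λ P → ⟦ (M ↾ p) P ⟧ ℤ.* v P) (λ P → ⟦ (M ↾ (not ∘ p)) P ⟧ ℤ.* v P))
  where
  lemma : ∀ P b → ⟦ M P ⟧ ℤ.* v P ≡ ⟦ if b then M P else 𝟎 ⟧ ℤ.* v P ℤ.+
                                    ⟦ if not b then M P else 𝟎 ⟧ ℤ.* v P
  lemma P true  = sym (ℤ.+-identityʳ _)
  lemma P false = sym (ℤ.+-identityˡ _)

isNot : ∀ {m} → Fin m → Fin m → Bool
isNot R P = not (does (P Fin.≟ R))

isNot⇒≢ : ∀ {m} {R P : Fin m} → isNot R P ≡ true → P ≢ R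
isNot⇒≢ {R = R} {P} eq P≡R with P Fin.≟ R
isNot⇒≢ ()  P≡R | yes _
isNot⇒≢ eq  P≡R | no P≢R = P≢R P≡R

combine-extract : ∀ {m} (M : Marking m) R v →
                  combine M v ≡ ⟦ M R ⟧ ℤ.* v R ℤ.+ combine (M ↾ isNot R) v
combine-extract M zero    v =
  cong (λ x → ⟦ M zero ⟧ ℤ.* v zero ℤ.+ x) (sym (ℤ.+-identityˡ _))
combine-extract M (suc R) v = begin
  a ℤ.+ combine (M ∘ suc) (v ∘ suc)
    ≡⟨ cong (λ x → a ℤ.+ x) (combine-extract (M ∘ suc) R (v ∘ suc)) ⟩
  a ℤ.+ (b ℤ.+ c)
    ≡⟨ ℤ.+-assoc a b c ⟨
  a ℤ.+ b ℤ.+ c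
    ≡⟨ cong (ℤ._+ c) (ℤ.+-comm a b) ⟩
  b ℤ.+ a ℤ.+ c
    ≡⟨ ℤ.+-assoc b a c ⟩
  b ℤ.+ (a ℤ.+ c) ∎
  where
  open ≡-Reasoning
  a = ⟦ M zero ⟧ ℤ.* v zero
  b = ⟦ M (suc R) ⟧ ℤ.* v (suc R)
  c = combine ((M ∘ suc) ↾ isNot R) (v ∘ suc)

combine-single : ∀ {m} (M : Marking m) R v → M R ≡ 𝟏 → (∀ P → M P ≢ 𝟎 → P ≡ R) →
                 combine M v ≡ v R
combine-single M R v MR≡𝟏 only = begin
  combine M v                                 ≡⟨ combine-extract M R v ⟩
  ⟦ M R ⟧ ℤ.* v R ℤ.+ combine (M ↾ isNot R) v ≡⟨ cong₂ ℤ._+_ (cong (λ c → ⟦ c ⟧ ℤ.* v R) MR≡𝟏) (combine-zero v rest) ⟩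
  + 1 ℤ.* v R ℤ.+ + 0                         ≡⟨ ℤ.+-identityʳ _ ⟩
  + 1 ℤ.* v R                                 ≡⟨ ℤ.*-identityˡ _ ⟩
  v R                                         ∎
  where
  open ≡-Reasoning
  rest : ∀ P → (M ↾ isNot R) P ≡ 𝟎
  rest P with isZero? ((M ↾ isNot R) P)
  ... | yes ≡𝟎 = ≡𝟎
  ... | no  ≢𝟎 with ↾-support M (isNot R) {P} ≢𝟎
  ...   | kept , MP≢𝟎 = contradiction (only P MP≢𝟎) (isNot⇒≢ kept)

argmax : ∀ {m} {D : Fin m → Set} → (∀ P → Dec (D P)) → (e : Fin m → ℕ) → ∀ {Q} → D Q →
         ∃[ R ] D R × (∀ {S} → D S → e S ≤ e R)
argmax {suc m} {D} D? e {Q} DQ with Fin.any? (D? ∘ suc)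
... | no none = zero , D0 Q DQ , max0
  where
  D0 : ∀ Q → D Q → D zero
  D0 zero    D0 = D0
  D0 (suc Q) DQ = contradiction (Q , DQ) none
  max0 : ∀ {S} → D S → e S ≤ e zero
  max0 {zero}  _  = ℕ.≤-refl
  max0 {suc S} DS = contradiction (S , DS) none
... | yes (S , DS) with argmax (D? ∘ suc) (e ∘ suc) {S} DS
...   | R , DR , maxR with D? zero
...     | no ¬D0 = suc R , DR , λ { {zero} D0 → contradiction D0 ¬D0 ; {suc _} DS → maxR DS }
...     | yes D0 with ℕ.≤-total (e zero) (e (suc R))
...       | inj₁ ≤R = suc R , DR , λ { {zero} _ → ≤R ; {suc _} DS → maxR DS }
...       | inj₂ R≤ = zero , D0 , λ { {zero} _ → ℕ.≤-refl ; {suc _} DS → ℕ.≤-trans (maxR DS) R≤ }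

_≟ᶜ_ : (c d : Coefficient) → Dec (c ≡ d)
−𝟏 ≟ᶜ −𝟏 = yes refl
−𝟏 ≟ᶜ 𝟎  = no λ ()
−𝟏 ≟ᶜ 𝟏  = no λ ()
𝟎  ≟ᶜ −𝟏 = no λ ()
𝟎  ≟ᶜ 𝟎  = yes refl
𝟎  ≟ᶜ 𝟏  = no λ ()
𝟏  ≟ᶜ −𝟏 = no λ ()
𝟏  ≟ᶜ 𝟎  = no λ ()
𝟏  ≟ᶜ 𝟏  = yes refl

infix 4 _<ᶜ_

_<ᶜ_ : Coefficient → Coefficient → Set
c <ᶜ d = ⟦ c ⟧ ℤ.< ⟦ d ⟧

≢⇒<ᶜ⊎>ᶜ : ∀ {c d} → c ≢ d → c <ᶜ d ⊎ d <ᶜ c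
≢⇒<ᶜ⊎>ᶜ {−𝟏} {−𝟏} c≢d = contradiction refl c≢d
≢⇒<ᶜ⊎>ᶜ {−𝟏} {𝟎}  c≢d = inj₁ ℤ.-<+
≢⇒<ᶜ⊎>ᶜ {−𝟏} {𝟏}  c≢d = inj₁ ℤ.-<+
≢⇒<ᶜ⊎>ᶜ {𝟎}  {−𝟏} c≢d = inj₂ ℤ.-<+
≢⇒<ᶜ⊎>ᶜ {𝟎}  {𝟎}  c≢d = contradiction refl c≢d
≢⇒<ᶜ⊎>ᶜ {𝟎}  {𝟏}  c≢d = inj₁ (ℤ.+<+ (s≤s z≤n))
≢⇒<ᶜ⊎>ᶜ {𝟏}  {−𝟏} c≢d = inj₂ ℤ.-<+
≢⇒<ᶜ⊎>ᶜ {𝟏}  {𝟎}  c≢d = inj₂ (ℤ.+<+ (s≤s z≤n))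
≢⇒<ᶜ⊎>ᶜ {𝟏}  {𝟏}  c≢d = contradiction refl c≢d

∣∣<⇒< : ∀ x {n} → ∣ x ∣ < n → x ℤ.< + n
∣∣<⇒< (+ _)    lt = ℤ.+<+ lt
∣∣<⇒< -[1+ _ ] lt = ℤ.-<+

∣∣<⇒-< : ∀ x {n} → ∣ x ∣ < n → ℤ.- + n ℤ.< x
∣∣<⇒-< x {n} lt = subst (ℤ.- + n ℤ.<_) (ℤ.neg-involutive x)
  (ℤ.neg-mono-< (∣∣<⇒< (ℤ.- x) (subst (_< n) (sym (ℤ.∣-i∣≡∣i∣ x)) lt)))

∣⟦⟧*∣≤ : ∀ c x → ∣ ⟦ c ⟧ ℤ.* + x ∣ ≤ x
∣⟦⟧*∣≤ −𝟏 x = ℕ.≤-reflexive (trans (cong ∣_∣ (ℤ.-1*i≡-i (+ x))) (ℤ.∣-i∣≡∣i∣ (+ x)))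
∣⟦⟧*∣≤ 𝟎  x = z≤n
∣⟦⟧*∣≤ 𝟏  x = ℕ.≤-reflexive (cong ∣_∣ (ℤ.*-identityˡ (+ x)))

module SignedDigits {m : ℕ} (e : Fin m → ℕ) where

  power : Fin m → ℤ
  power P = + (2 ^ e P)

  val : Marking m → ℤ
  val M = combine M power

  Gapped : Marking m → Set
  Gapped M = ∀ {P Q} → M P ≢ 𝟎 → M Q ≢ 𝟎 → P ≢ Q → 2 + e P ≤ e Q ⊎ 2 + e Q ≤ e P

  ↾-gapped : ∀ {M} p → Gapped M → Gapped (M ↾ p)
  ↾-gapped {M} p gap P∈ Q∈ = gap (proj₂ (↾-support M p P∈)) (proj₂ (↾-support M p Q∈))

  below-top : ∀ {M R S} → Gapped M → M R ≢ 𝟎 → (∀ {S} → M S ≢ 𝟎 → e S ≤ e R) →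
              (M ↾ isNot R) S ≢ 𝟎 → 2 + e S ≤ e R
  below-top {M} {R} gap R∈ top S∈′ with ↾-support M (isNot R) S∈′
  ... | kept , S∈ with gap S∈ R∈ (isNot⇒≢ kept)
  ...   | inj₁ le = le
  ...   | inj₂ ge = contradiction (ℕ.≤-trans ge (top S∈)) (ℕ.<⇒≱ (s≤s (ℕ.n≤1+n _)))

  Small : ℕ → Set
  Small f = ∀ {M} → Gapped M → (∀ {S} → M S ≢ 𝟎 → 2 + e S ≤ f) → 3 * ∣ val M ∣ < 2 ^ f

  small-empty : ∀ f {M} → (∀ {S} → ¬ (M S ≢ 𝟎)) → 3 * ∣ val M ∣ < 2 ^ f
  small-empty f {M} empty = subst (λ x → 3 * ∣ x ∣ < 2 ^ f) (sym (combine-zero power allZero)) (ℕ.m^n>0 2 f)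
    where
    allZero : ∀ P → M P ≡ 𝟎
    allZero P with isZero? (M P)
    ... | yes ≡𝟎 = ≡𝟎
    ... | no  ≢𝟎 = contradiction ≢𝟎 empty

  -- A digit of exponent `f` excludes one of exponent `f - 1`, so what remains obeys the bound for
  -- `f`, and 3 · 2^f + 2^f is exactly 2^(2 + f). The factor 3 is the one that makes this recursion
  -- close.
  small-step : ∀ {f} → Small f → Small (suc f) → Small (2 + f)
  small-step {f} small-f small-1+f {M} gap le
    with Fin.any? (λ S → ¬? (isZero? (M S)) ×-dec (e S ℕ.≟ f))
  ... | no none = ℕ.<-≤-trans (small-1+f gap le′) (ℕ.m≤m+n _ _)
    where
    le′ : ∀ {S} → M S ≢ 𝟎 → 2 + e S ≤ suc f
    le′ {S} S∈ = s≤s (ℕ.≤∧≢⇒< (s≤s⁻¹ (s≤s⁻¹ (le S∈))) λ eq → none (S , S∈ , eq))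
  ... | yes (R , R∈ , eR≡f) = begin-strict
    3 * ∣ val M ∣                              ≡⟨ cong (λ x → 3 * ∣ x ∣) (combine-extract M R power) ⟩
    3 * ∣ ⟦ M R ⟧ ℤ.* power R ℤ.+ val M′ ∣     ≤⟨ ℕ.*-monoʳ-≤ 3 (ℤ.∣i+j∣≤∣i∣+∣j∣ (⟦ M R ⟧ ℤ.* power R) (val M′)) ⟩
    3 * (∣ ⟦ M R ⟧ ℤ.* power R ∣ + ∣ val M′ ∣) ≤⟨ ℕ.*-monoʳ-≤ 3 (ℕ.+-monoˡ-≤ _ (∣⟦⟧*∣≤ (M R) _)) ⟩
    3 * (2 ^ e R + ∣ val M′ ∣)                 ≡⟨ cong (λ x → 3 * (2 ^ x + ∣ val M′ ∣)) eR≡f ⟩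
    3 * (2 ^ f + ∣ val M′ ∣)                   ≡⟨ ℕ.*-distribˡ-+ 3 (2 ^ f) _ ⟩
    3 * 2 ^ f + 3 * ∣ val M′ ∣                 <⟨ ℕ.+-monoʳ-< (3 * 2 ^ f) (small-f (↾-gapped (isNot R) gap) below) ⟩
    3 * 2 ^ f + 2 ^ f                          ≡⟨ arith (2 ^ f) ⟩
    2 ^ (2 + f)                                ∎
    where
    open ℕ.≤-Reasoning
    M′ = M ↾ isNot R
    below : ∀ {S} → M′ S ≢ 𝟎 → 2 + e S ≤ f
    below {S} S∈ = subst (2 + e S ≤_) eR≡f
      (below-top gap R∈ (λ {S} S∈ → subst (e S ≤_) (sym eR≡f) (s≤s⁻¹ (s≤s⁻¹ (le S∈)))) S∈)
    arith : ∀ x → 3 * x + x ≡ 2 * (2 * x)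
    arith = solve-∀

  -- Extremal case: digits at f - 2, f - 4, …, whose sum is 2^f / 3 up to rounding.
  small : ∀ f → Small f
  small zero          gap le = small-empty 0 λ S∈ → case le S∈ of λ ()
  small (suc zero)    gap le = small-empty 1 λ S∈ → case le S∈ of λ { (s≤s ()) }
  small (suc (suc f))        = small-step (small f) (small (suc f))

  private
    ∣3*∣ : ∀ x → ∣ + 3 ℤ.* x ∣ ≡ 3 * ∣ x ∣
    ∣3*∣ x = ℤ.∣i*j∣≡∣i∣*∣j∣ (+ 3) x

    cast : ∀ {M f} → 3 * ∣ val M ∣ < 2 ^ f → ∣ + 3 ℤ.* val M ∣ < 2 ^ f
    cast {M} {f} = subst (_< 2 ^ f) (sym (∣3*∣ (val M)))

  -- Let `i` be the exponent of `R`. Three times the value is above 2^(i+1), strictly between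
  -- -2^(i+1) and 2^(i+1), or below -2^(i+1) if the digit at `R` is 1, 0 or -1; for 0 provided that
  -- no other digit has exponent `i`. Without gaps the ranges would meet: 2^i - 2^(i-1) = 2^(i-1).
  module Leading {M : Marking m} {R : Fin m} (gap : Gapped M) (top : ∀ {S} → M S ≢ 𝟎 → e S ≤ e R) where

    private
      i = e R
      M′ = M ↾ isNot R

      rest-small : M R ≢ 𝟎 → ∣ + 3 ℤ.* val M′ ∣ < 2 ^ i
      rest-small R∈ = cast {M′} {i} (small i (↾-gapped (isNot R) gap) (below-top gap R∈ top))

      expand : ∀ {c} → M R ≡ c → + 3 ℤ.* val M ≡ + 3 ℤ.* (⟦ c ⟧ ℤ.* power R) ℤ.+ + 3 ℤ.* val M′
      expand refl = trans (cong (+ 3 ℤ.*_) (combine-extract M R power)) (ℤ.*-distribˡ-+ (+ 3) (⟦ M R ⟧ ℤ.* power R) (val M′))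

    positive : M R ≡ 𝟏 → + (2 ^ suc i) ℤ.< + 3 ℤ.* val M
    positive MR≡𝟏 = subst (+ (2 ^ suc i) ℤ.<_) (sym (expand MR≡𝟏))
      (subst (ℤ._< + 3 ℤ.* (+ 1 ℤ.* power R) ℤ.+ + 3 ℤ.* val M′) eq
        (ℤ.+-monoʳ-< (+ 3 ℤ.* (+ 1 ℤ.* power R)) (∣∣<⇒-< (+ 3 ℤ.* val M′) (rest-small λ MR≡𝟎 → case trans (sym MR≡𝟏) MR≡𝟎 of λ ()))))
      where
      eq : + 3 ℤ.* (+ 1 ℤ.* + (2 ^ i)) ℤ.+ ℤ.- + (2 ^ i) ≡ + (2 * 2 ^ i)
      eq = trans (lemma (+ (2 ^ i))) (sym (ℤ.pos-* 2 (2 ^ i)))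
        where
        lemma : ∀ x → + 3 ℤ.* (+ 1 ℤ.* x) ℤ.+ ℤ.- x ≡ + 2 ℤ.* x
        lemma = ℤSolver.solve-∀

    negative : M R ≡ −𝟏 → + 3 ℤ.* val M ℤ.< ℤ.- + (2 ^ suc i)
    negative MR≡−𝟏 = subst (ℤ._< ℤ.- + (2 ^ suc i)) (sym (expand MR≡−𝟏))
      (subst (+ 3 ℤ.* (-[1+ 0 ] ℤ.* power R) ℤ.+ + 3 ℤ.* val M′ ℤ.<_) eq
        (ℤ.+-monoʳ-< (+ 3 ℤ.* (-[1+ 0 ] ℤ.* power R)) (∣∣<⇒< (+ 3 ℤ.* val M′) (rest-small λ MR≡𝟎 → case trans (sym MR≡−𝟏) MR≡𝟎 of λ ()))))
      where
      eq : + 3 ℤ.* (-[1+ 0 ] ℤ.* + (2 ^ i)) ℤ.+ + (2 ^ i) ≡ ℤ.- + (2 * 2 ^ i)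
      eq = trans (lemma (+ (2 ^ i))) (cong ℤ.-_ (sym (ℤ.pos-* 2 (2 ^ i))))
        where
        lemma : ∀ x → + 3 ℤ.* (-[1+ 0 ] ℤ.* x) ℤ.+ x ≡ ℤ.- (+ 2 ℤ.* x)
        lemma = ℤSolver.solve-∀

    module _ (unique : ∀ {S} → M S ≢ 𝟎 → e S ≡ e R → S ≡ R) (MR≡𝟎 : M R ≡ 𝟎) where

      private
        all-small : ∣ + 3 ℤ.* val M ∣ < 2 ^ suc i
        all-small = cast {M} {suc i} (small (suc i) gap λ {S} S∈ → s≤s (ℕ.≤∧≢⇒< (top S∈) λ eq →
          S∈ (trans (cong M (unique S∈ eq)) MR≡𝟎)))

      zero< : + 3 ℤ.* val M ℤ.< + (2 ^ suc i)
      zero< = ∣∣<⇒< (+ 3 ℤ.* val M) all-small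

      zero> : ℤ.- + (2 ^ suc i) ℤ.< + 3 ℤ.* val M
      zero> = ∣∣<⇒-< (+ 3 ℤ.* val M) all-small

  module _ {M N : Marking m} (gapᴹ : Gapped M) (gapᴺ : Gapped N) {R : Fin m}
           (uniqueᴹ : ∀ {S} → M S ≢ 𝟎 → e S ≡ e R → S ≡ R)
           (uniqueᴺ : ∀ {S} → N S ≢ 𝟎 → e S ≡ e R → S ≡ R)
           (agree : ∀ {S} → e R < e S → M S ≡ N S) where

    private
      low : Fin m → Bool
      low S = e S ≤ᵇ e R

      low⇒≤ : ∀ {S} → low S ≡ true → e S ≤ e R
      low⇒≤ {S} eq = ℕ.≤ᵇ⇒≤ (e S) (e R) (subst T (sym eq) tt)

      low-R : ∀ M → (M ↾ low) R ≡ M R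
      low-R M with e R ≤ᵇ e R in eq
      ... | true  = refl
      ... | false = ⊥-elim (subst T eq (ℕ.≤⇒≤ᵇ {e R} ℕ.≤-refl))

      high-agree : ∀ S → (M ↾ (not ∘ low)) S ≡ (N ↾ (not ∘ low)) S
      high-agree S with e S ≤ᵇ e R in eq
      ... | true  = refl
      ... | false = agree (ℕ.≰⇒> λ le → subst T eq (ℕ.≤⇒≤ᵇ le))

      module Low (M : Marking m) (gap : Gapped M) (unique : ∀ {S} → M S ≢ 𝟎 → e S ≡ e R → S ≡ R) where
        open Leading {M ↾ low} {R} (↾-gapped low gap) (λ {S} S∈ → low⇒≤ {S} (proj₁ (↾-support M low {S} S∈))) public
        low-unique : ∀ {S} → (M ↾ low) S ≢ 𝟎 → e S ≡ e R → S ≡ R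
        low-unique {S} S∈ = unique (proj₂ (↾-support M low {S} S∈))

      module Mᴸ = Low M gapᴹ uniqueᴹ
      module Nᴸ = Low N gapᴺ uniqueᴺ

      3*-mono⁻ : ∀ {x y} → + 3 ℤ.* x ℤ.< + 3 ℤ.* y → x ℤ.< y
      3*-mono⁻ = ℤ.*-cancelˡ-<-nonNeg (+ 3)

      −<+ : ∀ {n} → ℤ.- + n ℤ.≤ + n
      −<+ = ℤ.neg-≤-pos

      low-< : M R <ᶜ N R → val (M ↾ low) ℤ.< val (N ↾ low)
      low-< lt = 3*-mono⁻ (cases (M R) (N R) lt (low-R M) (low-R N))
        where
        cases : ∀ c d → c <ᶜ d → (M ↾ low) R ≡ c → (N ↾ low) R ≡ d →
                + 3 ℤ.* val (M ↾ low) ℤ.< + 3 ℤ.* val (N ↾ low)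
        cases −𝟏 −𝟏 lt _ _ = contradiction lt (ℤ.<-irrefl refl)
        cases −𝟏 𝟎  _ p q = ℤ.<-trans (Mᴸ.negative p) (Nᴸ.zero> Nᴸ.low-unique q)
        cases −𝟏 𝟏  _ p q = ℤ.<-trans (Mᴸ.negative p) (ℤ.≤-<-trans −<+ (Nᴸ.positive q))
        cases 𝟎  −𝟏 () _ _
        cases 𝟎  𝟎  lt _ _ = contradiction lt (ℤ.<-irrefl refl)
        cases 𝟎  𝟏  _ p q = ℤ.<-trans (Mᴸ.zero< Mᴸ.low-unique p) (Nᴸ.positive q)
        cases 𝟏  −𝟏 () _ _
        cases 𝟏  𝟎  (ℤ.+<+ ()) _ _
        cases 𝟏  𝟏  lt _ _ = contradiction lt (ℤ.<-irrefl refl)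

    -- Both markings are cut at the exponent of `R`. The upper parts are equal and cancel; in the
    -- lower parts nothing exceeds `R`, and `Leading` puts their values into disjoint ranges.
    lexicographic : M R <ᶜ N R → val M ℤ.< val N
    lexicographic lt = subst₂ ℤ._<_ (sym (combine-partition M low power))
      (sym (trans (combine-partition N low power) (cong (λ x → val (N ↾ low) ℤ.+ x) (sym (combine-cong power high-agree)))))
      (ℤ.+-monoˡ-< (val (M ↾ (not ∘ low))) (low-< lt))

  leading-difference : ∀ (M N : Marking m) {Q} → M Q ≢ N Q →
                       ∃[ R ] M R ≢ N R × e Q ≤ e R × (∀ {S} → e R < e S → M S ≡ N S)
  leading-difference M N {Q} M≢N with argmax (λ S → ¬? (M S ≟ᶜ N S)) e {Q} M≢N
  ... | R , R≢ , maximal = R , R≢ , maximal M≢N , agree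
    where
    agree : ∀ {S} → e R < e S → M S ≡ N S
    agree {S} R<S with M S ≟ᶜ N S
    ... | yes eq = eq
    ... | no neq = contradiction (maximal neq) (ℕ.<⇒≱ R<S)

-- Circuits from formulas

data Formula (X V : Set) : Set where
  var   : V → Formula X V
  neg   : Formula X V → Formula X V
  ⋀ ⋁   : ∀ {a} → (Fin a → Formula X V) → Formula X V
  extra : ∀ {a} → X → (Fin a → Formula X V) → Formula X V

module _ {X V : Set} where

  evalᶠ : Interpretation X → (V → Bool) → Formula X V → Bool
  evalᶠ I ρ (var x)     = ρ x
  evalᶠ I ρ (neg φ)     = not (evalᶠ I ρ φ)
  evalᶠ I ρ (⋀ φ)       = Vec.foldr _ _∧_ true (tabulate λ i → evalᶠ I ρ (φ i))
  evalᶠ I ρ (⋁ φ)       = Vec.foldr _ _∨_ false (tabulate λ i → evalᶠ I ρ (φ i))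
  evalᶠ I ρ (extra x φ) = I x (tabulate λ i → evalᶠ I ρ (φ i))

  sizeᶠ : Formula X V → ℕ
  sizeᶠ (var _)         = 0
  sizeᶠ (neg φ)         = 2 + sizeᶠ φ
  sizeᶠ (⋀ {a} φ)       = suc a + Vec.sum (tabulate λ i → sizeᶠ (φ i))
  sizeᶠ (⋁ {a} φ)       = suc a + Vec.sum (tabulate λ i → sizeᶠ (φ i))
  sizeᶠ (extra {a} _ φ) = suc a + Vec.sum (tabulate λ i → sizeᶠ (φ i))

  depthᶠ : Formula X V → ℕ
  depthᶠ (var _)     = 0
  depthᶠ (neg φ)     = suc (depthᶠ φ)
  depthᶠ (⋀ φ)       = suc (max (tabulate λ i → depthᶠ (φ i)))
  depthᶠ (⋁ φ)       = suc (max (tabulate λ i → depthᶠ (φ i)))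
  depthᶠ (extra _ φ) = suc (max (tabulate λ i → depthᶠ (φ i)))

  evalᶠ-cong : ∀ I {ρ σ} → ρ ≗ σ → evalᶠ I ρ ≗ evalᶠ I σ
  evalᶠ-cong I ρ≗σ (var x)     = ρ≗σ x
  evalᶠ-cong I ρ≗σ (neg φ)     = cong not (evalᶠ-cong I ρ≗σ φ)
  evalᶠ-cong I ρ≗σ (⋀ φ)       = cong (Vec.foldr _ _∧_ true) (Vec.tabulate-cong λ i → evalᶠ-cong I ρ≗σ (φ i))
  evalᶠ-cong I ρ≗σ (⋁ φ)       = cong (Vec.foldr _ _∨_ false) (Vec.tabulate-cong λ i → evalᶠ-cong I ρ≗σ (φ i))
  evalᶠ-cong I ρ≗σ (extra x φ) = cong (I x) (Vec.tabulate-cong λ i → evalᶠ-cong I ρ≗σ (φ i))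

max-tabulate-≤ : ∀ {a} (f : Fin a → ℕ) {d} → (∀ i → f i ≤ d) → max (tabulate f) ≤ d
max-tabulate-≤ {zero}  f f≤d = z≤n
max-tabulate-≤ {suc a} f f≤d = ℕ.⊔-lub (f≤d zero) (max-tabulate-≤ (f ∘ suc) (f≤d ∘ suc))

≤-max-tabulate : ∀ {a} (f : Fin a → ℕ) i → f i ≤ max (tabulate f)
≤-max-tabulate f zero    = ℕ.m≤m⊔n _ _
≤-max-tabulate f (suc i) = ℕ.≤-trans (≤-max-tabulate (f ∘ suc) i) (ℕ.m≤n⊔m _ _)

sum-tabulate-≤ : ∀ {a} (f : Fin a → ℕ) {k} → (∀ i → f i ≤ k) → Vec.sum (tabulate f) ≤ a * k
sum-tabulate-≤ {zero}  f f≤k = z≤n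
sum-tabulate-≤ {suc a} f f≤k = ℕ.+-mono-≤ (f≤k zero) (sum-tabulate-≤ (f ∘ suc) (f≤k ∘ suc))

module _ {X : Set} {n : ℕ} where

  depthAt : ∀ {s} → Gates X n s → Fin (s + n) → ℕ
  depthAt gs = lookup (wireDepths gs)

  infix 4 _⊑_

  record _⊑_ {s t} (gs : Gates X n s) (hs : Gates X n t) : Set where
    field
      keep       : Fin (s + n) → Fin (t + n)
      keep-value : ∀ (I : Interpretation X) v i →
                   lookup (evalGates I hs v) (keep i) ≡ lookup (evalGates I gs v) i
      keep-depth : ∀ i → depthAt hs (keep i) ≡ depthAt gs i

  open _⊑_ public

  ⊑-refl : ∀ {s} {gs : Gates X n s} → gs ⊑ gs
  ⊑-refl = record { keep = λ i → i ; keep-value = λ _ _ _ → refl ; keep-depth = λ _ → refl }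

  ⊑-trans : ∀ {s t u} {gs : Gates X n s} {hs : Gates X n t} {ks : Gates X n u} → gs ⊑ hs → hs ⊑ ks → gs ⊑ ks
  ⊑-trans p q = record
    { keep       = keep q ∘ keep p
    ; keep-value = λ I v i → trans (keep-value q I v (keep p i)) (keep-value p I v i)
    ; keep-depth = λ i → trans (keep-depth q (keep p i)) (keep-depth p i)
    }

  ⊑-▷ : ∀ {s} {gs : Gates X n s} g → gs ⊑ gs ▷ g
  ⊑-▷ g = record { keep = suc ; keep-value = λ _ _ _ → refl ; keep-depth = λ _ → refl }

  record Extension {s} (gs : Gates X n s) (k d : ℕ) (Y : Set)
                   (F : Interpretation X → Vec Bool n → Y → Bool) : Set where
    field
      {count}   : ℕ
      extended  : Gates X n count
      extends   : gs ⊑ extended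
      size-≤    : gatesSize extended ≤ k + gatesSize gs
      -- `depth` is a maximum over all wires, not only over the outputs. The bound `D` is arbitrary
      -- because `gs` may already have wires deeper than `d`.
      shallow   : ∀ {D} → d ≤ D → (∀ i → depthAt gs i ≤ D) → ∀ i → depthAt extended i ≤ D
      out       : Y → Fin (count + n)
      out-value : ∀ (I : Interpretation X) v x → lookup (evalGates I extended v) (out x) ≡ F I v x
      out-depth : ∀ x → depthAt extended (out x) ≤ d

open Extension

-- A multi-output circuit which can be attached to any wires: it reads the
-- variables V, has the outputs Y and computes F with size k and depth d.
record Block (X V Y : Set) (k d : ℕ) (F : Interpretation X → (V → Bool) → Y → Bool) : Set where
  field
    F-cong : ∀ (I : Interpretation X) {ρ σ} → ρ ≗ σ → F I ρ ≗ F I σ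
    attach : ∀ {n s} (gs : Gates X n s) (ρ : V → Fin (s + n)) d₀ → (∀ x → depthAt gs (ρ x) ≤ d₀) →
             Extension gs k (d₀ + d) Y (λ I v → F I (λ x → lookup (evalGates I gs v) (ρ x)))

open Block

variable
  X V Y Z : Set
  k l d d′ : ℕ
  F G : Interpretation X → (V → Bool) → Y → Bool

weaken : k ≤ l → d ≤ d′ → Block X V Y k d F → Block X V Y l d′ F
weaken k≤l d≤d′ blk = record
  { F-cong = F-cong blk
  ; attach = λ gs ρ d₀ ρ≤ → let E = attach blk gs ρ d₀ ρ≤ ; le = ℕ.+-monoʳ-≤ d₀ d≤d′ in record
    { extended  = extended E
    ; extends   = extends E
    ; size-≤    = ℕ.≤-trans (size-≤ E) (ℕ.+-monoˡ-≤ _ k≤l)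
    ; shallow   = λ d≤D → shallow E (ℕ.≤-trans le d≤D)
    ; out       = out E
    ; out-value = out-value E
    ; out-depth = λ x → ℕ.≤-trans (out-depth E x) le
    }
  }

reindex : (f : Z → Y) → (∀ (I : Interpretation X) ρ x → F I ρ (f x) ≡ G I ρ x) →
          Block X V Y k d F → Block X V Z k d G
reindex f F≗G blk = record
  { F-cong = λ I ρ≗σ x → trans (sym (F≗G I _ x)) (trans (F-cong blk I ρ≗σ (f x)) (F≗G I _ x))
  ; attach = λ gs ρ d₀ ρ≤ → let E = attach blk gs ρ d₀ ρ≤ in record
    { extended  = extended E
    ; extends   = extends E
    ; size-≤    = size-≤ E
    ; shallow   = shallow E
    ; out       = out E ∘ f
    ; out-value = λ I v x → trans (out-value E I v (f x)) (F≗G I _ x)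
    ; out-depth = out-depth E ∘ f
    }
  }

wires : Block X V V 0 0 (λ _ ρ → ρ)
wires = record
  { F-cong = λ _ ρ≗σ → ρ≗σ
  ; attach = λ gs ρ d₀ ρ≤ → record
    { extended  = gs
    ; extends   = ⊑-refl
    ; size-≤    = ℕ.≤-refl
    ; shallow   = λ _ gs≤D → gs≤D
    ; out       = ρ
    ; out-value = λ _ _ _ → refl
    ; out-depth = λ x → ℕ.≤-trans (ρ≤ x) (ℕ.m≤m+n d₀ 0)
    }
  }

infixl 5 _>>>_

_>>>_ : Block X V Y k d F → Block X (V ⊎ Y) Z l d′ G →
        Block X V Z (k + l) (d + d′) (λ I ρ → G I [ ρ , F I ρ ]′)
_>>>_ {k = k} {d = d} {F = F} {l = l} {d′ = d′} {G = G} blk blk′ = record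
  { F-cong = λ I ρ≗σ → F-cong blk′ I λ { (inj₁ x) → ρ≗σ x ; (inj₂ x) → F-cong blk I ρ≗σ x }
  ; attach = λ gs ρ d₀ ρ≤ →
      let E  = attach blk gs ρ d₀ ρ≤
          ρ′ = [ keep (extends E) ∘ ρ , out E ]′
          E′ = attach blk′ (extended E) ρ′ (d₀ + d)
                 λ { (inj₁ x) → ℕ.≤-trans (ℕ.≤-reflexive (keep-depth (extends E) (ρ x))) (ℕ.≤-trans (ρ≤ x) (ℕ.m≤m+n d₀ d))
                   ; (inj₂ x) → out-depth E x }
          assoc = ℕ.+-assoc d₀ d d′
      in record
    { extended  = extended E′
    ; extends   = ⊑-trans (extends E) (extends E′)
    ; size-≤    = ℕ.≤-trans (size-≤ E′) (ℕ.≤-trans (ℕ.+-monoʳ-≤ l (size-≤ E))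
                    (ℕ.≤-reflexive (trans (sym (ℕ.+-assoc l k _)) (cong (_+ gatesSize gs) (ℕ.+-comm l k)))))
    ; shallow   = λ d≤D gs≤D → shallow E′ (ℕ.≤-trans (ℕ.≤-reflexive assoc) d≤D)
                    (shallow E (ℕ.≤-trans (ℕ.m≤m+n (d₀ + d) d′) (ℕ.≤-trans (ℕ.≤-reflexive assoc) d≤D)) gs≤D)
    ; out       = out E′
    ; out-value = λ I v x → trans (out-value E′ I v x) (F-cong blk′ I
                    (λ { (inj₁ y) → keep-value (extends E) I v (ρ y) ; (inj₂ y) → out-value E I v y }) x)
    ; out-depth = λ x → ℕ.≤-trans (out-depth E′ x) (ℕ.≤-reflexive assoc)
    }
  }

parallel : ∀ {a} {k d : Fin a → ℕ} {F : Fin a → Interpretation X → (V → Bool) → Y → Bool} →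
           (∀ i → Block X V Y (k i) (d i) (F i)) →
           Block X V (Fin a × Y) (Vec.sum (tabulate k)) (max (tabulate d)) (λ I ρ (i , x) → F i I ρ x)
parallel blks = record
  { F-cong = λ { I ρ≗σ (i , x) → F-cong (blks i) I ρ≗σ x }
  ; attach = go blks
  }
  where
  go : ∀ {a} {k d : Fin a → ℕ} {F : Fin a → Interpretation X → (V → Bool) → Y → Bool} →
       (∀ i → Block X V Y (k i) (d i) (F i)) →
       ∀ {n s} (gs : Gates X n s) (ρ : V → Fin (s + n)) d₀ → (∀ x → depthAt gs (ρ x) ≤ d₀) →
       Extension gs (Vec.sum (tabulate k)) (d₀ + max (tabulate d)) (Fin a × Y)
         (λ I v (i , x) → F i I (λ x → lookup (evalGates I gs v) (ρ x)) x)
  go {a = zero} blks gs ρ d₀ ρ≤ = record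
    { extended  = gs
    ; extends   = ⊑-refl
    ; size-≤    = ℕ.≤-refl
    ; shallow   = λ _ gs≤D → gs≤D
    ; out       = λ ()
    ; out-value = λ { _ _ () }
    ; out-depth = λ ()
    }
  go {a = suc a} {k} {d} blks gs ρ d₀ ρ≤ = record
    { extended  = extended E′
    ; extends   = ⊑-trans (extends E) (extends E′)
    ; size-≤    = ℕ.≤-trans (size-≤ E′) (ℕ.≤-trans (ℕ.+-monoʳ-≤ K (size-≤ E))
                    (ℕ.≤-reflexive (trans (sym (ℕ.+-assoc K (k zero) _)) (cong (_+ gatesSize gs) (ℕ.+-comm K (k zero))))))
    ; shallow   = λ d≤D gs≤D → shallow E′ (ℕ.≤-trans later≤ d≤D) (shallow E (ℕ.≤-trans first≤ d≤D) gs≤D)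
    ; out       = λ { (zero , x) → keep (extends E′) (out E x) ; (suc i , x) → out E′ (i , x) }
    ; out-value = λ { I v (zero  , x) → trans (keep-value (extends E′) I v (out E x)) (out-value E I v x)
                    ; I v (suc i , x) → trans (out-value E′ I v (i , x))
                                          (F-cong (blks (suc i)) I (λ y → keep-value (extends E) I v (ρ y)) x) }
    ; out-depth = λ { (zero  , x) → ℕ.≤-trans (ℕ.≤-reflexive (keep-depth (extends E′) (out E x)))
                                      (ℕ.≤-trans (out-depth E x) first≤)
                    ; (suc i , x) → ℕ.≤-trans (out-depth E′ (i , x)) later≤ }
    }
    where
    K  = Vec.sum (tabulate (k ∘ suc))
    E  = attach (blks zero) gs ρ d₀ ρ≤
    E′ = go (blks ∘ suc) (extended E) (keep (extends E) ∘ ρ) d₀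
           (λ x → ℕ.≤-trans (ℕ.≤-reflexive (keep-depth (extends E) (ρ x))) (ρ≤ x))
    first≤ : d₀ + d zero ≤ d₀ + max (tabulate d)
    first≤ = ℕ.+-monoʳ-≤ d₀ (ℕ.m≤m⊔n _ _)
    later≤ : d₀ + max (tabulate (d ∘ suc)) ≤ d₀ + max (tabulate d)
    later≤ = ℕ.+-monoʳ-≤ d₀ (ℕ.m≤n⊔m (d zero) _)

gate : ∀ {a} (g : ∀ {w} → Vec (Fin w) a → Gate X w) (f : Interpretation X → Vec Bool a → Bool) →
       (∀ {w} (is : Vec (Fin w) a) → fanIn (g is) ≡ a) →
       (∀ I {w} (is : Vec (Fin w) a) v → evalGate I (g is) v ≡ f I (Vec.map (lookup v) is)) →
       (∀ {w} (is : Vec (Fin w) a) ds → gateDepth (g is) ds ≡ suc (max (Vec.map (lookup ds) is))) →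
       Block X (Fin a) ⊤ (suc a) 1 (λ I ρ _ → f I (tabulate ρ))
gate g f g-fanIn g-eval g-depth = record
  { F-cong = λ I ρ≗σ _ → cong (f I) (Vec.tabulate-cong ρ≗σ)
  ; attach = λ gs ρ d₀ ρ≤ →
      let g≤ : gateDepth (g (tabulate ρ)) (wireDepths gs) ≤ d₀ + 1
          g≤ = ℕ.≤-trans (ℕ.≤-reflexive (trans (g-depth (tabulate ρ) (wireDepths gs))
                 (cong (suc ∘ max) (sym (Vec.tabulate-∘ (depthAt gs) ρ)))))
                 (ℕ.≤-trans (s≤s (max-tabulate-≤ (depthAt gs ∘ ρ) ρ≤)) (ℕ.≤-reflexive (ℕ.+-comm 1 d₀)))
      in record
    { extended  = gs ▷ g (tabulate ρ)
    ; extends   = ⊑-▷ (g (tabulate ρ))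
    ; size-≤    = ℕ.≤-reflexive (cong (λ x → suc x + gatesSize gs) (g-fanIn (tabulate ρ)))
    ; shallow   = λ { d≤D gs≤D zero → ℕ.≤-trans g≤ d≤D ; d≤D gs≤D (suc i) → gs≤D i }
    ; out       = λ _ → zero
    ; out-value = λ I v _ → trans (g-eval I (tabulate ρ) (evalGates I gs v))
                    (cong (f I) (sym (Vec.tabulate-∘ (lookup (evalGates I gs v)) ρ)))
    ; out-depth = λ _ → g≤
    }
  }

rename : (f : Z → V) → Block X Z Y k d F → Block X V Y k d (λ I ρ → F I (ρ ∘ f))
rename f blk = record
  { F-cong = λ I ρ≗σ → F-cong blk I (ρ≗σ ∘ f)
  ; attach = λ gs ρ d₀ ρ≤ → attach blk gs (ρ ∘ f) d₀ (ρ≤ ∘ f)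
  }

compile : (φ : Formula X V) → Block X V ⊤ (sizeᶠ φ) (depthᶠ φ) (λ I ρ _ → evalᶠ I ρ φ)
compile-gate : ∀ {a} (φ : Fin a → Formula X V)
               (g : ∀ {w} → Vec (Fin w) a → Gate X w) (f : Interpretation X → Vec Bool a → Bool) →
               (∀ {w} (is : Vec (Fin w) a) → fanIn (g is) ≡ a) →
               (∀ I {w} (is : Vec (Fin w) a) v → evalGate I (g is) v ≡ f I (Vec.map (lookup v) is)) →
               (∀ {w} (is : Vec (Fin w) a) ds → gateDepth (g is) ds ≡ suc (max (Vec.map (lookup ds) is))) →
               (∀ i → Block X V ⊤ (sizeᶠ (φ i)) (depthᶠ (φ i)) (λ I ρ _ → evalᶠ I ρ (φ i))) →
               Block X V ⊤ (suc a + Vec.sum (tabulate (sizeᶠ ∘ φ))) (suc (max (tabulate (depthᶠ ∘ φ))))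
                 (λ I ρ _ → f I (tabulate λ i → evalᶠ I ρ (φ i)))
compile-gate {a = a} φ g f g-fanIn g-eval g-depth blks =
  weaken (ℕ.≤-reflexive (ℕ.+-comm (Vec.sum (tabulate (sizeᶠ ∘ φ))) (suc a)))
         (ℕ.≤-reflexive (ℕ.+-comm (max (tabulate (depthᶠ ∘ φ))) 1))
         (parallel blks >>> rename (λ i → inj₂ (i , tt)) (gate g f g-fanIn g-eval g-depth))

compile (var x) = rename {Z = ⊤} (λ _ → x) wires
compile (neg φ) =
  weaken (ℕ.≤-reflexive (ℕ.+-comm (sizeᶠ φ) 2)) (ℕ.≤-reflexive (ℕ.+-comm (depthᶠ φ) 1))
    (compile φ >>> rename {Z = Fin 1} (λ _ → inj₂ tt) not-gate)
  where
  not-gate : Block X (Fin 1) ⊤ 2 1 (λ _ ρ _ → not (Vec.head (tabulate ρ)))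
  not-gate = gate (λ { (i ∷ []) → Not i }) (λ _ v → not (Vec.head v))
    (λ { (_ ∷ []) → refl }) (λ { _ (_ ∷ []) _ → refl })
    (λ { (i ∷ []) ds → cong suc (sym (ℕ.⊔-identityʳ (lookup ds i))) })
compile (⋀ φ)       = compile-gate φ And (λ _ → Vec.foldr _ _∧_ true)
  (λ _ → refl) (λ _ _ _ → refl) (λ _ _ → refl) (λ i → compile (φ i))
compile (⋁ φ)       = compile-gate φ Or (λ _ → Vec.foldr _ _∨_ false)
  (λ _ → refl) (λ _ _ _ → refl) (λ _ _ → refl) (λ i → compile (φ i))
compile (extra x φ) = compile-gate φ (Extra x) (λ I → I x)
  (λ _ → refl) (λ _ _ _ → refl) (λ _ _ → refl) (λ i → compile (φ i))

module ToCircuit {X : Set} {n k d : ℕ} {F : Interpretation X → (Fin n → Bool) → ⊤ → Bool}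
                 (blk : Block X (Fin n) ⊤ k d F) where

  private
    E : Extension [] k d ⊤ _
    E = attach blk [] (λ i → i) 0 (λ i → ℕ.≤-reflexive (Vec.lookup-replicate i 0))

  opaque

    circuit : Circuit X n
    circuit = record { gates = extended E ; output = out E tt }

    circuit-size : size circuit ≤ k
    circuit-size = ℕ.≤-trans (size-≤ E) (ℕ.≤-reflexive (ℕ.+-identityʳ k))

    circuit-depth : depth circuit ≤ d
    circuit-depth = subst (λ ds → max ds ≤ d) (Vec.tabulate∘lookup (wireDepths (extended E)))
      (max-tabulate-≤ _ (shallow E ℕ.≤-refl λ i → ℕ.≤-trans (ℕ.≤-reflexive (Vec.lookup-replicate i 0)) z≤n))

    circuit-eval : ∀ I v → eval I circuit v ≡ F I (lookup v) tt
    circuit-eval I v = out-value E I v tt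

-- Comparing the nodes of a power circuit

module Exponents (Π : Dag) where

  open Dag Π

  -- Opaque because comparing unfolded evaluations of concrete dags is slow.
  opaque

    e : Node → ℕ
    e P = ∣ εᴹ (Λ P) ∣

    e-unfold : ∀ P → e P ≡ ∣ εᴹ (Λ P) ∣
    e-unfold P = refl

  -- The exponent of P is not negative, so that ε P is not junk.
  record Valid (P : Node) : Set where
    constructor mkValid
    field exponent : εᴹ (Λ P) ≡ + e P

  open Valid public

  e-exponent : ∀ {P n} → εᴹ (Λ P) ≡ + n → e P ≡ n
  e-exponent {P} eq = trans (e-unfold P) (cong ∣_∣ eq)

  valid-exponent : ∀ {P n} → εᴹ (Λ P) ≡ + n → Valid P
  valid-exponent eq = mkValid (trans eq (cong +_ (sym (e-exponent eq))))

  open SignedDigits e public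

  ε-valid : ∀ {P} → Valid P → ε P ≡ + (2 ^ e P)
  ε-valid {P} valid = trans (ε-unfold P) (cong 2^_ (exponent valid))

  Supported : (Node → Set) → Marking ∣Γ∣ → Set
  Supported D M = ∀ {P} → M P ≢ 𝟎 → D P

  εᴹ-val : ∀ {M} → Supported Valid M → εᴹ M ≡ val M
  εᴹ-val {M} valid = combine-congʳ M λ P P∈ → ε-valid (valid P∈)

  ε-mono⁻ : ∀ {P Q} → Valid P → Valid Q → ε P ℤ.≤ ε Q → e P ≤ e Q
  ε-mono⁻ {P} {Q} vP vQ le = ℕ.≮⇒≥ λ lt →
    ℕ.<⇒≱ (ℕ.^-monoʳ-< 2 (s≤s (s≤s z≤n)) lt) (ℤ.drop‿+≤+ (subst₂ ℤ._≤_ (ε-valid vP) (ε-valid vQ) le))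

  ε-mono : ∀ {P Q} → Valid P → Valid Q → e P ≤ e Q → ε P ℤ.≤ ε Q
  ε-mono {P} {Q} vP vQ le = subst₂ ℤ._≤_ (sym (ε-valid vP)) (sym (ε-valid vQ)) (ℤ.+≤+ (ℕ.^-monoʳ-≤ 2 le))

  module _ {P Q} (validᴾ : Supported Valid (Λ P)) (validQ : Supported Valid (Λ Q))
           (gapᴾ : Gapped (Λ P)) (gapQ : Gapped (Λ Q))
           (injective : ∀ {S T} → Λ P S ≢ 𝟎 ⊎ Λ Q S ≢ 𝟎 → Λ P T ≢ 𝟎 ⊎ Λ Q T ≢ 𝟎 → e S ≡ e T → S ≡ T) where

    <ᶜ⇒∈ : ∀ {R} → Λ P R <ᶜ Λ Q R ⊎ Λ Q R <ᶜ Λ P R → Λ P R ≢ 𝟎 ⊎ Λ Q R ≢ 𝟎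
    <ᶜ⇒∈ {R} lt with isZero? (Λ P R) | isZero? (Λ Q R)
    ... | no P∋R  | _        = inj₁ P∋R
    ... | _       | no Q∋R   = inj₂ Q∋R
    ... | yes P∌R | yes Q∌R = ⊥-elim ([ irr P∌R Q∌R , irr Q∌R P∌R ]′ lt)
      where
      irr : ∀ {c d} → c ≡ 𝟎 → d ≡ 𝟎 → ¬ (c <ᶜ d)
      irr refl refl = ℤ.<-irrefl refl

    εᴹ-lexicographic : ∀ {R} → (∀ {S} → e R < e S → Λ P S ≡ Λ Q S) → Λ P R <ᶜ Λ Q R →
                       εᴹ (Λ P) ℤ.< εᴹ (Λ Q)
    εᴹ-lexicographic agree lt = subst₂ ℤ._<_ (sym (εᴹ-val validᴾ)) (sym (εᴹ-val validQ))
      (lexicographic gapᴾ gapQ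
        (λ S∈ eq → injective (inj₁ S∈) (<ᶜ⇒∈ (inj₁ lt)) eq)
        (λ S∈ eq → injective (inj₂ S∈) (<ᶜ⇒∈ (inj₁ lt)) eq)
        agree lt)

  valid-< : ∀ {P Q} → Valid P → Valid Q → εᴹ (Λ P) ℤ.< εᴹ (Λ Q) → e P < e Q
  valid-< vP vQ lt = ℤ.drop‿+<+ (subst₂ ℤ._<_ (exponent vP) (exponent vQ) lt)

module Correctness {k} (i : ComparisonInstance k) where

  open ComparisonInstance i
  open Exponents Π public

  valid : ∀ P → Valid P
  valid P with isPowerCircuit P
  ... | n , ε≡2^n = valid-exponent (nonneg (εᴹ (Λ P)) (trans (sym (ε-unfold P)) ε≡2^n))
    where
    nonneg : ∀ z → 2^ z ≡ + (2 ^ n) → z ≡ + ∣ z ∣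
    nonneg (+ _)    _  = refl
    -- The junk value 0 of a negative exponent is not a power of two.
    nonneg -[1+ _ ] eq = contradiction (ℤ.+-injective eq) (ℕ.<⇒≢ (ℕ.m^n>0 2 n))

  e-injective : ∀ {P Q} → e P ≡ e Q → P ≡ Q
  e-injective {P} {Q} eq with P Fin.≟ Q
  ... | yes P≡Q = P≡Q
  ... | no  P≢Q = contradiction (trans (ε-valid (valid P)) (trans (cong (λ n → + (2 ^ n)) eq) (sym (ε-valid (valid Q))))) (distinct P≢Q)

  ∣-∣≥2⇒gap : ∀ a b → ∣ + a ℤ.- + b ∣ ≥ 2 → 2 + a ≤ b ⊎ 2 + b ≤ a
  ∣-∣≥2⇒gap a b ge with ℕ.≤-total a b
  ... | inj₁ a≤b = inj₁ (ℕ.m≤o∸n⇒m+n≤o 2 a≤b (subst (2 ≤_) (trans (cong ∣_∣ (ℤ.m-n≡m⊖n a b)) (ℤ.∣⊖∣-≤ a≤b)) ge))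
  ... | inj₂ b≤a = inj₂ (ℕ.m≤o∸n⇒m+n≤o 2 b≤a
                     (subst (2 ≤_) (trans (cong ∣_∣ (ℤ.m-n≡m⊖n a b)) (trans (ℤ.∣m⊖n∣≡∣n⊖m∣ a b) (ℤ.∣⊖∣-≤ b≤a))) ge))

  gapped : ∀ P → Gapped (Λ P)
  gapped P {Q} {R} Q∈ R∈ Q≢R = ∣-∣≥2⇒gap (e Q) (e R)
    (subst₂ (λ x y → ∣ x ℤ.- y ∣ ≥ 2) (exponent (valid Q)) (exponent (valid R)) (compact P Q∈ R∈ Q≢R))

  lex⇒< : ∀ {P Q R} → (∀ {S} → e R < e S → Λ P S ≡ Λ Q S) → Λ P R <ᶜ Λ Q R → e P < e Q
  lex⇒< {P} {Q} agree lt = valid-< (valid P) (valid Q)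
    (εᴹ-lexicographic (λ _ → valid _) (λ _ → valid _) (gapped P) (gapped Q) (λ _ _ → e-injective) agree lt)

  -- The markings differ somewhere since equal markings have equal exponents. Their largest
  -- difference has the right direction, as otherwise `lex⇒<` with `P` and `Q` exchanged would
  -- contradict the hypothesis.
  <⇒lex : ∀ {P Q} → e P < e Q → ∃[ R ] Λ P R <ᶜ Λ Q R × (∀ {S} → e R < e S → Λ P S ≡ Λ Q S)
  <⇒lex {P} {Q} P<Q with Fin.any? (λ S → ¬? (Λ P S ≟ᶜ Λ Q S))
  ... | no none = contradiction (trans (e-unfold P) (trans (cong ∣_∣ (combine-cong ε same)) (sym (e-unfold Q)))) (ℕ.<⇒≢ P<Q)
    where
    same : ∀ S → Λ P S ≡ Λ Q S
    same S with Λ P S ≟ᶜ Λ Q S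
    ... | yes eq = eq
    ... | no neq = contradiction (S , neq) none
  ... | yes (S , neq) with leading-difference (Λ P) (Λ Q) neq
  ...   | R , R≢ , _ , agree with ≢⇒<ᶜ⊎>ᶜ R≢
  ...     | inj₁ lt = R , lt , agree
  ...     | inj₂ gt = contradiction (lex⇒< (λ R<S → sym (agree R<S)) gt) (ℕ.<-asym P<Q)

  Shorter : ℕ → Node → Set
  Shorter t P = ∀ {Q} (π : Star (Edge δ) P Q) → pathLength π < t

  shorter-successor : ∀ {t P R} → Shorter (suc t) P → Λ P R ≢ 𝟎 → Shorter t R
  shorter-successor short edge π = s≤s⁻¹ (short (edge ◅ π))

  Step : (Node × Node → Bool) → Node × Node → Set
  Step before (P , Q) = ∃[ R ] Λ P R <ᶜ Λ Q R × (∀ S → before (R , S) ≡ true → Λ P S ≡ Λ Q S)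

  -- The initial table may be arbitrary: `Shorter 0` holds of no node, because the empty path
  -- counts.
  rounds-correct : (before : ℕ → Node × Node → Bool) →
    (∀ t PQ → before (suc t) PQ ≡ true ⇔ Step (before t) PQ) →
    ∀ t {P Q} → Shorter t P → Shorter t Q → before t (P , Q) ≡ true ⇔ e P < e Q
  rounds-correct before step zero    shortᴾ _ = contradiction (shortᴾ ε⋆) λ ()
    where
    ε⋆ : Star (Edge δ) _ _
    ε⋆ = Star.ε
  rounds-correct before step (suc t) {P} {Q} shortᴾ shortQ = mk⇔ to from
    where
    short : ∀ {R} → Λ P R ≢ 𝟎 ⊎ Λ Q R ≢ 𝟎 → Shorter t R
    short (inj₁ P∋R) = shorter-successor shortᴾ P∋R
    short (inj₂ Q∋R) = shorter-successor shortQ Q∋R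

    -- `S` ranges over all nodes, but the old table is only known to be right for nodes of small
    -- height. A higher node is in neither support, so the two coefficients agree on it whatever the
    -- table says.
    outside : ∀ {S} → (Λ P S ≢ 𝟎 ⊎ Λ Q S ≢ 𝟎 → Λ P S ≡ Λ Q S) → Λ P S ≡ Λ Q S
    outside {S} inside with isZero? (Λ P S) | isZero? (Λ Q S)
    ... | no P∋S  | _       = inside (inj₁ P∋S)
    ... | yes _   | no Q∋S  = inside (inj₂ Q∋S)
    ... | yes P∌S | yes Q∌S = trans P∌S (sym Q∌S)

    short-R : ∀ {R} → Λ P R <ᶜ Λ Q R → Shorter t R
    short-R lt = short (<ᶜ⇒∈ {P} {Q} (λ _ → valid _) (λ _ → valid _) (gapped P) (gapped Q) (λ _ _ → e-injective) (inj₁ lt))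

    to : before (suc t) (P , Q) ≡ true → e P < e Q
    to eq with Equivalence.to (step t (P , Q)) eq
    ... | R , lt , agree = lex⇒< {R = R} (λ {S} R<S → outside λ S∈ →
      agree S (Equivalence.from (rounds-correct before step t (short-R lt) (short S∈)) R<S)) lt

    from : e P < e Q → before (suc t) (P , Q) ≡ true
    from P<Q with <⇒lex P<Q
    ... | R , lt , agree = Equivalence.from (step t (P , Q)) (R , lt , λ S RS → outside λ S∈ →
      agree (Equivalence.to (rounds-correct before step t (short-R lt) (short S∈)) RS))

-- The comparison circuit

two : Formula X V → Formula X V → Fin 2 → Formula X V
two φ ψ zero    = φ
two φ ψ (suc _) = ψ

_∧ᶠ_ _∨ᶠ_ : Formula X V → Formula X V → Formula X V
φ ∧ᶠ ψ = ⋀ (two φ ψ)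
φ ∨ᶠ ψ = ⋁ (two φ ψ)

foldr-∧-true : ∀ {a} (f : Fin a → Bool) → Vec.foldr _ _∧_ true (tabulate f) ≡ true ⇔ (∀ i → f i ≡ true)
foldr-∧-true f = mk⇔ (to f) (from f)
  where
  to : ∀ {a} (f : Fin a → Bool) → Vec.foldr _ _∧_ true (tabulate f) ≡ true → ∀ i → f i ≡ true
  to {suc a} f eq i with f zero in eq₀
  to {suc a} f eq zero    | true = eq₀
  to {suc a} f eq (suc i) | true = to (f ∘ suc) eq i
  from : ∀ {a} (f : Fin a → Bool) → (∀ i → f i ≡ true) → Vec.foldr _ _∧_ true (tabulate f) ≡ true
  from {zero}  f all = refl
  from {suc a} f all rewrite all zero = from (f ∘ suc) (all ∘ suc)

foldr-∨-true : ∀ {a} (f : Fin a → Bool) → Vec.foldr _ _∨_ false (tabulate f) ≡ true ⇔ (∃[ i ] f i ≡ true)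
foldr-∨-true f = mk⇔ (to f) (λ { (i , eq) → from f i eq })
  where
  to : ∀ {a} (f : Fin a → Bool) → Vec.foldr _ _∨_ false (tabulate f) ≡ true → ∃[ i ] f i ≡ true
  to {suc a} f eq with f zero in eq₀
  ... | true  = zero , eq₀
  ... | false with to (f ∘ suc) eq
  ...   | i , eqᵢ = suc i , eqᵢ
  from : ∀ {a} (f : Fin a → Bool) i → f i ≡ true → Vec.foldr _ _∨_ false (tabulate f) ≡ true
  from f zero    eq rewrite eq = refl
  from f (suc i) eq with f zero
  ... | true  = refl
  ... | false = from (f ∘ suc) i eq

not-true : ∀ {b} → not b ≡ true ⇔ (¬ b ≡ true)
not-true {true}  = mk⇔ (λ ()) (λ ¬t → contradiction refl ¬t)
not-true {false} = mk⇔ (λ _ ()) (λ _ → refl)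

module _ {X V : Set} (I : Interpretation X) (ρ : V → Bool) where

  infix 4 ⊨_

  ⊨_ : Formula X V → Set
  ⊨ φ = evalᶠ I ρ φ ≡ true

  ⊨-⋀ : ∀ {a} (φ : Fin a → Formula X V) → ⊨ ⋀ φ ⇔ (∀ i → ⊨ φ i)
  ⊨-⋀ φ = foldr-∧-true (λ i → evalᶠ I ρ (φ i))

  ⊨-⋁ : ∀ {a} (φ : Fin a → Formula X V) → ⊨ ⋁ φ ⇔ (∃[ i ] ⊨ φ i)
  ⊨-⋁ φ = foldr-∨-true (λ i → evalᶠ I ρ (φ i))

  ⊨-∧ : ∀ φ ψ → ⊨ φ ∧ᶠ ψ ⇔ (⊨ φ × ⊨ ψ)
  ⊨-∧ φ ψ = mk⇔ (λ p → let all = Equivalence.to (⊨-⋀ (two φ ψ)) p in all zero , all (suc zero))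
                (λ { (l , r) → Equivalence.from (⊨-⋀ (two φ ψ)) λ { zero → l ; (suc zero) → r } })

  ⊨-∨ : ∀ φ ψ → ⊨ φ ∨ᶠ ψ ⇔ (⊨ φ ⊎ ⊨ ψ)
  ⊨-∨ φ ψ = mk⇔ (λ p → case Equivalence.to (⊨-⋁ (two φ ψ)) p of λ { (zero , l) → inj₁ l ; (suc zero , r) → inj₂ r })
                [ (λ l → Equivalence.from (⊨-⋁ (two φ ψ)) (zero , l)) , (λ r → Equivalence.from (⊨-⋁ (two φ ψ)) (suc zero , r)) ]′

-- These tests are correct only on the three codes in use: the second bit alone identifies -𝟏, and
-- the first bit alone identifies 𝟎.
is : Coefficient → V → V → Formula X V
is −𝟏 nonzero negative = var negative
is 𝟎  nonzero negative = neg (var nonzero)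
is 𝟏  nonzero negative = var nonzero ∧ᶠ neg (var negative)

ltᶠ eqᶠ : V → V → V → V → Formula X V
ltᶠ x₀ x₁ y₀ y₁ = (is −𝟏 x₀ x₁ ∧ᶠ neg (is −𝟏 y₀ y₁)) ∨ᶠ (neg (is 𝟏 x₀ x₁) ∧ᶠ is 𝟏 y₀ y₁)
eqᶠ x₀ x₁ y₀ y₁ = ⋁ {a = 3} λ
  { zero             → is −𝟏 x₀ x₁ ∧ᶠ is −𝟏 y₀ y₁
  ; (suc zero)       → is 𝟎 x₀ x₁ ∧ᶠ is 𝟎 y₀ y₁
  ; (suc (suc zero)) → is 𝟏 x₀ x₁ ∧ᶠ is 𝟏 y₀ y₁
  }

module _ {I : Interpretation X} {ρ : V → Bool} {x₀ x₁ y₀ y₁ : V} (c d : Coefficient)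
         (ρx₀ : ρ x₀ ≡ lookup (bits c) zero) (ρx₁ : ρ x₁ ≡ lookup (bits c) (suc zero))
         (ρy₀ : ρ y₀ ≡ lookup (bits d) zero) (ρy₁ : ρ y₁ ≡ lookup (bits d) (suc zero)) where

  ltᶠ-true : evalᶠ I ρ (ltᶠ x₀ x₁ y₀ y₁) ≡ true ⇔ c <ᶜ d
  ltᶠ-true rewrite ρx₀ | ρx₁ | ρy₀ | ρy₁ = cases c d
    where
    cases : ∀ c d → let nx = lookup (bits c) zero; sx = lookup (bits c) (suc zero)
                        ny = lookup (bits d) zero; sy = lookup (bits d) (suc zero) in
            (sx ∧ not sy ∧ true) ∨ (not (nx ∧ not sx ∧ true) ∧ (ny ∧ not sy ∧ true) ∧ true) ∨ false ≡ true ⇔ c <ᶜ d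
    cases −𝟏 −𝟏 = mk⇔ (λ ()) (λ lt → contradiction lt (ℤ.<-irrefl refl))
    cases −𝟏 𝟎  = mk⇔ (λ _ → ℤ.-<+) (λ _ → refl)
    cases −𝟏 𝟏  = mk⇔ (λ _ → ℤ.-<+) (λ _ → refl)
    cases 𝟎  −𝟏 = mk⇔ (λ ()) (λ ())
    cases 𝟎  𝟎  = mk⇔ (λ ()) (λ lt → contradiction lt (ℤ.<-irrefl refl))
    cases 𝟎  𝟏  = mk⇔ (λ _ → ℤ.+<+ (s≤s z≤n)) (λ _ → refl)
    cases 𝟏  −𝟏 = mk⇔ (λ ()) (λ ())
    cases 𝟏  𝟎  = mk⇔ (λ ()) (λ { (ℤ.+<+ ()) })
    cases 𝟏  𝟏  = mk⇔ (λ ()) (λ lt → contradiction lt (ℤ.<-irrefl refl))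

  eqᶠ-true : evalᶠ I ρ (eqᶠ x₀ x₁ y₀ y₁) ≡ true ⇔ c ≡ d
  eqᶠ-true rewrite ρx₀ | ρx₁ | ρy₀ | ρy₁ = cases c d
    where
    cases : ∀ c d → let nx = lookup (bits c) zero; sx = lookup (bits c) (suc zero)
                        ny = lookup (bits d) zero; sy = lookup (bits d) (suc zero) in
            (sx ∧ sy ∧ true) ∨ (not nx ∧ not ny ∧ true) ∨
            ((nx ∧ not sx ∧ true) ∧ (ny ∧ not sy ∧ true) ∧ true) ∨ false ≡ true ⇔ c ≡ d
    cases −𝟏 −𝟏 = mk⇔ (λ _ → refl) (λ _ → refl)
    cases −𝟏 𝟎  = mk⇔ (λ ()) (λ ())
    cases −𝟏 𝟏  = mk⇔ (λ ()) (λ ())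
    cases 𝟎  −𝟏 = mk⇔ (λ ()) (λ ())
    cases 𝟎  𝟎  = mk⇔ (λ _ → refl) (λ _ → refl)
    cases 𝟎  𝟏  = mk⇔ (λ ()) (λ ())
    cases 𝟏  −𝟏 = mk⇔ (λ ()) (λ ())
    cases 𝟏  𝟎  = mk⇔ (λ ()) (λ ())
    cases 𝟏  𝟏  = mk⇔ (λ _ → refl) (λ _ → refl)

table : ∀ {m s d} (φ : Fin m → Fin m → Formula X V) → (∀ P Q → sizeᶠ (φ P Q) ≤ s) → (∀ P Q → depthᶠ (φ P Q) ≤ d) →
        Block X V (Fin m × Fin m) (m * (m * s)) d (λ I ρ (P , Q) → evalᶠ I ρ (φ P Q))
table {m = m} {s = s} {d = d} φ size≤ depth≤ =
  weaken (sum-tabulate-≤ _ λ P → sum-tabulate-≤ _ (size≤ P))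
         (max-tabulate-≤ _ λ P → max-tabulate-≤ _ (depth≤ P))
    (reindex (λ (P , Q) → P , Q , tt) (λ _ _ _ → refl)
      (parallel λ P → parallel λ Q → compile (φ P Q)))

iterated : (Interpretation X → (V → Bool) → Y → Bool) → (Interpretation X → (V ⊎ Y → Bool) → Y → Bool) →
           ℕ → Interpretation X → (V → Bool) → Y → Bool
iterated F G zero    = F
iterated F G (suc t) = λ I ρ → G I [ ρ , iterated F G t I ρ ]′

-- Rounds are chained as blocks, so that the outputs of a round become wires shared by all their
-- readers and sizes add up. Substituting formulas into formulas would multiply the sizes.
iterateᵇ : Block X V Y k d F → Block X (V ⊎ Y) Y l d′ G →
          ∀ t → Block X V Y (t * l + k) (t * d′ + d) (iterated F G t)
iterateᵇ blk blk′ zero = blk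
iterateᵇ {k = k} {d = d} {l = l} {d′ = d′} blk blk′ (suc t) =
  weaken (ℕ.≤-reflexive (arith (t * l) k l)) (ℕ.≤-reflexive (arith (t * d′) d d′)) (iterateᵇ blk blk′ t >>> blk′)
  where
  arith : ∀ x y z → x + y + z ≡ z + x + y
  arith = solve-∀

len : ℕ → ℕ
len m = m * (m * 2) + (m + m)

module Comparator (m : ℕ) where

  entry : Fin m → Fin m → Fin 2 → Fin (len m)
  entry P Q b = Fin.combine P (Fin.combine Q b) Fin.↑ˡ (m + m)

  first second : Fin m → Fin (len m)
  first  P = (m * (m * 2)) Fin.↑ʳ (P Fin.↑ˡ m)
  second P = (m * (m * 2)) Fin.↑ʳ (m Fin.↑ʳ P)

  Wires : Set
  Wires = Fin (len m) ⊎ (Fin m × Fin m)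

  compareEntries : (∀ {V : Set} → V → V → V → V → Formula X V) → Fin m → Fin m → Fin m → Formula X Wires
  compareEntries φ P Q R = φ (inj₁ (entry P R zero)) (inj₁ (entry P R (suc zero))) (inj₁ (entry Q R zero)) (inj₁ (entry Q R (suc zero)))

  agreeAt : Fin m → Fin m → Fin m → Fin m → Formula X Wires
  agreeAt P Q R S = neg (var (inj₂ (R , S))) ∨ᶠ compareEntries eqᶠ P Q S

  stepAt : Fin m → Fin m → Fin m → Formula X Wires
  stepAt P Q R = compareEntries ltᶠ P Q R ∧ᶠ ⋀ (agreeAt P Q R)

  step : Fin m → Fin m → Formula X Wires
  step P Q = ⋁ (stepAt P Q)

  answerAt : Fin m → Fin m → Formula X Wires
  answerAt P Q = (var (inj₁ (first P)) ∧ᶠ var (inj₁ (second Q))) ∧ᶠ neg (var (inj₂ (Q , P)))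

  answer : Formula X Wires
  answer = ⋁ λ P → ⋁ (answerAt P)

  -- Gates and wires are counted. In `stepAt`, 26 is `ltᶠ` with the outer conjunction, and 1 is the
  -- gate collecting all `S`; 33 is `agreeAt` with its wire into that gate. In `answerSize`, 8 is
  -- `answerAt`.
  stepSize answerSize : ℕ
  stepSize   = suc m + m * (27 + m * 33)
  answerSize = suc m + m * (suc m + m * 8)

  step-size : ∀ P Q → sizeᶠ (step {X = X} P Q) ≤ stepSize
  step-size {X = X} P Q = ℕ.+-monoʳ-≤ (suc m) (sum-tabulate-≤ _ λ R → bound R)
    where
    open ℕ.≤-Reasoning
    arith : ∀ m → 26 + (suc m + m * 32 + 0) ≡ 27 + m * 33
    arith = solve-∀
    bound : ∀ R → sizeᶠ (stepAt {X} P Q R) ≤ 27 + m * 33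
    bound R = begin
      26 + (suc m + _ + 0)      ≤⟨ ℕ.+-monoʳ-≤ 26 (ℕ.+-monoˡ-≤ 0 (ℕ.+-monoʳ-≤ (suc m) (sum-tabulate-≤ {m} _ {32} λ S → ℕ.≤-refl))) ⟩
      26 + (suc m + m * 32 + 0) ≡⟨ arith m ⟩
      27 + m * 33               ∎

  step-depth : ∀ P Q → depthᶠ (step {X = X} P Q) ≤ 8
  step-depth P Q = s≤s (max-tabulate-≤ {m} _ λ R → s≤s (s≤s (ℕ.⊔-lub (ℕ.m≤m+n 4 1)
    (max-tabulate-≤ {m} _ λ S → ℕ.≤-refl))))

  answer-size : sizeᶠ (answer {X = X}) ≤ answerSize
  answer-size = ℕ.+-monoʳ-≤ (suc m) (sum-tabulate-≤ {m} _ λ P → ℕ.+-monoʳ-≤ (suc m) (sum-tabulate-≤ {m} _ λ Q → ℕ.≤-refl))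

  answer-depth : depthᶠ (answer {X = X}) ≤ 4
  answer-depth = s≤s (max-tabulate-≤ {m} _ λ P → s≤s (max-tabulate-≤ {m} _ λ Q → ℕ.≤-refl))

  after : ℕ → Interpretation X → (Fin (len m) → Bool) → Fin m × Fin m → Bool
  after = iterated (λ _ _ _ → false) (λ I ρ (P , Q) → evalᶠ I ρ (step P Q))

  nothing : Block X V (Fin m × Fin m) (m * (m * 1)) 1 (λ _ _ _ → false)
  nothing = table (λ _ _ → ⋁ {a = 0} λ ()) (λ _ _ → ℕ.≤-refl) (λ _ _ → ℕ.≤-refl)

  round : Block X (Fin (len m) ⊎ (Fin m × Fin m)) (Fin m × Fin m) (m * (m * stepSize)) 8 (λ I ρ (P , Q) → evalᶠ I ρ (step P Q))
  round {X = X} = table (step {X}) (step-size {X}) (step-depth {X})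

  comparison : ∀ t → Block X (Fin (len m)) ⊤ (t * (m * (m * stepSize)) + m * (m * 1) + answerSize) (t * 8 + 1 + 4)
                 (λ I ρ _ → evalᶠ I [ ρ , after t I ρ ]′ answer)
  comparison {X} t = iterateᵇ nothing round t >>> weaken (answer-size {X}) (answer-depth {X}) (compile answer)

module Decide {k} (i : ComparisonInstance k) (I : Interpretation X) where

  open ComparisonInstance i
  open Correctness i
  open Comparator ∣Γ∣

  word : Vec Bool (len ∣Γ∣)
  word = Problem.encode (Comparison k) i

  private
    matrix : Vec Bool (∣Γ∣ * (∣Γ∣ * 2))
    matrix = Vec.concat (tabulate λ P → Vec.concat (tabulate λ Q → bits (δ P Q)))

    oneHot-true : ∀ {m} (P Q : Fin m) → lookup (oneHot P) Q ≡ true ⇔ Q ≡ P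
    oneHot-true P Q rewrite Vec.lookup∘tabulate (λ Q → does (Q Fin.≟ P)) Q with Q Fin.≟ P
    ... | yes eq = mk⇔ (λ _ → eq) (λ _ → refl)
    ... | no neq = mk⇔ (λ ()) (λ eq → contradiction eq neq)

  lookup-entry : ∀ P Q b → lookup word (entry P Q b) ≡ lookup (bits (δ P Q)) b
  lookup-entry P Q b = begin
    lookup word (entry P Q b)
      ≡⟨ Vec.lookup-++ˡ matrix (oneHot A Vec.++ oneHot B) _ ⟩
    lookup matrix (Fin.combine P (Fin.combine Q b))
      ≡⟨ Vec.lookup-concat (tabulate λ P → Vec.concat (tabulate λ Q → bits (δ P Q))) P _ ⟩
    lookup (lookup (tabulate λ P → Vec.concat (tabulate λ Q → bits (δ P Q))) P) (Fin.combine Q b)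
      ≡⟨ cong (λ v → lookup v (Fin.combine Q b)) (Vec.lookup∘tabulate _ P) ⟩
    lookup (Vec.concat (tabulate λ Q → bits (δ P Q))) (Fin.combine Q b)
      ≡⟨ Vec.lookup-concat (tabulate λ Q → bits (δ P Q)) Q b ⟩
    lookup (lookup (tabulate λ Q → bits (δ P Q)) Q) b
      ≡⟨ cong (λ v → lookup v b) (Vec.lookup∘tabulate _ Q) ⟩
    lookup (bits (δ P Q)) b ∎
    where open ≡-Reasoning

  lookup-first : ∀ P → lookup word (first P) ≡ true ⇔ P ≡ A
  lookup-first P = subst (λ b → b ≡ true ⇔ P ≡ A)
    (sym (trans (Vec.lookup-++ʳ matrix (oneHot A Vec.++ oneHot B) (P Fin.↑ˡ ∣Γ∣)) (Vec.lookup-++ˡ (oneHot A) (oneHot B) P)))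
    (oneHot-true A P)

  lookup-second : ∀ P → lookup word (second P) ≡ true ⇔ P ≡ B
  lookup-second P = subst (λ b → b ≡ true ⇔ P ≡ B)
    (sym (trans (Vec.lookup-++ʳ matrix (oneHot A Vec.++ oneHot B) (∣Γ∣ Fin.↑ʳ P)) (Vec.lookup-++ʳ (oneHot A) (oneHot B) P)))
    (oneHot-true B P)

  module _ (before : Node × Node → Bool) where

    private
      ρ = [ lookup word , before ]′

      ltᶠ-entry : ∀ P Q R → evalᶠ I ρ (compareEntries ltᶠ P Q R) ≡ true ⇔ Λ P R <ᶜ Λ Q R
      ltᶠ-entry P Q R = ltᶠ-true {I = I} {ρ}
        {inj₁ (entry P R zero)} {inj₁ (entry P R (suc zero))} {inj₁ (entry Q R zero)} {inj₁ (entry Q R (suc zero))} (δ P R) (δ Q R) (lookup-entry P R _) (lookup-entry P R _) (lookup-entry Q R _) (lookup-entry Q R _)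

      eqᶠ-entry : ∀ P Q R → evalᶠ I ρ (compareEntries eqᶠ P Q R) ≡ true ⇔ Λ P R ≡ Λ Q R
      eqᶠ-entry P Q R = eqᶠ-true {I = I} {ρ}
        {inj₁ (entry P R zero)} {inj₁ (entry P R (suc zero))} {inj₁ (entry Q R zero)} {inj₁ (entry Q R (suc zero))} (δ P R) (δ Q R) (lookup-entry P R _) (lookup-entry P R _) (lookup-entry Q R _) (lookup-entry Q R _)

    open Equivalence

    step-true : ∀ P Q → evalᶠ I ρ (step P Q) ≡ true ⇔ Step before (P , Q)
    step-true P Q = mk⇔ forth back
      where
      forth : evalᶠ I ρ (step P Q) ≡ true → Step before (P , Q)
      forth p with to (⊨-⋁ I ρ (stepAt P Q)) p
      ... | R , q with to (⊨-∧ I ρ (compareEntries ltᶠ P Q R) (⋀ (agreeAt P Q R))) q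
      ...   | lt , all = R , to (ltᶠ-entry P Q R) lt , agree
        where
        agree : ∀ S → before (R , S) ≡ true → Λ P S ≡ Λ Q S
        agree S RS with to (⊨-∨ I ρ (neg (var (inj₂ (R , S)))) (compareEntries eqᶠ P Q S)) (to (⊨-⋀ I ρ (agreeAt P Q R)) all S)
        ... | inj₁ ¬RS = contradiction RS (to not-true ¬RS)
        ... | inj₂ eq  = to (eqᶠ-entry P Q S) eq
      back : Step before (P , Q) → evalᶠ I ρ (step P Q) ≡ true
      back (R , lt , agree) = from (⊨-⋁ I ρ (stepAt P Q)) (R , from (⊨-∧ I ρ (compareEntries ltᶠ P Q R) (⋀ (agreeAt P Q R)))
        (from (ltᶠ-entry P Q R) lt , from (⊨-⋀ I ρ (agreeAt P Q R)) λ S →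
          from (⊨-∨ I ρ (neg (var (inj₂ (R , S)))) (compareEntries eqᶠ P Q S)) (decide S (before (R , S)) refl)))
        where
        decide : ∀ S b → before (R , S) ≡ b → not (before (R , S)) ≡ true ⊎ evalᶠ I ρ (compareEntries eqᶠ P Q S) ≡ true
        decide S true  eq = inj₂ (from (eqᶠ-entry P Q S) (agree S eq))
        decide S false eq = inj₁ (cong not eq)

    answer-true : (∀ P Q → before (P , Q) ≡ true ⇔ e P < e Q) → evalᶠ I ρ answer ≡ true ⇔ ε A ℤ.≤ ε B
    answer-true before-correct = mk⇔ forth back
      where
      forth : evalᶠ I ρ answer ≡ true → ε A ℤ.≤ ε B
      forth p with to (⊨-⋁ I ρ λ P → ⋁ (answerAt P)) p
      ... | P , q with to (⊨-⋁ I ρ (answerAt P)) q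
      ...   | Q , r with to (⊨-∧ I ρ (var (inj₁ (first P)) ∧ᶠ var (inj₁ (second Q))) (neg (var (inj₂ (Q , P))))) r
      ...     | PQ , ¬before with to (⊨-∧ I ρ (var (inj₁ (first P))) (var (inj₁ (second Q)))) PQ
      ...       | p≡A , q≡B with to (lookup-first P) p≡A | to (lookup-second Q) q≡B
      ...         | refl | refl = ε-mono (valid A) (valid B)
                    (ℕ.≮⇒≥ λ lt → to not-true ¬before (from (before-correct B A) lt))
      back : ε A ℤ.≤ ε B → evalᶠ I ρ answer ≡ true
      back le = from (⊨-⋁ I ρ λ P → ⋁ (answerAt P)) (A , from (⊨-⋁ I ρ (answerAt A)) (B ,
        from (⊨-∧ I ρ (var (inj₁ (first A)) ∧ᶠ var (inj₁ (second B))) (neg (var (inj₂ (B , A)))))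
          ( from (⊨-∧ I ρ (var (inj₁ (first A))) (var (inj₁ (second B)))) (from (lookup-first A) refl , from (lookup-second B) refl)
          , from not-true λ p → ℕ.<⇒≱ (to (before-correct B A) p) (ε-mono⁻ (valid A) (valid B) le))))

-- Growth rates and membership in TC^k

^-distribʳ-* : ∀ k m n → (m * n) ^ k ≡ m ^ k * n ^ k
^-distribʳ-* zero    m n = refl
^-distribʳ-* (suc k) m n = trans (cong (m * n *_) (^-distribʳ-* k m n)) (ℕ.[m*n]*[o*p]≡[m*o]*[n*p] m n (m ^ k) (n ^ k))

2^-cancel-≤ : ∀ {m n} → 2 ^ m ≤ 2 ^ n → m ≤ n
2^-cancel-≤ le = ℕ.≮⇒≥ λ lt → ℕ.<⇒≱ (ℕ.^-monoʳ-< 2 (s≤s (s≤s z≤n)) lt) le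

lgStep : ℕ → ℕ → ℕ
lgStep n l = if n ≤ᵇ 2 ^ l then l else suc l

-- For `n` ≥ 1 this is the binary logarithm rounded up.
lg : ℕ → ℕ
lg zero    = 0
lg (suc n) = lgStep (suc n) (lg n)

n≤2^lgStep : ∀ n l → n ≤ 2 ^ l → suc n ≤ 2 ^ lgStep (suc n) l
n≤2^lgStep n l n≤2^l with suc n ≤ᵇ 2 ^ l in eq
... | true  = ℕ.≤ᵇ⇒≤ (suc n) (2 ^ l) (subst T (sym eq) tt)
... | false = ℕ.≤-trans (ℕ.+-mono-≤ (ℕ.m^n>0 2 l) n≤2^l) (ℕ.≤-reflexive (cong (λ x → 2 ^ l + x) (sym (ℕ.+-identityʳ (2 ^ l)))))

2^lgStep≤2n : ∀ n l → 2 ^ l ≤ 2 * n → 2 ^ lgStep (suc n) l ≤ 2 * suc n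
2^lgStep≤2n n l 2^l≤2n with suc n ≤ᵇ 2 ^ l in eq
... | true  = ℕ.≤-trans 2^l≤2n (ℕ.*-monoʳ-≤ 2 (ℕ.n≤1+n n))
... | false = ℕ.*-monoʳ-≤ 2 (ℕ.<⇒≤ (ℕ.≰⇒> λ le → subst T eq (ℕ.≤⇒≤ᵇ {suc n} {2 ^ l} le)))

n≤2^lg : ∀ n → n ≤ 2 ^ lg n
n≤2^lg zero    = z≤n
n≤2^lg (suc n) = n≤2^lgStep n (lg n) (n≤2^lg n)

2^lg≤2n : ∀ n → n ≥ 1 → 2 ^ lg n ≤ 2 * n
2^lg≤2n (suc zero)    _ = s≤s z≤n
2^lg≤2n (suc (suc n)) _ = 2^lgStep≤2n (suc n) (lg (suc n)) (2^lg≤2n (suc n) (s≤s z≤n))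

lg≤n : ∀ n → lg n ≤ n
lg≤n zero    = z≤n
lg≤n (suc n) with suc n ≤ᵇ 2 ^ lg n
... | true  = ℕ.≤-trans (lg≤n n) (ℕ.n≤1+n n)
... | false = s≤s (lg≤n n)

-- The bound is instantiated at the rational `L`/1, which is an upper bound of the logarithm.
≤-c·log^⁻ : ∀ {k n c d L} → n ≤ 2 ^ L → d ≤ c ·log^ k ⟨ n ⟩ → d ≤ c * L ^ k
≤-c·log^⁻ {k} {n} {c} {d} {L} n≤2^L bound = begin
  d         ≡⟨ ℕ.*-identityʳ d ⟨
  d * 1     ≡⟨ cong (d *_) (ℕ.^-zeroˡ k) ⟨
  d * 1 ^ k ≤⟨ bound L 1 (s≤s z≤n) (ℕ.≤-trans (ℕ.≤-reflexive (ℕ.*-identityʳ n)) n≤2^L) ⟩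
  c * L ^ k ∎
  where open ℕ.≤-Reasoning

≤-c·log^ : ∀ {k n a b d L} → n ≥ 2 → 2 ^ L ≤ n → d ≤ a + b * L ^ k → d ≤ (a + b) ·log^ k ⟨ n ⟩
≤-c·log^ {k} {n} {a} {b} {d} {L} n≥2 2^L≤n d≤ p q q≥1 n^q≤2^p = begin
  d * q ^ k                     ≤⟨ ℕ.*-monoˡ-≤ (q ^ k) d≤ ⟩
  (a + b * L ^ k) * q ^ k       ≡⟨ ℕ.*-distribʳ-+ (q ^ k) a (b * L ^ k) ⟩
  a * q ^ k + b * L ^ k * q ^ k ≡⟨ cong (λ x → a * q ^ k + x) (trans (ℕ.*-assoc b _ _) (cong (b *_) (sym (^-distribʳ-* k L q)))) ⟩
  a * q ^ k + b * (L * q) ^ k   ≤⟨ ℕ.+-mono-≤ (ℕ.*-monoʳ-≤ a (ℕ.^-monoˡ-≤ k q≤p)) (ℕ.*-monoʳ-≤ b (ℕ.^-monoˡ-≤ k (power-≤ {L} 2^L≤n))) ⟩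
  a * p ^ k + b * p ^ k         ≡⟨ ℕ.*-distribʳ-+ (p ^ k) a b ⟨
  (a + b) * p ^ k               ∎
  where
  open ℕ.≤-Reasoning
  power-≤ : ∀ {L} → 2 ^ L ≤ n → L * q ≤ p
  power-≤ {L} le = 2^-cancel-≤ (ℕ.≤-trans (ℕ.≤-reflexive (sym (ℕ.^-*-assoc 2 L q))) (ℕ.≤-trans (ℕ.^-monoˡ-≤ q le) n^q≤2^p))
  q≤p : q ≤ p
  q≤p = subst (_≤ p) (ℕ.*-identityˡ q) (power-≤ {1} n≥2)

-- `Polynomial` with the threshold fixed at 1, so that bounds can be added and multiplied without
-- comparing thresholds.
Poly : (ℕ → ℕ) → Set
Poly f = ∃₂ λ c e → ∀ n → n ≥ 1 → f n ≤ c * n ^ e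

^-monoʳ′ : ∀ {n d e} → n ≥ 1 → d ≤ e → n ^ d ≤ n ^ e
^-monoʳ′ {suc n} _ = ℕ.^-monoʳ-≤ (suc n)

poly-const : ∀ c → Poly (λ _ → c)
poly-const c = c , 0 , λ n _ → ℕ.≤-reflexive (sym (ℕ.*-identityʳ c))

poly-id : Poly (λ n → n)
poly-id = 1 , 1 , λ n _ → ℕ.≤-reflexive (sym (trans (ℕ.*-identityˡ _) (ℕ.*-identityʳ n)))

poly-+ : ∀ {f g} → Poly f → Poly g → Poly (λ n → f n + g n)
poly-+ {f} {g} (a , d , f≤) (b , e , g≤) = a + b , d + e , λ n n≥1 → begin
  f n + g n                         ≤⟨ ℕ.+-mono-≤ (f≤ n n≥1) (g≤ n n≥1) ⟩
  a * n ^ d + b * n ^ e             ≤⟨ ℕ.+-mono-≤ (ℕ.*-monoʳ-≤ a (^-monoʳ′ n≥1 (ℕ.m≤m+n d e))) (ℕ.*-monoʳ-≤ b (^-monoʳ′ n≥1 (ℕ.m≤n+m e d))) ⟩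
  a * n ^ (d + e) + b * n ^ (d + e) ≡⟨ ℕ.*-distribʳ-+ (n ^ (d + e)) a b ⟨
  (a + b) * n ^ (d + e)             ∎
  where open ℕ.≤-Reasoning

poly-* : ∀ {f g} → Poly f → Poly g → Poly (λ n → f n * g n)
poly-* {f} {g} (a , d , f≤) (b , e , g≤) = a * b , d + e , λ n n≥1 → begin
  f n * g n                 ≤⟨ ℕ.*-mono-≤ (f≤ n n≥1) (g≤ n n≥1) ⟩
  a * n ^ d * (b * n ^ e)   ≡⟨ ℕ.[m*n]*[o*p]≡[m*o]*[n*p] a (n ^ d) b (n ^ e) ⟩
  a * b * (n ^ d * n ^ e)   ≡⟨ cong (a * b *_) (ℕ.^-distribˡ-+-* n d e) ⟨
  a * b * n ^ (d + e)       ∎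
  where open ℕ.≤-Reasoning

poly-^ : ∀ {f} k → Poly f → Poly (λ n → f n ^ k)
poly-^ zero    _  = poly-const 1
poly-^ (suc k) pf = poly-* pf (poly-^ k pf)

poly-≤ : ∀ {f g} → (∀ n → n ≥ 1 → f n ≤ g n) → Poly g → Poly f
poly-≤ f≤g (c , e , g≤) = c , e , λ n n≥1 → ℕ.≤-trans (f≤g n n≥1) (g≤ n n≥1)

infixl 6 _⊕_
infixl 7 _⊗_
_⊕_ = poly-+
_⊗_ = poly-*

m≤len : ∀ m → m ≤ len m
m≤len m = ℕ.≤-trans (ℕ.m≤m+n m m) (ℕ.m≤n+m _ (m * (m * 2)))

len≥1⇒≥1 : ∀ m → len m ≥ 1 → m ≥ 1
len≥1⇒≥1 (suc _) _ = s≤s z≤n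

len-mono-< : ∀ {m n} → m < n → len m < len n
len-mono-< lt = ℕ.+-mono-≤-< (ℕ.*-mono-≤ (ℕ.<⇒≤ lt) (ℕ.*-monoˡ-≤ 2 (ℕ.<⇒≤ lt))) (ℕ.+-mono-< lt lt)

len-injective : ∀ {m n} → len m ≡ len n → m ≡ n
len-injective {m} {n} eq with ℕ.<-cmp m n
... | tri< lt _ _ = contradiction eq (ℕ.<⇒≢ (len-mono-< lt))
... | tri≈ _ m≡n _ = m≡n
... | tri> _ _ gt = contradiction (sym eq) (ℕ.<⇒≢ (len-mono-< gt))

len⁻¹? : ∀ n → Dec (∃[ m ] len m ≡ n)
len⁻¹? n with Fin.any? {n = suc n} (λ m → len (toℕ m) ℕ.≟ n)
... | yes (m , eq) = yes (toℕ m , eq)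
... | no none = no λ (m , eq) →
  let m<1+n : m < suc n
      m<1+n = s≤s (ℕ.≤-trans (m≤len m) (ℕ.≤-reflexive eq))
  in none (Fin.fromℕ< m<1+n , trans (cong len {toℕ (Fin.fromℕ< m<1+n)} {m} (Fin.toℕ-fromℕ< m<1+n)) eq)

module UpperBound (k : ℕ) where

  -- One more than an upper bound of the depth, because `Shorter` is strict.
  rounds : ℕ → ℕ
  rounds m = suc (lg m ^ k)

  sizeBound : ℕ → ℕ
  sizeBound m = rounds m * (m * (m * stepSize)) + m * (m * 1) + answerSize
    where open Comparator m

  opaque

    comparator : ∀ m → Block ⊤ (Fin (len m)) ⊤ (sizeBound m) (rounds m * 8 + 1 + 4)
                   (λ I ρ _ → evalᶠ I [ ρ , Comparator.after m (rounds m) I ρ ]′ (Comparator.answer m))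
    comparator m = Comparator.comparison m (rounds m)

  forLength : ∀ n → Dec (∃[ m ] len m ≡ n) → Circuit ⊤ n
  forLength n (yes (m , refl)) = ToCircuit.circuit (comparator m)
  -- No instance has this length, so any small circuit will do.
  forLength n (no _)           = record { gates = [] ▷ Or [] ; output = zero }

  -- The length of a word determines the number of nodes, so it does not matter which witness the
  -- decision procedure finds.
  forLength-len : ∀ m m′ (eq : len m′ ≡ len m) → forLength (len m) (yes (m′ , eq)) ≡ ToCircuit.circuit (comparator m)
  forLength-len m m′ eq with len-injective {m′} {m} eq
  ... | refl with ℕ.≡-irrelevant eq refl
  ...   | refl = refl

  family : Family ⊤
  family n = forLength n (len⁻¹? n)

  -- Opaque so that the constants are not computed.
  opaque

    poly-sizeBound : Poly sizeBound
    poly-sizeBound =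
      poly-≤ (λ n _ → s≤s (ℕ.^-monoˡ-≤ k (lg≤n n))) (poly-const 1 ⊕ poly-^ k poly-id)
        ⊗ (poly-id ⊗ (poly-id ⊗ (poly-const 1 ⊕ poly-id ⊕ poly-id ⊗ (poly-const 27 ⊕ poly-id ⊗ poly-const 33))))
      ⊕ poly-id ⊗ (poly-id ⊗ poly-const 1)
      ⊕ (poly-const 1 ⊕ poly-id ⊕ poly-id ⊗ (poly-const 1 ⊕ poly-id ⊕ poly-id ⊗ poly-const 8))

  family-size : Polynomial (λ n → size (family n))
  family-size = c + 1 , e , 1 , λ n n≥1 → go n n≥1 (len⁻¹? n)
    where
    open ℕ.≤-Reasoning
    c e : ℕ
    c = proj₁ poly-sizeBound
    e = proj₁ (proj₂ poly-sizeBound)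
    go : ∀ n → n ≥ 1 → (d : Dec (∃[ m ] len m ≡ n)) → size (forLength n d) ≤ (c + 1) * n ^ e
    go n n≥1 (no _) = begin
      1               ≤⟨ ^-monoʳ′ {n} {0} {e} n≥1 z≤n ⟩
      n ^ e           ≤⟨ ℕ.m≤n+m _ (c * n ^ e) ⟩
      c * n ^ e + n ^ e ≡⟨ cong (λ x → c * n ^ e + x) (ℕ.*-identityˡ (n ^ e)) ⟨
      c * n ^ e + 1 * n ^ e ≡⟨ ℕ.*-distribʳ-+ (n ^ e) c 1 ⟨
      (c + 1) * n ^ e ∎
    go n n≥1 (yes (m , refl)) = begin
      size (ToCircuit.circuit (comparator m)) ≤⟨ ToCircuit.circuit-size (comparator m) ⟩
      sizeBound m                             ≤⟨ proj₂ (proj₂ poly-sizeBound) m (len≥1⇒≥1 m n≥1) ⟩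
      c * m ^ e                               ≤⟨ ℕ.*-mono-≤ (ℕ.m≤m+n c 1) (ℕ.^-monoˡ-≤ e (m≤len m)) ⟩
      (c + 1) * len m ^ e                     ∎

  family-depth : O[log^ k ] (λ n → depth (family n))
  family-depth = 13 + 8 , 2 , λ n n≥2 → go n n≥2 (len⁻¹? n)
    where
    go : ∀ n → n ≥ 2 → (d : Dec (∃[ m ] len m ≡ n)) → depth (forLength n d) ≤ (13 + 8) ·log^ k ⟨ n ⟩
    go n n≥2 (no _) = ≤-c·log^ {k} {n} {13} {8} {L = 0} n≥2 (ℕ.≤-trans (s≤s z≤n) n≥2)
      (ℕ.⊔-lub (s≤s z≤n) (ℕ.≤-trans (ℕ.≤-reflexive (replicate-0 n)) z≤n))
      where
      replicate-0 : ∀ n → max (Vec.replicate n 0) ≡ 0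
      replicate-0 zero    = refl
      replicate-0 (suc n) = replicate-0 n
    go n n≥2 (yes (m , refl)) = ≤-c·log^ {k} {len m} {13} {8} {L = lg m} n≥2
      (ℕ.≤-trans (2^lg≤2n m (len≥1⇒≥1 m (ℕ.≤-trans (s≤s z≤n) n≥2))) (ℕ.≤-trans (ℕ.≤-reflexive (cong (λ x → m + x) (ℕ.+-identityʳ m))) (ℕ.m≤n+m (m + m) (m * (m * 2)))))
      (ℕ.≤-trans (ToCircuit.circuit-depth (comparator m)) (ℕ.≤-reflexive (arith (lg m ^ k))))
      where
      arith : ∀ x → suc x * 8 + 1 + 4 ≡ 13 + 8 * x
      arith = solve-∀

  family-decides : DecidesWith majority family (Comparison k)
  family-decides i = subst (λ b → b ≡ true ⇔ ε A ℤ.≤ ε B) (sym (evaluate (len⁻¹? (len ∣Γ∣))))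
    (answer-true (before (rounds ∣Γ∣)) λ P Q → rounds-correct before (λ t PQ → step-true (before t) (proj₁ PQ) (proj₂ PQ)) (rounds ∣Γ∣) short short)
    where
    open ComparisonInstance i
    open Correctness i
    open Decide i majority
    before : ℕ → Node × Node → Bool
    before t = Comparator.after ∣Γ∣ t majority (lookup word)
    short : ∀ {P} → Shorter (rounds ∣Γ∣) P
    short π with depthBound
    ... | d , (_ , longest) , d≤log = s≤s (ℕ.≤-trans (longest π)
      (ℕ.≤-trans (≤-c·log^⁻ {k} {c = 1} (n≤2^lg ∣Γ∣) d≤log) (ℕ.≤-reflexive (ℕ.*-identityˡ (lg ∣Γ∣ ^ k)))))
    evaluate : ∀ d → eval majority (forLength (len ∣Γ∣) d) word ≡ evalᶠ majority [ lookup word , before (rounds ∣Γ∣) ]′ (Comparator.answer ∣Γ∣)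
    evaluate (no none) = contradiction (∣Γ∣ , refl) none
    evaluate (yes (m , eq)) = trans (cong (λ C → eval majority C word) (forLength-len ∣Γ∣ m eq))
      (ToCircuit.circuit-eval (comparator ∣Γ∣) majority word)

  comparison∈TC : TC k (Comparison k)
  comparison∈TC = family , record { polynomialSize = family-size ; logDepth = family-depth } , family-decides

-- Power circuits from networks of negated disjunctions

n<2^n : ∀ n → n < 2 ^ n
n<2^n zero    = s≤s z≤n
n<2^n (suc n) = ℕ.+-mono-≤ (ℕ.m^n>0 2 n) (ℕ.≤-trans (n<2^n n) (ℕ.≤-reflexive (sym (ℕ.+-identityʳ _))))

-- A leading digit 1 of exponent `n` gives three times the value more than 2^(1+n); by this
-- inequality the value then exceeds `n` itself. Exponents therefore grow from layer to layer.
3n<2^[1+n] : ∀ n → 3 * n < 2 ^ suc n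
3n<2^[1+n] zero          = s≤s z≤n
3n<2^[1+n] (suc zero)    = ℕ.≤-refl
3n<2^[1+n] (suc n@(suc m)) = begin-strict
  3 * suc n         ≡⟨ arith m ⟩
  3 * n + 3         ≤⟨ ℕ.+-monoʳ-≤ (3 * n) (ℕ.*-monoʳ-≤ 3 (s≤s (z≤n {m}))) ⟩
  3 * n + 3 * n     <⟨ ℕ.+-mono-< (3n<2^[1+n] n) (3n<2^[1+n] n) ⟩
  2 ^ suc n + 2 ^ suc n ≡⟨ cong (λ x → 2 ^ suc n + x) (ℕ.+-identityʳ (2 ^ suc n)) ⟨
  2 ^ suc (suc n)   ∎
  where
  open ℕ.≤-Reasoning
  arith : ∀ m → 3 * suc (suc m) ≡ 3 * suc m + 3
  arith = solve-∀

-- The source of compactness in the constructed circuits: there, exponents are only shown to be even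
-- and distinct.
even-gap : ∀ {a b} → 2 ∣ a → 2 ∣ b → a ≢ b → 2 + a ≤ b ⊎ 2 + b ≤ a
even-gap (divides x refl) (divides y refl) a≢b with ℕ.<-cmp x y
... | tri< x<y _ _  = inj₁ (ℕ.*-monoˡ-≤ 2 x<y)
... | tri≈ _ refl _ = contradiction refl a≢b
... | tri> _ _ y<x  = inj₂ (ℕ.*-monoˡ-≤ 2 y<x)

combine-even : ∀ {m} (M : Marking m) (v : Fin m → ℤ) → (∀ P → M P ≢ 𝟎 → + 2 ∣ᶻ v P) → + 2 ∣ᶻ combine M v
combine-even {zero}  M v even = dividesᶻ (+ 0) refl
combine-even {suc m} M v even = ∣m∣n⇒∣m+n (head (isZero? (M zero))) (combine-even (M ∘ suc) (v ∘ suc) (even ∘ suc))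
  where
  head : Dec (M zero ≡ 𝟎) → + 2 ∣ᶻ ⟦ M zero ⟧ ℤ.* v zero
  head (yes ≡𝟎) rewrite ≡𝟎 = dividesᶻ (+ 0) refl
  head (no  ≢𝟎) = ∣n⇒∣m*n ⟦ M zero ⟧ (even zero ≢𝟎)

2∣2^ : ∀ {n} → 1 ≤ n → 2 ∣ 2 ^ n
2∣2^ {suc n} _ = divides (2 ^ n) (ℕ.*-comm 2 (2 ^ n))

pattern H        = zero
pattern θ        = suc zero
pattern vertex v = suc (suc v)

-- The nodes: a chain of towers of twos, the layers 0, …, L of width 2 + N, and
-- padding.  All markings differ since the marking of a node which is not in the
-- chain contains the ternary digits of its number, as coefficients of the chain.
module Layout (N L b : ℕ) (fits : 4 + b + suc L * (2 + N) ≤ 3 ^ b) where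

  r width layers rest : ℕ
  r      = 2 + (b + 2)
  width  = 2 + N
  layers = suc L * width

  private
    r≡4+b : r ≡ 4 + b
    r≡4+b = cong (λ x → 2 + x) (ℕ.+-comm b 2)

    padding : ∃[ rest ] r + layers + rest ≡ 3 ^ b
    padding = ℕ.m≤n⇒∃[o]m+o≡n (ℕ.≤-trans (ℕ.≤-reflexive (cong (_+ layers) r≡4+b)) fits)

  rest = proj₁ padding

  Node : Set
  Node = Fin (3 ^ b)

  data Kind : Set where
    chain : Fin r → Kind
    slot  : Fin (suc L) → Fin width → Kind
    pad   : Kind

  private
    total : r + (layers + rest) ≡ 3 ^ b
    total = trans (sym (ℕ.+-assoc r layers rest)) (proj₂ padding)

    kindᵖ : Fin layers ⊎ Fin rest → Kind
    kindᵖ (inj₁ i) = uncurry slot (Fin.remQuot {suc L} width i)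
    kindᵖ (inj₂ _) = pad

    kindʳ : Fin r ⊎ Fin (layers + rest) → Kind
    kindʳ (inj₁ j) = chain j
    kindʳ (inj₂ i) = kindᵖ (Fin.splitAt layers i)

  opaque

    kind : Node → Kind
    kind P = kindʳ (Fin.splitAt r (Fin.cast (sym total) P))

    chainAt : Fin r → Node
    chainAt j = Fin.cast total (j Fin.↑ˡ (layers + rest))

    slotAt : Fin (suc L) → Fin width → Node
    slotAt t u = Fin.cast total (r Fin.↑ʳ (Fin.combine t u Fin.↑ˡ rest))

    kind-chainAt : ∀ j → kind (chainAt j) ≡ chain j
    kind-chainAt j rewrite Fin.cast-involutive (sym total) total (j Fin.↑ˡ (layers + rest))
                         | Fin.splitAt-↑ˡ r j (layers + rest) = refl

    kind-slotAt : ∀ t u → kind (slotAt t u) ≡ slot t u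
    kind-slotAt t u rewrite Fin.cast-involutive (sym total) total (r Fin.↑ʳ (Fin.combine t u Fin.↑ˡ rest))
                          | Fin.splitAt-↑ʳ r (layers + rest) (Fin.combine t u Fin.↑ˡ rest)
                          | Fin.splitAt-↑ˡ layers (Fin.combine t u) rest
      = cong (uncurry slot) (Fin.remQuot-combine {suc L} {width} t u)

    kind-chain⁻¹ : ∀ {P j} → kind P ≡ chain j → P ≡ chainAt j
    kind-chain⁻¹ {P} eq with Fin.splitAt r (Fin.cast (sym total) P) in split
    kind-chain⁻¹ {P} refl | inj₁ j =
      trans (sym (Fin.cast-involutive total (sym total) P)) (cong (Fin.cast total) (sym (Fin.splitAt⁻¹-↑ˡ split)))
    kind-chain⁻¹ {P} eq | inj₂ i with Fin.splitAt layers i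
    kind-chain⁻¹ {P} () | inj₂ i | inj₁ _
    kind-chain⁻¹ {P} () | inj₂ i | inj₂ _

    kind-slot⁻¹ : ∀ {P t u} → kind P ≡ slot t u → P ≡ slotAt t u
    kind-slot⁻¹ {P} eq with Fin.splitAt r (Fin.cast (sym total) P) in split
    kind-slot⁻¹ {P} () | inj₁ j
    kind-slot⁻¹ {P} eq | inj₂ i with Fin.splitAt layers i in split′
    kind-slot⁻¹ {P} refl | inj₂ i | inj₁ x =
      trans (sym (Fin.cast-involutive total (sym total) P)) (cong (Fin.cast total)
        (trans (sym (Fin.splitAt⁻¹-↑ʳ split)) (cong (r Fin.↑ʳ_)
          (trans (sym (Fin.splitAt⁻¹-↑ˡ split′)) (cong (Fin._↑ˡ rest) (sym (Fin.combine-remQuot {suc L} width x)))))))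
    kind-slot⁻¹ {P} () | inj₂ i | inj₂ _

  trit : Fin 3 → Coefficient
  trit zero             = −𝟏
  trit (suc zero)       = 𝟎
  trit (suc (suc zero)) = 𝟏

  trit-injective : ∀ {i j} → trit i ≡ trit j → i ≡ j
  trit-injective {zero}           {zero}           _ = refl
  trit-injective {zero}           {suc zero}       ()
  trit-injective {zero}           {suc (suc zero)} ()
  trit-injective {suc zero}       {zero}           ()
  trit-injective {suc zero}       {suc (suc zero)} ()
  trit-injective {suc (suc zero)} {zero}           ()
  trit-injective {suc (suc zero)} {suc zero}       ()
  trit-injective {suc zero}       {suc zero}       _ = refl
  trit-injective {suc (suc zero)} {suc (suc zero)} _ = refl

  -- Only the node H of layer 0 has the second largest node of the chain in its
  -- marking; this makes H the largest node of that layer.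
  lift : Kind → Coefficient
  lift (slot zero H) = 𝟏
  lift _             = 𝟎

  -- The constant coefficient 𝟏 at the top of the chain outweighs the digits below it, so the
  -- marking of a node without successors outside the chain is positive whatever its number is.
  label′ : Node → Kind → Fin b ⊎ Fin 2 → Coefficient
  label′ P κ (inj₁ d)          = trit (Fin.finToFun P d)
  label′ P κ (inj₂ zero)       = lift κ
  label′ P κ (inj₂ (suc zero)) = 𝟏

  label : Node → Kind → Fin r → Coefficient
  label P κ (suc (suc j)) = label′ P κ (Fin.splitAt b j)
  label P κ _             = 𝟎

  -- A rank that drops along every edge. It yields acyclicity and the bound on the depth, and it is
  -- the induction variable of `Invariant`.
  rankᵏ : Kind → ℕ
  rankᵏ (chain j)  = toℕ j
  rankᵏ (slot t _) = r + toℕ t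
  rankᵏ pad        = r

  rank : Node → ℕ
  rank P = rankᵏ (kind P)

  NonChain : Node → Set
  NonChain P = ∀ {j} → kind P ≢ chain j

  top lift-index : Fin r
  top        = suc (suc (b Fin.↑ʳ suc zero))
  lift-index = suc (suc (b Fin.↑ʳ zero))

  digit : Fin b → Fin r
  digit d = suc (suc (d Fin.↑ˡ 2))

  toℕ-top : suc (toℕ top) ≡ r
  toℕ-top = trans (cong (λ x → 3 + x) (Fin.toℕ-↑ʳ b (suc zero))) (arith b)
    where
    arith : ∀ b → 3 + (b + 1) ≡ 2 + (b + 2)
    arith = solve-∀

  ≤top : ∀ (j : Fin r) → toℕ j ≤ toℕ top
  ≤top j = s≤s⁻¹ (subst (toℕ j <_) (sym toℕ-top) (Fin.toℕ<n j))

-- Layer t simulates round t of the network v ↦ ¬ ⋁ {u ∣ S v u}: the vertex v is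
-- true iff it exceeds the threshold θ of its layer.  H exceeds everything else in
-- its layer, which keeps exponents positive.  In the next layer, θ has the marking
-- H − θ and v the marking H − ∑ u, so that the largest node in which these differ
-- is θ, making v true, unless some u exceeds θ.
module NorNetwork (N L b : ℕ) (S : Fin N → Fin N → Bool)
                  (fits : 4 + b + suc L * (2 + N) ≤ 3 ^ b) where

  open Layout N L b fits public

  -- The row of `H` is nowhere smaller than another row and strictly larger at `θ`; this is what
  -- makes `H` the largest node of its layer again.
  weight : Fin width → Fin width → Coefficient
  weight H          H          = 𝟏
  weight H          θ          = 𝟏
  weight H          (vertex u) = 𝟎
  weight θ          H          = 𝟏
  weight θ          θ          = −𝟏
  weight θ          (vertex u) = 𝟎
  weight (vertex v) H          = 𝟏
  weight (vertex v) θ          = 𝟎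
  weight (vertex v) (vertex u) = if S v u then −𝟏 else 𝟎

  coefficient : Node → Kind → Kind → Coefficient
  coefficient P (chain i)    (chain j)      = if toℕ i ≡ᵇ suc (toℕ j) then 𝟏 else 𝟎
  coefficient P (slot t u)   (chain j)      = label P (slot t u) j
  coefficient P pad          (chain j)      = label P pad j
  coefficient P (slot t u)   (slot t′ u′)   = if toℕ t ≡ᵇ suc (toℕ t′) then weight u u′ else 𝟎
  coefficient P _            _              = 𝟎

  opaque

    δ : Node → Marking (3 ^ b)
    δ P Q = coefficient P (kind P) (kind Q)

    δ-at : ∀ {P Q κ κ′} → kind P ≡ κ → kind Q ≡ κ′ → δ P Q ≡ coefficient P κ κ′
    δ-at refl refl = refl

  private
    if-𝟎 : ∀ {m n c} → (if m ≡ᵇ n then c else 𝟎) ≢ 𝟎 → m ≡ n × c ≢ 𝟎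
    if-𝟎 {m} {n} ≢𝟎 with m ≡ᵇ n in eq
    ... | true  = ℕ.≡ᵇ⇒≡ m n (subst T (sym eq) tt) , ≢𝟎
    ... | false = contradiction refl ≢𝟎

    if-≡ : ∀ {m n c} → m ≡ n → (if m ≡ᵇ n then c else 𝟎) ≡ c
    if-≡ {m} {n} m≡n with m ≡ᵇ n in eq
    ... | true  = refl
    ... | false = ⊥-elim (subst T eq (ℕ.≡⇒≡ᵇ m n m≡n))

  rank-decreasing : ∀ P κ κ′ → coefficient P κ κ′ ≢ 𝟎 → rankᵏ κ′ < rankᵏ κ
  rank-decreasing P (chain i)  (chain j)    ≢𝟎 = ℕ.≤-reflexive (sym (proj₁ (if-𝟎 ≢𝟎)))
  rank-decreasing P (chain i)  (slot _ _)   ≢𝟎 = contradiction refl ≢𝟎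
  rank-decreasing P (chain i)  pad          ≢𝟎 = contradiction refl ≢𝟎
  rank-decreasing P (slot t u) (chain j)    ≢𝟎 = ℕ.≤-trans (Fin.toℕ<n j) (ℕ.m≤m+n r (toℕ t))
  rank-decreasing P (slot t u) (slot t′ u′) ≢𝟎 = ℕ.+-monoʳ-< r (ℕ.≤-reflexive (sym (proj₁ (if-𝟎 ≢𝟎))))
  rank-decreasing P (slot t u) pad          ≢𝟎 = contradiction refl ≢𝟎
  rank-decreasing P pad        (chain j)    ≢𝟎 = Fin.toℕ<n j
  rank-decreasing P pad        (slot _ _)   ≢𝟎 = contradiction refl ≢𝟎
  rank-decreasing P pad        pad          ≢𝟎 = contradiction refl ≢𝟎

  edge-rank : ∀ {P Q} → Edge δ P Q → rank Q < rank P
  edge-rank {P} {Q} edge = rank-decreasing P (kind P) (kind Q) (edge ∘ trans (δ-at refl refl))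

  rank< : ∀ P → rank P < r + suc L
  rank< P with kind P
  ... | chain j  = ℕ.≤-trans (Fin.toℕ<n j) (ℕ.m≤m+n r (suc L))
  ... | slot t _ = ℕ.+-monoʳ-< r (Fin.toℕ<n t)
  ... | pad      = ℕ.m<m+n r (s≤s z≤n)

  Π : Dag
  Π = record
    { ∣Γ∣     = 3 ^ b
    ; δ       = δ
    ; acyclic = λ π → ℕ.<-irrefl refl (path-rank π)
    }
    where
    path-rank : ∀ {P Q} → TransClosure (Edge δ) P Q → rank Q < rank P
    path-rank Plus.[ edge ]    = edge-rank edge
    path-rank (edge Plus.∷ π) = ℕ.<-trans (path-rank π) (edge-rank edge)

  open Dag Π public using (Λ; ε; εᴹ; IsPowerCircuit; IsDepth; pathLength; Compact)
  open Exponents Π public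

  pathLength-≤ : ∀ {P Q} (π : Star (Edge δ) P Q) → pathLength π ≤ rank P
  pathLength-≤ Star.ε     = z≤n
  pathLength-≤ (edge ◅ π) = ℕ.≤-<-trans (pathLength-≤ π) (edge-rank edge)

  private
    chain-zero : ∀ Q → δ (chainAt zero) Q ≡ 𝟎
    chain-zero Q = trans (δ-at (kind-chainAt zero) refl) (lemma (kind Q))
      where
      lemma : ∀ κ → coefficient (chainAt zero) (chain zero) κ ≡ 𝟎
      lemma (chain _)  = refl
      lemma (slot _ _) = refl
      lemma pad        = refl

    chain-suc : ∀ j → δ (chainAt (suc j)) (chainAt (Fin.inject₁ j)) ≡ 𝟏
    chain-suc j = trans (δ-at (kind-chainAt (suc j)) (kind-chainAt (Fin.inject₁ j)))
      (if-≡ {suc (toℕ j)} (cong suc (sym (Fin.toℕ-inject₁ j))))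

    chain-only : ∀ {i Q} → δ (chainAt i) Q ≢ 𝟎 → ∃[ j ] Q ≡ chainAt j × toℕ i ≡ suc (toℕ j)
    chain-only {i} {Q} ≢𝟎 = lemma (kind Q) refl (≢𝟎 ∘ trans (δ-at (kind-chainAt i) refl))
      where
      lemma : ∀ κ → kind Q ≡ κ → coefficient (chainAt i) (chain i) κ ≢ 𝟎 → ∃[ j ] Q ≡ chainAt j × toℕ i ≡ suc (toℕ j)
      lemma (chain j)  eq ≢𝟎 = j , kind-chain⁻¹ eq , proj₁ (if-𝟎 ≢𝟎)
      lemma (slot _ _) eq ≢𝟎 = contradiction refl ≢𝟎
      lemma pad        eq ≢𝟎 = contradiction refl ≢𝟎

    chain-value : ∀ j → εᴹ (Λ (chainAt (suc j))) ≡ ε (chainAt (Fin.inject₁ j))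
    chain-value j = combine-single (Λ (chainAt (suc j))) (chainAt (Fin.inject₁ j)) ε (chain-suc j) only
      where
      only : ∀ Q → δ (chainAt (suc j)) Q ≢ 𝟎 → Q ≡ chainAt (Fin.inject₁ j)
      only Q ≢𝟎 with chain-only ≢𝟎
      ... | i , refl , eq = cong chainAt (Fin.toℕ-injective (trans (sym (ℕ.suc-injective eq)) (sym (Fin.toℕ-inject₁ j))))

  chain-valid : ∀ j → Valid (chainAt j)
  chain-valid = Fin.<-weakInduction (Valid ∘ chainAt) (valid-exponent (combine-zero ε chain-zero))
    λ j valid → valid-exponent (trans (chain-value j) (ε-valid valid))

  e-chain-suc : ∀ j → e (chainAt (suc j)) ≡ 2 ^ e (chainAt (Fin.inject₁ j))
  e-chain-suc j = e-exponent (trans (chain-value j) (ε-valid (chain-valid (Fin.inject₁ j))))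

  chain-mono-< : ∀ {i j} → toℕ i < toℕ j → e (chainAt i) < e (chainAt j)
  chain-mono-< {i} {j} = Fin.<-weakInduction (λ j → toℕ i < toℕ j → e (chainAt i) < e (chainAt j)) (λ ()) step j
    where
    step : ∀ j → (toℕ i < toℕ (Fin.inject₁ j) → e (chainAt i) < e (chainAt (Fin.inject₁ j))) →
           toℕ i < suc (toℕ j) → e (chainAt i) < e (chainAt (suc j))
    step j ih i<1+j = subst (e (chainAt i) <_) (sym (e-chain-suc j)) (ℕ.≤-<-trans below (n<2^n (e (chainAt (Fin.inject₁ j)))))
      where
      below : e (chainAt i) ≤ e (chainAt (Fin.inject₁ j))
      below with ℕ.m≤n⇒m<n∨m≡n (s≤s⁻¹ i<1+j)
      ... | inj₁ i<j = ℕ.<⇒≤ (ih (subst (toℕ i <_) (sym (Fin.toℕ-inject₁ j)) i<j))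
      ... | inj₂ i≡j = ℕ.≤-reflexive (cong (e ∘ chainAt) (Fin.toℕ-injective (trans i≡j (sym (Fin.toℕ-inject₁ j)))))

  chain-mono⁻ : ∀ {i j} → e (chainAt i) ≤ e (chainAt j) → toℕ i ≤ toℕ j
  chain-mono⁻ le = ℕ.≮⇒≥ λ lt → ℕ.<⇒≱ (chain-mono-< lt) le

  chain-≤top : ∀ j → e (chainAt j) ≤ e (chainAt top)
  chain-≤top j = ℕ.≮⇒≥ λ lt → ℕ.<⇒≱ (≤top′ lt) (≤top j)
    where
    ≤top′ : e (chainAt top) < e (chainAt j) → toℕ top < toℕ j
    ≤top′ lt = ℕ.≤∧≢⇒< (chain-mono⁻ (ℕ.<⇒≤ lt)) λ eq →
      ℕ.<⇒≢ lt (cong (e ∘ chainAt) (Fin.toℕ-injective eq))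

  chain-positive : ∀ {j} → 1 ≤ toℕ j → 1 ≤ e (chainAt j)
  chain-positive {suc j} _ = subst (1 ≤_) (sym (e-chain-suc j)) (ℕ.m^n>0 2 (e (chainAt (Fin.inject₁ j))))

  chain-even : ∀ {j} → 2 ≤ toℕ j → 2 ∣ e (chainAt j)
  chain-even {suc zero}    (s≤s ())
  chain-even {suc (suc j)} _ = subst (2 ∣_) (sym (e-chain-suc (suc j)))
    (2∣2^ (chain-positive {Fin.inject₁ (suc j)} (s≤s z≤n)))

  -- The two nodes of the chain which are excluded have exponents 0 and 1.
  NonBase : Node → Set
  NonBase P = ∀ {j} → kind P ≡ chain j → 2 ≤ toℕ j

  private
    label-𝟎 : ∀ {P κ j} → label P κ j ≢ 𝟎 → 2 ≤ toℕ j
    label-𝟎 {j = zero}        ≢𝟎 = contradiction refl ≢𝟎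
    label-𝟎 {j = suc zero}    ≢𝟎 = contradiction refl ≢𝟎
    label-𝟎 {j = suc (suc j)} _  = s≤s (s≤s z≤n)

  support-nonbase : ∀ {P} → NonChain P → Supported NonBase (Λ P)
  support-nonbase {P} nonchain {Q} ≢𝟎 {j} eq = lemma (kind P) refl (≢𝟎 ∘ trans (δ-at refl eq))
    where
    lemma : ∀ κ → kind P ≡ κ → coefficient P κ (chain j) ≢ 𝟎 → 2 ≤ toℕ j
    lemma (chain _)  eqᴾ _  = contradiction eqᴾ nonchain
    lemma (slot t u) _   ≢𝟎 = label-𝟎 {P} {slot t u} ≢𝟎
    lemma pad        _   ≢𝟎 = label-𝟎 {P} {pad} ≢𝟎

  label-at : ∀ {P j} → NonChain P → δ P (chainAt j) ≡ label P (kind P) j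
  label-at {P} {j} nonchain = trans (δ-at refl (kind-chainAt j)) (lemma (kind P) refl)
    where
    lemma : ∀ κ → kind P ≡ κ → coefficient P κ (chain j) ≡ label P κ j
    lemma (chain _)  eq = contradiction eq nonchain
    lemma (slot _ _) _  = refl
    lemma pad        _  = refl

  label-top : ∀ P κ → label P κ top ≡ 𝟏
  label-top P κ = cong (label′ P κ) (Fin.splitAt-↑ʳ b 2 (suc zero))

  label-lift : ∀ P κ → label P κ lift-index ≡ lift κ
  label-lift P κ = cong (label′ P κ) (Fin.splitAt-↑ʳ b 2 zero)

  label-digit : ∀ P κ d → label P κ (digit d) ≡ trit (Fin.finToFun P d)
  label-digit P κ d = cong (label′ P κ) (Fin.splitAt-↑ˡ b d 2)

  slot-nonchain : ∀ t u → NonChain (slotAt t u)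
  slot-nonchain t u eq with trans (sym (kind-slotAt t u)) eq
  ... | ()

  weight-at : ∀ {t t′} u u′ → toℕ t ≡ suc (toℕ t′) → δ (slotAt t u) (slotAt t′ u′) ≡ weight u u′
  weight-at {t} {t′} u u′ eq = trans (δ-at (kind-slotAt t u) (kind-slotAt t′ u′)) (if-≡ {toℕ t} eq)

  weight-H : ∀ u → weight u H ≡ 𝟏
  weight-H H          = refl
  weight-H θ          = refl
  weight-H (vertex _) = refl

  slot-successor : ∀ {t u Q} → NonChain Q → δ (slotAt t u) Q ≢ 𝟎 →
                   ∃₂ λ t′ u′ → Q ≡ slotAt t′ u′ × toℕ t ≡ suc (toℕ t′)
  slot-successor {t} {u} {Q} nonchain ≢𝟎 = lemma (kind Q) refl (≢𝟎 ∘ trans (δ-at (kind-slotAt t u) refl))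
    where
    lemma : ∀ κ → kind Q ≡ κ → coefficient (slotAt t u) (slot t u) κ ≢ 𝟎 →
            ∃₂ λ t′ u′ → Q ≡ slotAt t′ u′ × toℕ t ≡ suc (toℕ t′)
    lemma (chain _)    eq _  = contradiction eq nonchain
    lemma (slot t′ u′) eq ≢𝟎 = t′ , u′ , kind-slot⁻¹ eq , proj₁ (if-𝟎 ≢𝟎)
    lemma pad          eq ≢𝟎 = contradiction refl ≢𝟎

  pad-successor : ∀ {P Q} → kind P ≡ pad → NonChain Q → δ P Q ≡ 𝟎
  pad-successor {P} {Q} eqᴾ nonchain = trans (δ-at eqᴾ refl) (lemma (kind Q) refl)
    where
    lemma : ∀ κ → kind Q ≡ κ → coefficient P pad κ ≡ 𝟎
    lemma (chain _)  eq = contradiction eq nonchain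
    lemma (slot _ _) _  = refl
    lemma pad        _  = refl

  chain? : ∀ P → (∃[ j ] P ≡ chainAt j) ⊎ NonChain P
  chain? P with kind P in eq
  ... | chain j  = inj₁ (j , kind-chain⁻¹ eq)
  ... | slot _ _ = inj₂ λ ()
  ... | pad      = inj₂ λ ()

  -- The clauses depend on each other. `even` and `injective` make the markings of the next rank
  -- gapped; `above` and `H-largest` give them a positive leading digit, hence `valid` and `above`;
  -- lexicographic comparison of such markings then gives `injective` and `H-largest`.
  record Invariant (n : ℕ) : Set where
    field
      valid     : ∀ {P} → rank P < n → Valid P
      even      : ∀ {P} → rank P < n → NonBase P → 2 ∣ e P
      injective : ∀ {P Q} → rank P < n → rank Q < n → e P ≡ e Q → P ≡ Q
      above     : ∀ {P} → rank P < n → NonChain P → e (chainAt top) < e P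
      H-largest : ∀ {t u} → r + toℕ t < n → e (slotAt t (suc u)) < e (slotAt t H)

  private
    rank-slotAt : ∀ t u → rank (slotAt t u) ≡ r + toℕ t
    rank-slotAt t u = cong rankᵏ (kind-slotAt t u)

    nonchain-rank : ∀ P → NonChain P → r ≤ rank P
    nonchain-rank P nonchain = lemma (kind P) refl
      where
      lemma : ∀ κ → kind P ≡ κ → r ≤ rankᵏ κ
      lemma (chain _)  eq = contradiction eq nonchain
      lemma (slot _ _) _  = ℕ.m≤m+n r _
      lemma pad        _  = ℕ.≤-refl

    e-chain-injective : ∀ {i j} → e (chainAt i) ≡ e (chainAt j) → i ≡ j
    e-chain-injective eq = Fin.toℕ-injective (ℕ.≤-antisym (chain-mono⁻ (ℕ.≤-reflexive eq)) (chain-mono⁻ (ℕ.≤-reflexive (sym eq))))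

  -- The chain satisfies its clauses at every rank, and `above` separates it from the other nodes,
  -- so only the latter need an induction.
  extend-invariant : ∀ {n} →
    (∀ {P} → NonChain P → rank P < n → Valid P) →
    (∀ {P} → NonChain P → rank P < n → 2 ∣ e P) →
    (∀ {P Q} → NonChain P → NonChain Q → rank P < n → rank Q < n → e P ≡ e Q → P ≡ Q) →
    (∀ {P} → NonChain P → rank P < n → e (chainAt top) < e P) →
    (∀ {t u} → r + toℕ t < n → e (slotAt t (suc u)) < e (slotAt t H)) →
    Invariant n
  extend-invariant valid even injective above H-largest = record
    { valid = λ {P} lt → case chain? P of λ
        { (inj₁ (j , refl)) → chain-valid j
        ; (inj₂ nonchain)   → valid nonchain lt }
    ; even = λ {P} lt nonbase → case chain? P of λ
        { (inj₁ (j , refl)) → chain-even (nonbase (kind-chainAt j))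
        ; (inj₂ nonchain)   → even nonchain lt }
    ; injective = λ {P} {Q} ltᴾ ltQ eq → case chain? P , chain? Q of λ
        { (inj₁ (i , refl) , inj₁ (j , refl)) → cong chainAt (e-chain-injective eq)
        ; (inj₁ (i , refl) , inj₂ nonchainQ)  → contradiction eq (ℕ.<⇒≢ (ℕ.≤-<-trans (chain-≤top i) (above nonchainQ ltQ)))
        ; (inj₂ nonchainᴾ  , inj₁ (j , refl)) → contradiction (sym eq) (ℕ.<⇒≢ (ℕ.≤-<-trans (chain-≤top j) (above nonchainᴾ ltᴾ)))
        ; (inj₂ nonchainᴾ  , inj₂ nonchainQ)  → injective nonchainᴾ nonchainQ ltᴾ ltQ eq }
    ; above     = λ lt nonchain → above nonchain lt
    ; H-largest = λ {t} {u} → H-largest {t} {u}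
    }

  invariant-base : Invariant r
  invariant-base = extend-invariant
    (λ nonchain lt → ⊥-elim (none nonchain lt))
    (λ nonchain lt → ⊥-elim (none nonchain lt))
    (λ nonchain _ lt _ → ⊥-elim (none nonchain lt))
    (λ nonchain lt → ⊥-elim (none nonchain lt))
    (λ lt → contradiction lt (ℕ.≤⇒≯ (ℕ.m≤m+n r _)))
    where
    none : ∀ {P} → NonChain P → ¬ rank P < r
    none {P} nonchain = ℕ.≤⇒≯ (nonchain-rank P nonchain)

  module Step {n} (inv : Invariant n) (r≤n : r ≤ n) where

    open Invariant inv

    Ready : Node → Set
    Ready P = NonChain P × rank P ≤ n

    support-rank : ∀ {P} → Ready P → Supported (λ Q → rank Q < n) (Λ P)
    support-rank (_ , rank≤n) edge = ℕ.<-≤-trans (edge-rank edge) rank≤n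

    support-valid : ∀ {P} → Ready P → Supported Valid (Λ P)
    support-valid ready edge = valid (support-rank ready edge)

    ready-gapped : ∀ {P} → Ready P → Gapped (Λ P)
    ready-gapped ready Q∈ R∈ Q≢R = even-gap
      (even (support-rank ready Q∈) (support-nonbase (proj₁ ready) Q∈))
      (even (support-rank ready R∈) (support-nonbase (proj₁ ready) R∈))
      (Q≢R ∘ injective (support-rank ready Q∈) (support-rank ready R∈))

    chain-< : ∀ {P} → rank P < n → NonChain P → ∀ j → e (chainAt j) < e P
    chain-< rank<n nonchain j = ℕ.≤-<-trans (chain-≤top j) (above rank<n nonchain)

    -- A largest node of the support, with coefficient 𝟏, is what forces a positive exponent. It is
    -- the top of the chain for padding and layer 0, and `H` of the previous layer for the later
    -- layers.
    record Leader (P : Node) : Set where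
      field
        leader   : Node
        positive : δ P leader ≡ 𝟏
        largest  : ∀ {Q} → δ P Q ≢ 𝟎 → e Q ≤ e leader
        ≥top     : e (chainAt top) ≤ e leader

    leader-top : ∀ {P} → NonChain P → (∀ {Q} → NonChain Q → δ P Q ≡ 𝟎) → Leader P
    leader-top {P} nonchain none = record
      { leader   = chainAt top
      ; positive = trans (label-at nonchain) (label-top P (kind P))
      ; largest  = λ {Q} Q∈ → case chain? Q of λ
          { (inj₁ (j , refl)) → chain-≤top j
          ; (inj₂ nonchainQ)  → contradiction (none nonchainQ) Q∈ }
      ; ≥top     = ℕ.≤-refl
      }

    slot-rank : ∀ {t t′ : Fin (suc L)} → r + toℕ t ≤ n → toℕ t ≡ suc (toℕ t′) → r + toℕ t′ < n
    slot-rank {t} {t′} le eq = ℕ.<-≤-trans (ℕ.+-monoʳ-< r (ℕ.≤-reflexive (sym eq))) le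

    slot-rank′ : ∀ {t t′ : Fin (suc L)} u → r + toℕ t ≤ n → toℕ t ≡ suc (toℕ t′) → rank (slotAt t′ u) < n
    slot-rank′ {t} {t′} u le eq = subst (_< n) (sym (rank-slotAt t′ u)) (slot-rank {t} {t′} le eq)

    leader-H : ∀ {t t′ u} → r + toℕ t ≤ n → toℕ t ≡ suc (toℕ t′) → Leader (slotAt t u)
    leader-H {t} {t′} {u} le eq = record
      { leader   = slotAt t′ H
      ; positive = trans (weight-at u H eq) (weight-H u)
      ; largest  = λ {Q} Q∈ → case chain? Q of λ
          { (inj₁ (j , refl)) → ℕ.<⇒≤ (chain-< (slot-rank′ {t} {t′} H le eq) (slot-nonchain t′ H) j)
          ; (inj₂ nonchain)   → case slot-successor {t} {u} nonchain Q∈ of λ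
              { (t″ , u″ , refl , eq″) → lemma u″ (Fin.toℕ-injective (ℕ.suc-injective (trans (sym eq) eq″))) } }
      ; ≥top     = ℕ.<⇒≤ (above (slot-rank′ {t} {t′} H le eq) (slot-nonchain t′ H))
      }
      where
      lemma : ∀ {t″} u″ → t′ ≡ t″ → e (slotAt t″ u″) ≤ e (slotAt t′ H)
      lemma zero    refl = ℕ.≤-refl
      lemma (suc u) refl = ℕ.<⇒≤ (H-largest {t′} {u} (slot-rank {t} {t′} le eq))

    ready-leader : ∀ {P} → Ready P → Leader P
    ready-leader {P} (nonchain , rank≤n) = lemma (kind P) refl
      where
      lemma : ∀ κ → kind P ≡ κ → Leader P
      lemma (chain _)        eq = contradiction eq nonchain
      lemma pad              eq = leader-top nonchain (pad-successor eq)
      lemma (slot zero u)    eq = leader-top nonchain λ {Q} nonchainQ → zero-successor nonchainQ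
        where
        zero-successor : ∀ {Q} → NonChain Q → δ P Q ≡ 𝟎
        zero-successor {Q} nonchainQ with isZero? (δ P Q)
        ... | yes ≡𝟎 = ≡𝟎
        ... | no  ≢𝟎 with slot-successor {zero} {u} nonchainQ (subst (λ P → δ P Q ≢ 𝟎) (kind-slot⁻¹ eq) ≢𝟎)
        ...   | _ , _ , _ , ()
      lemma (slot (suc t) u) eq = subst Leader (sym (kind-slot⁻¹ eq))
        (leader-H {suc t} {Fin.inject₁ t} (subst (_≤ n) (cong rankᵏ eq) rank≤n) (cong suc (sym (Fin.toℕ-inject₁ t))))

    ready-value : ∀ {P} (ready : Ready P) → let open Leader (ready-leader ready) in
                  + e leader ℤ.< εᴹ (Λ P)
    ready-value {P} ready = subst (+ e leader ℤ.<_) (sym (εᴹ-val (support-valid ready)))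
      (ℤ.*-cancelˡ-<-nonNeg (+ 3) (ℤ.<-trans
        (subst (ℤ._< + (2 ^ suc (e leader))) (ℤ.pos-* 3 (e leader)) (ℤ.+<+ (3n<2^[1+n] (e leader))))
        (Leading.positive (ready-gapped ready) largest positive)))
      where open Leader (ready-leader ready)

    ready-valid : ∀ {P} → Ready P → Valid P
    ready-valid {P} ready = positive⇒valid (εᴹ (Λ P)) refl (ready-value ready)
      where
      positive⇒valid : ∀ z {n} → εᴹ (Λ P) ≡ z → + n ℤ.< z → Valid P
      positive⇒valid (+ _) eq _ = valid-exponent eq

    leader-< : ∀ {P} (ready : Ready P) → e (Leader.leader (ready-leader ready)) < e P
    leader-< {P} ready = ℤ.drop‿+<+ (subst (+ e (Leader.leader (ready-leader ready)) ℤ.<_) (exponent (ready-valid ready)) (ready-value ready))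

    ready-above : ∀ {P} → Ready P → e (chainAt top) < e P
    ready-above ready = ℕ.≤-<-trans (Leader.≥top (ready-leader ready)) (leader-< ready)

    nonbase-positive : ∀ {P} → rank P < n → NonBase P → 1 ≤ e P
    nonbase-positive {P} rank<n nonbase with chain? P
    ... | inj₁ (j , refl) = chain-positive (ℕ.≤-trans (s≤s z≤n) (nonbase (kind-chainAt j)))
    ... | inj₂ nonchain   = ℕ.≤-trans (s≤s z≤n) (above rank<n nonchain)

    ready-even : ∀ {P} → Ready P → 2 ∣ e P
    ready-even {P} ready = subst (2 ∣_) (trans (cong ∣_∣ (sym (εᴹ-val (support-valid ready)))) (sym (e-unfold P)))
      (∣⇒∣ᵤ (combine-even (Λ P) power λ Q Q∈ → ∣ᵤ⇒∣
        (2∣2^ (nonbase-positive (support-rank ready Q∈) (support-nonbase (proj₁ ready) Q∈)))))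

    -- A known difference at `S` need not be the decisive one, but it bounds the decisive node from
    -- below. This bound later confines that node: no node of the chain lies above a slot, and only
    -- the top of the chain lies above `lift-index` there.
    record Contrast (P Q : Node) (S : Node) : Set where
      field
        decisive   : Node
        S≤decisive : e S ≤ e decisive
        agree      : ∀ {R} → e decisive < e R → δ P R ≡ δ Q R
        outcome    : (δ P decisive <ᶜ δ Q decisive × e P < e Q) ⊎ (δ Q decisive <ᶜ δ P decisive × e Q < e P)

    contrast : ∀ {P Q S} → Ready P → Ready Q → δ P S ≢ δ Q S → Contrast P Q S
    contrast {P} {Q} {S} readyᴾ readyQ P≢Q with leading-difference (Λ P) (Λ Q) {S} P≢Q
    ... | R , R≢ , S≤R , agree = record
      { decisive   = R
      ; S≤decisive = S≤R
      ; agree      = agree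
      ; outcome    = case ≢⇒<ᶜ⊎>ᶜ R≢ of λ
          { (inj₁ lt) → inj₁ (lt , valid-< (ready-valid readyᴾ) (ready-valid readyQ)
              (εᴹ-lexicographic (support-valid readyᴾ) (support-valid readyQ) (ready-gapped readyᴾ) (ready-gapped readyQ)
                (λ S∈ T∈ → injective (either S∈) (either T∈)) agree lt))
          ; (inj₂ gt) → inj₂ (gt , valid-< (ready-valid readyQ) (ready-valid readyᴾ)
              (εᴹ-lexicographic (support-valid readyQ) (support-valid readyᴾ) (ready-gapped readyQ) (ready-gapped readyᴾ)
                (λ S∈ T∈ → injective (either (swap S∈)) (either (swap T∈))) (λ lt → sym (agree lt)) gt)) }
      }
      where
      either : ∀ {S} → Λ P S ≢ 𝟎 ⊎ Λ Q S ≢ 𝟎 → rank S < n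
      either = [ support-rank readyᴾ , support-rank readyQ ]′

    -- Any difference of two such markings, wherever the decisive one is, separates the exponents.
    -- Hence a single ternary digit in which the node numbers differ is enough.
    ready-injective : ∀ {P Q} → Ready P → Ready Q → e P ≡ e Q → P ≡ Q
    ready-injective {P} {Q} readyᴾ readyQ eq with Fin.any? (λ d → ¬? (Fin.finToFun P d Fin.≟ Fin.finToFun Q d))
    ... | no same = trans (sym (Fin.funToFin-finToFin {b} {3} P)) (trans (funToFin-cong same′) (Fin.funToFin-finToFin {b} {3} Q))
      where
      same′ : ∀ d → Fin.finToFun P d ≡ Fin.finToFun Q d
      same′ d with Fin.finToFun P d Fin.≟ Fin.finToFun Q d
      ... | yes eq = eq
      ... | no neq = contradiction (d , neq) same
      funToFin-cong : ∀ {m n} {f g : Fin m → Fin n} → f ≗ g → Fin.funToFin f ≡ Fin.funToFin g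
      funToFin-cong {zero}  f≗g = refl
      funToFin-cong {suc m} f≗g = cong₂ Fin.combine (f≗g zero) (funToFin-cong (f≗g ∘ suc))
    ... | yes (d , P≢Q) = case Contrast.outcome (contrast readyᴾ readyQ differ) of λ
      { (inj₁ (_ , lt)) → contradiction eq (ℕ.<⇒≢ lt)
      ; (inj₂ (_ , gt)) → contradiction (sym eq) (ℕ.<⇒≢ gt) }
      where
      differ : δ P (chainAt (digit d)) ≢ δ Q (chainAt (digit d))
      differ same = P≢Q (trit-injective (trans (sym (digit-at (proj₁ readyᴾ))) (trans same (digit-at (proj₁ readyQ)))))
        where
        digit-at : ∀ {P} → NonChain P → δ P (chainAt (digit d)) ≡ trit (Fin.finToFun P d)
        digit-at {P} nonchain = trans (label-at nonchain) (label-digit P (kind P) d)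

    ready-slot : ∀ t u → r + toℕ t ≤ n → Ready (slotAt t u)
    ready-slot t u le = slot-nonchain t u , subst (_≤ n) (sym (rank-slotAt t u)) le

    -- Nodes with a larger exponent than a slot are not in the chain, so the
    -- decisive node of such a comparison is a slot of the previous layer.
    decisive-slot : ∀ {t t′ u₁ u₂ u} → r + toℕ t ≤ n → toℕ t ≡ suc (toℕ t′) → weight u₁ u ≢ weight u₂ u →
                    Σ[ c ∈ Contrast (slotAt t u₁) (slotAt t u₂) (slotAt t′ u) ]
                    ∃[ v ] Contrast.decisive c ≡ slotAt t′ v
    decisive-slot {t} {t′} {u₁} {u₂} {u} le eq w≢ = c , slot-of (chain? decisive)
      where
      c : Contrast (slotAt t u₁) (slotAt t u₂) (slotAt t′ u)
      c = contrast (ready-slot t u₁ le) (ready-slot t u₂ le)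
            (λ same → w≢ (trans (sym (weight-at u₁ u eq)) (trans same (weight-at u₂ u eq))))
      open Contrast c
      differ : δ (slotAt t u₁) decisive ≢ δ (slotAt t u₂) decisive
      differ same = [ (λ { (lt , _) → irr same lt }) , (λ { (lt , _) → irr (sym same) lt }) ]′ outcome
        where
        irr : ∀ {c d} → c ≡ d → ¬ c <ᶜ d
        irr refl = ℤ.<-irrefl refl
      same-layer : ∀ {u} → NonChain decisive → δ (slotAt t u) decisive ≢ 𝟎 → ∃[ v ] decisive ≡ slotAt t′ v
      same-layer {u} nonchain ≢𝟎 with slot-successor {t} {u} nonchain ≢𝟎
      ... | t″ , v , is-slot , eq″ =
        v , trans is-slot (cong (λ s → slotAt s v) (Fin.toℕ-injective (ℕ.suc-injective (trans (sym eq″) eq))))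
      slot-of : (∃[ j ] decisive ≡ chainAt j) ⊎ NonChain decisive → ∃[ v ] decisive ≡ slotAt t′ v
      slot-of (inj₁ (j , is-chain)) = contradiction
        (subst (λ D → e (slotAt t′ u) ≤ e D) is-chain S≤decisive)
        (ℕ.<⇒≱ (chain-< (slot-rank′ {t} {t′} u le eq) (slot-nonchain t′ u) j))
      slot-of (inj₂ nonchain) with isZero? (δ (slotAt t u₁) decisive) | isZero? (δ (slotAt t u₂) decisive)
      ... | yes p | yes q = contradiction (trans p (sym q)) differ
      ... | no ≢𝟎 | _     = same-layer {u₁} nonchain ≢𝟎
      ... | yes _ | no ≢𝟎 = same-layer {u₂} nonchain ≢𝟎

    -- In layer 0 the decisive node is `lift-index`, because the only higher node of the chain, the
    -- top, has coefficient 𝟏 in both markings. In a later layer it is a slot of the previous layer,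
    -- and in none of these is the weight of `H` the smaller one.
    ready-H-largest : ∀ {t u} → r + toℕ t ≤ n → e (slotAt t (suc u)) < e (slotAt t H)
    ready-H-largest {zero} {u} le with contrast {S = chainAt lift-index} (ready-slot zero (suc u) le) (ready-slot zero H le) differ
      where
      differ : δ (slotAt zero (suc u)) (chainAt lift-index) ≢ δ (slotAt zero H) (chainAt lift-index)
      differ same with trans (sym (lift-at (suc u))) (trans same (lift-at H))
        where
        lift-at : ∀ u → δ (slotAt zero u) (chainAt lift-index) ≡ lift (slot zero u)
        lift-at u = trans (label-at (slot-nonchain zero u))
          (trans (cong (λ κ → label (slotAt zero u) κ lift-index) (kind-slotAt zero u)) (label-lift (slotAt zero u) (slot zero u)))
      ... | ()
    ... | c with chain? (Contrast.decisive c)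
    ...   | inj₁ (j , is-chain) = at-chain j is-chain
      where
      open Contrast c
      P = slotAt zero (suc u)
      Q = slotAt zero H
      label-of : ∀ u → δ (slotAt zero u) (chainAt j) ≡ label (slotAt zero u) (slot zero u) j
      label-of u = trans (label-at (slot-nonchain zero u)) (cong (λ κ → label (slotAt zero u) κ j) (kind-slotAt zero u))
      cases : ∀ i → j ≡ suc (suc (b Fin.↑ʳ i)) → label P (slot zero (suc u)) j ≡ label Q (slot zero H) j ⊎
              (label P (slot zero (suc u)) j ≡ 𝟎 × label Q (slot zero H) j ≡ 𝟏)
      cases zero       refl = inj₂ (label-lift P (slot zero (suc u)) , label-lift Q (slot zero H))
      cases (suc zero) refl = inj₁ (trans (label-top P (slot zero (suc u))) (sym (label-top Q (slot zero H))))
      high : ∀ j → toℕ lift-index ≤ toℕ j → ∃[ i ] j ≡ suc (suc (b Fin.↑ʳ i))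
      high (suc (suc j)) (s≤s (s≤s le)) with Fin.splitAt b j in split
      ... | inj₂ i = i , cong (λ x → suc (suc x)) (sym (Fin.splitAt⁻¹-↑ʳ split))
      ... | inj₁ d = contradiction (ℕ.≤-trans (ℕ.≤-reflexive (sym (Fin.toℕ-↑ʳ b zero)) ) le)
        (ℕ.<⇒≱ (ℕ.<-≤-trans (subst (_< b) (trans (sym (Fin.toℕ-↑ˡ d 2)) (cong toℕ (Fin.splitAt⁻¹-↑ˡ split))) (Fin.toℕ<n d)) (ℕ.m≤m+n b 0)))
      at-chain : ∀ j′ → decisive ≡ chainAt j′ → e P < e Q
      at-chain _ _ = decide (outcome′ outcome) (case high j (chain-mono⁻ (subst (λ D → e (chainAt lift-index) ≤ e D) is-chain S≤decisive)) of λ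
          { (i , eq) → cases i eq })
        where
        outcome′ : _ → (δ P (chainAt j) <ᶜ δ Q (chainAt j) × e P < e Q) ⊎ (δ Q (chainAt j) <ᶜ δ P (chainAt j) × e Q < e P)
        outcome′ = subst (λ D → (δ P D <ᶜ δ Q D × e P < e Q) ⊎ (δ Q D <ᶜ δ P D × e Q < e P)) is-chain
        decide : (δ P (chainAt j) <ᶜ δ Q (chainAt j) × e P < e Q) ⊎ (δ Q (chainAt j) <ᶜ δ P (chainAt j) × e Q < e P) →
                 label P (slot zero (suc u)) j ≡ label Q (slot zero H) j ⊎
                 (label P (slot zero (suc u)) j ≡ 𝟎 × label Q (slot zero H) j ≡ 𝟏) → e P < e Q
        decide (inj₁ (_ , lt))  _ = lt
        decide (inj₂ (gt , _)) (inj₁ same)    = contradiction gt (ℤ.<-irrefl (cong ⟦_⟧ (trans (label-of H) (trans (sym same) (sym (label-of (suc u)))))))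
        decide (inj₂ (gt , _)) (inj₂ (p , q)) = contradiction gt (ℤ.<-asym (subst₂ _<ᶜ_ (sym (trans (label-of (suc u)) p)) (sym (trans (label-of H) q)) (ℤ.+<+ (s≤s z≤n))))
    ...   | inj₂ nonchain = [ proj₂ , (λ { (gt , _) → contradiction gt (ℤ.<-irrefl (cong ⟦_⟧ (trans (none H) (sym (none (suc u)))))) }) ]′ (Contrast.outcome c)
      where
      none : ∀ u → δ (slotAt zero u) (Contrast.decisive c) ≡ 𝟎
      none u with isZero? (δ (slotAt zero u) (Contrast.decisive c))
      ... | yes ≡𝟎 = ≡𝟎
      ... | no  ≢𝟎 with slot-successor {zero} {u} nonchain ≢𝟎
      ...   | _ , _ , _ , ()
    ready-H-largest {suc t} {u} le with decisive-slot {suc t} {Fin.inject₁ t} {suc u} {H} {θ} le (cong suc (sym (Fin.toℕ-inject₁ t))) (differ u)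
      where
      differ : ∀ u → weight (suc u) θ ≢ 𝟏
      differ zero    ()
      differ (suc _) ()
    ... | c , v , is-slot = [ proj₂ , (λ { (gt , _) → contradiction (weights gt) (H-dominates u v) }) ]′ (Contrast.outcome c)
      where
      weights : δ (slotAt (suc t) H) (Contrast.decisive c) <ᶜ δ (slotAt (suc t) (suc u)) (Contrast.decisive c) → weight H v <ᶜ weight (suc u) v
      weights gt = subst₂ _<ᶜ_ (at H) (at (suc u)) gt
        where
        at : ∀ u → δ (slotAt (suc t) u) (Contrast.decisive c) ≡ weight u v
        at u = trans (cong (δ (slotAt (suc t) u)) is-slot) (weight-at u v (cong suc (sym (Fin.toℕ-inject₁ t))))
      H-dominates : ∀ u v → ¬ weight H v <ᶜ weight (suc u) v
      H-dominates zero    H          (ℤ.+<+ (s≤s ()))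
      H-dominates (suc _) H          (ℤ.+<+ (s≤s ()))
      H-dominates zero    θ          ()
      H-dominates (suc _) θ          (ℤ.+<+ ())
      H-dominates zero    (vertex _) (ℤ.+<+ ())
      H-dominates (suc w) (vertex x) lt with S w x
      H-dominates (suc w) (vertex x) ()           | true
      H-dominates (suc w) (vertex x) (ℤ.+<+ ())   | false

    step : Invariant (suc n)
    step = extend-invariant
      (λ nonchain lt → ready-valid (nonchain , s≤s⁻¹ lt))
      (λ nonchain lt → ready-even (nonchain , s≤s⁻¹ lt))
      (λ nonchainᴾ nonchainQ ltᴾ ltQ → ready-injective (nonchainᴾ , s≤s⁻¹ ltᴾ) (nonchainQ , s≤s⁻¹ ltQ))
      (λ nonchain lt → ready-above (nonchain , s≤s⁻¹ lt))
      (λ {t} {u} lt → ready-H-largest {t} {u} (s≤s⁻¹ lt))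

    -- The markings of `vertex v` and `θ` differ at `θ`, so the decisive node is at least that
    -- large; it is `θ` itself or a vertex above it. All inequalities are strict because exponents
    -- are distinct, so every vertex has a truth value.
    threshold-step : ∀ {t t′ v} → r + toℕ t ≤ n → toℕ t ≡ suc (toℕ t′) →
      (e (slotAt t θ) < e (slotAt t (vertex v)) × (∀ {u} → S v u ≡ true → e (slotAt t′ (vertex u)) < e (slotAt t′ θ))) ⊎
      (e (slotAt t (vertex v)) < e (slotAt t θ) × ∃[ u ] S v u ≡ true × e (slotAt t′ θ) < e (slotAt t′ (vertex u)))
    threshold-step {t} {t′} {v} le eq with decisive-slot {t} {t′} {vertex v} {θ} {θ} le eq (λ ())
    ... | c , w , is-slot = cases w is-slot outcome
      where
      open Contrast c
      at : ∀ u {w} → decisive ≡ slotAt t′ w → δ (slotAt t u) decisive ≡ weight u w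
      at u {w} is-slot = trans (cong (δ (slotAt t u)) is-slot) (weight-at u w eq)
      θ≢ : ∀ {w} → w ≢ θ → e (slotAt t′ θ) ≢ e (slotAt t′ w)
      θ≢ {w} w≢θ same = w≢θ (slot-injective (trans (sym (kind-slotAt t′ w)) (trans (cong kind (sym same-node)) (kind-slotAt t′ θ))))
        where
        same-node = injective (slot-rank′ {t} {t′} θ le eq) (slot-rank′ {t} {t′} w le eq) same
        slot-injective : ∀ {t u t′ u′} → slot t u ≡ slot t′ u′ → u ≡ u′
        slot-injective refl = refl
      cases : ∀ w → decisive ≡ slotAt t′ w →
        (δ (slotAt t (vertex v)) decisive <ᶜ δ (slotAt t θ) decisive × e (slotAt t (vertex v)) < e (slotAt t θ)) ⊎
        (δ (slotAt t θ) decisive <ᶜ δ (slotAt t (vertex v)) decisive × e (slotAt t θ) < e (slotAt t (vertex v))) →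
        (e (slotAt t θ) < e (slotAt t (vertex v)) × (∀ {u} → S v u ≡ true → e (slotAt t′ (vertex u)) < e (slotAt t′ θ))) ⊎
        (e (slotAt t (vertex v)) < e (slotAt t θ) × ∃[ u ] S v u ≡ true × e (slotAt t′ θ) < e (slotAt t′ (vertex u)))
      cases H is-slot (inj₁ (lt , _)) = contradiction (subst₂ _<ᶜ_ (at (vertex v) is-slot) (at θ is-slot) lt) (ℤ.<-irrefl refl)
      cases H is-slot (inj₂ (gt , _)) = contradiction (subst₂ _<ᶜ_ (at θ is-slot) (at (vertex v) is-slot) gt) (ℤ.<-irrefl refl)
      cases θ is-slot (inj₁ (lt , _)) = contradiction (subst₂ _<ᶜ_ (at (vertex v) is-slot) (at θ is-slot) lt) λ ()
      -- Above the decisive node the markings agree, and the marking of `θ` contains no vertices. So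
      -- no `u` with `S v u` lies above `θ`.
      cases θ is-slot (inj₂ (_ , gt)) = inj₁ (gt , below)
        where
        below : ∀ {u} → S v u ≡ true → e (slotAt t′ (vertex u)) < e (slotAt t′ θ)
        below {u} edge = ℕ.≰⇒> λ θ≤u → absurd (trans (sym (weight-at (vertex v) (vertex u) eq))
          (trans (agree (subst (λ D → e D < e (slotAt t′ (vertex u))) (sym is-slot) (ℕ.≤∧≢⇒< θ≤u (θ≢ λ ()))))
            (weight-at θ (vertex u) eq)))
          where
          absurd : ¬ (if S v u then −𝟏 else 𝟎) ≡ 𝟎
          absurd eq rewrite edge = case eq of λ ()
      cases (vertex u) is-slot (inj₁ (lt , v<θ)) = inj₂ (v<θ , u , edge (subst₂ _<ᶜ_ (at (vertex v) is-slot) (at θ is-slot) lt) ,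
        ℕ.≤∧≢⇒< (subst (λ D → e (slotAt t′ θ) ≤ e D) is-slot S≤decisive) (θ≢ λ ()))
        where
        edge : (if S v u then −𝟏 else 𝟎) <ᶜ 𝟎 → S v u ≡ true
        edge lt with S v u
        ... | true  = refl
        ... | false = contradiction lt (ℤ.<-irrefl refl)
      cases (vertex u) is-slot (inj₂ (gt , _)) = contradiction (subst₂ _<ᶜ_ (at θ is-slot) (at (vertex v) is-slot) gt) negative
        where
        negative : ¬ 𝟎 <ᶜ (if S v u then −𝟏 else 𝟎)
        negative lt with S v u
        negative ()           | true
        negative (ℤ.+<+ ()) | false

  invariant : ∀ t → Invariant (r + t)
  invariant zero    = subst Invariant (sym (ℕ.+-identityʳ r)) invariant-base
  invariant (suc t) = subst Invariant (sym (ℕ.+-suc r t)) (Step.step (invariant t) (ℕ.m≤m+n r t))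

  private
    module Final = Invariant (invariant (suc L))

  all-valid : ∀ P → Valid P
  all-valid P = Final.valid (rank< P)

  e-injective : ∀ {P Q} → e P ≡ e Q → P ≡ Q
  e-injective {P} {Q} = Final.injective (rank< P) (rank< Q)

  gapped : ∀ P → Gapped (Λ P)
  gapped P with chain? P
  ... | inj₂ nonchain   = Step.ready-gapped (invariant (suc L)) (ℕ.m≤m+n r (suc L)) (nonchain , ℕ.<⇒≤ (rank< P))
  ... | inj₁ (j , refl) = λ Q∈ R∈ Q≢R → case chain-only Q∈ , chain-only R∈ of λ
    { ((i , refl , eq) , (i′ , refl , eq′)) →
        contradiction (cong chainAt (Fin.toℕ-injective (ℕ.suc-injective (trans (sym eq) eq′)))) Q≢R }

  isPowerCircuit : IsPowerCircuit
  isPowerCircuit P = e P , ε-valid (all-valid P)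

  compact : ∀ P → Compact (Λ P)
  compact P {Q} {R} Q∈ R∈ Q≢R = subst₂ (λ x y → ∣ x ℤ.- y ∣ ≥ 2) (sym (exponent (all-valid Q))) (sym (exponent (all-valid R)))
    ([ distance (e Q) (e R) , subst (_≥ 2) (ℤ.∣i-j∣≡∣j-i∣ (+ e R) (+ e Q)) ∘ distance (e R) (e Q) ]′ (gapped P Q∈ R∈ Q≢R))
    where
    distance : ∀ a b → 2 + a ≤ b → ∣ + a ℤ.- + b ∣ ≥ 2
    distance a b le = subst (_≥ 2) (sym (trans (cong ∣_∣ (ℤ.m-n≡m⊖n a b)) (ℤ.∣⊖∣-≤ (ℕ.≤-trans (ℕ.m≤n+m a 2) le))))
      (ℕ.m+n≤o⇒m≤o∸n 2 le)

  distinct : ∀ {P Q} → P ≢ Q → ε P ≢ ε Q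
  distinct {P} {Q} P≢Q eq = P≢Q (e-injective (ℕ.≤-antisym
    (ε-mono⁻ (all-valid P) (all-valid Q) (ℤ.≤-reflexive eq)) (ε-mono⁻ (all-valid Q) (all-valid P) (ℤ.≤-reflexive (sym eq)))))

  private
    ≡𝟏⇒≢𝟎 : ∀ {c} → c ≡ 𝟏 → c ≢ 𝟎
    ≡𝟏⇒≢𝟎 refl ()

    Descent : Node → ℕ → Set
    Descent P l = Σ[ π ∈ Star (Edge δ) P (chainAt zero) ] pathLength π ≡ l

    descend : ∀ {P Q l} → δ P Q ≡ 𝟏 → Descent Q l → Descent P (suc l)
    descend edge (π , eq) = ≡𝟏⇒≢𝟎 edge ◅ π , cong suc eq

    chain-descent : ∀ j → Descent (chainAt j) (toℕ j)
    chain-descent = Fin.<-weakInduction (λ j → Descent (chainAt j) (toℕ j)) (Star.ε , refl)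
      λ j d → descend (chain-suc j) (subst (Descent _) (Fin.toℕ-inject₁ j) d)

    slot-descent : ∀ t → Descent (slotAt t H) (r + toℕ t)
    slot-descent = Fin.<-weakInduction (λ t → Descent (slotAt t H) (r + toℕ t))
      (subst (Descent _) (trans toℕ-top (sym (ℕ.+-identityʳ r)))
        (descend (trans (label-at (slot-nonchain zero H)) (label-top _ (kind (slotAt zero H)))) (chain-descent top)))
      λ t d → subst (Descent _) (sym (ℕ.+-suc r (toℕ t)))
        (descend (trans (weight-at H H (cong suc (sym (Fin.toℕ-inject₁ t)))) refl)
          (subst (λ x → Descent (slotAt (Fin.inject₁ t) H) (r + x)) (Fin.toℕ-inject₁ t) d))

  -- A longest path follows the nodes `H` from the last layer to layer 0, steps to the top of the
  -- chain and descends the whole chain.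
  depth≡r+L : IsDepth (r + L)
  depth≡r+L = (slotAt (Fin.fromℕ L) H , chainAt zero , subst (Descent _) (cong (λ x → r + x) (Fin.toℕ-fromℕ L)) (slot-descent (Fin.fromℕ L))) ,
              λ {P} π → ℕ.≤-trans (pathLength-≤ π) (s≤s⁻¹ (ℕ.≤-trans (rank< P) (ℕ.≤-reflexive (ℕ.+-suc r L))))

  Holds : Fin (suc L) → Fin N → Bool → Set
  Holds t v true  = e (slotAt t θ) < e (slotAt t (vertex v))
  Holds t v false = e (slotAt t (vertex v)) < e (slotAt t θ)

  module _ {t t′ : Fin (suc L)} {v : Fin N} (eq : toℕ t ≡ suc (toℕ t′)) where

    private
      rank-≤ : r + toℕ t ≤ r + suc L
      rank-≤ = ℕ.+-monoʳ-≤ r (ℕ.<⇒≤ (Fin.toℕ<n t))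

      threshold = Step.threshold-step (invariant (suc L)) (ℕ.m≤m+n r (suc L)) {t} {t′} {v} rank-≤ eq

    nor-true : (∀ u → S v u ≡ true → Holds t′ u false) → Holds t v true
    nor-true all-false = [ proj₁ , (λ (_ , u , edge , θ<u) → contradiction θ<u (ℕ.<-asym (all-false u edge))) ]′ threshold

    nor-false : ∀ u → S v u ≡ true → Holds t′ u true → Holds t v false
    nor-false u edge θ<u = [ (λ (_ , below) → contradiction θ<u (ℕ.<-asym (below edge))) , proj₁ ]′ threshold

-- Networks from circuits

module _ {X : Set} where

  renameGate : ∀ {v w} → (Fin v → Fin w) → Gate X v → Gate X w
  renameGate f (And is)     = And (Vec.map f is)
  renameGate f (Or is)      = Or (Vec.map f is)
  renameGate f (Not i)      = Not (f i)
  renameGate f (Extra x is) = Extra x (Vec.map f is)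

  private
    map-lookup-suc : ∀ {Y : Set} {w a} (y : Y) (ys : Vec Y w) (is : Vec (Fin w) a) →
                     Vec.map (lookup (y ∷ ys)) (Vec.map suc is) ≡ Vec.map (lookup ys) is
    map-lookup-suc y ys is = sym (Vec.map-∘ (lookup (y ∷ ys)) suc is)

  evalGate-suc : ∀ (I : Interpretation X) {w} (g : Gate X w) y ys → evalGate I (renameGate suc g) (y ∷ ys) ≡ evalGate I g ys
  evalGate-suc I (And is)     y ys = cong (Vec.foldr _ _∧_ true) (map-lookup-suc y ys is)
  evalGate-suc I (Or is)      y ys = cong (Vec.foldr _ _∨_ false) (map-lookup-suc y ys is)
  evalGate-suc I (Not i)      y ys = refl
  evalGate-suc I (Extra x is) y ys = cong (I x) (map-lookup-suc y ys is)

  gateDepth-suc : ∀ {w} (g : Gate X w) d ds → gateDepth (renameGate suc g) (d ∷ ds) ≡ gateDepth g ds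
  gateDepth-suc (And is)     d ds = cong (suc ∘ max) (map-lookup-suc d ds is)
  gateDepth-suc (Or is)      d ds = cong (suc ∘ max) (map-lookup-suc d ds is)
  gateDepth-suc (Not i)      d ds = refl
  gateDepth-suc (Extra x is) d ds = cong (suc ∘ max) (map-lookup-suc d ds is)

  -- A gate refers to the wires available when it was added, whereas the network has one fixed set
  -- of vertices; so the arguments are renamed to wires of the complete circuit.
  origin : ∀ {n s} → Gates X n s → Fin (s + n) → Fin n ⊎ Gate X (s + n)
  origin []       i       = inj₁ i
  origin (gs ▷ g) zero    = inj₂ (renameGate suc g)
  origin (gs ▷ g) (suc i) = Sum.map₂ (renameGate suc) (origin gs i)

  module _ (I : Interpretation X) where

    origin-value : ∀ {n s} (gs : Gates X n s) v i →
      lookup (evalGates I gs v) i ≡ [ lookup v , (λ g → evalGate I g (evalGates I gs v)) ]′ (origin gs i)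
    origin-value []       v i       = refl
    origin-value (gs ▷ g) v zero    = sym (evalGate-suc I g _ _)
    origin-value (gs ▷ g) v (suc i) = trans (origin-value gs v i) (lemma (origin gs i))
      where
      lemma : ∀ o → [ lookup v , (λ g → evalGate I g (evalGates I gs v)) ]′ o ≡
                    [ lookup v , (λ h → evalGate I h (evalGates I (gs ▷ g) v)) ]′ (Sum.map₂ (renameGate suc) o)
      lemma (inj₁ x) = refl
      lemma (inj₂ h) = sym (evalGate-suc I h _ _)

  origin-depth : ∀ {n s} (gs : Gates X n s) i →
    lookup (wireDepths gs) i ≡ [ (λ _ → 0) , (λ g → gateDepth g (wireDepths gs)) ]′ (origin gs i)
  origin-depth {n} []       i = Vec.lookup-replicate i 0
  origin-depth (gs ▷ g) zero    = sym (gateDepth-suc g _ _)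
  origin-depth (gs ▷ g) (suc i) = trans (origin-depth gs i) (lemma (origin gs i))
    where
    lemma : ∀ o → [ (λ _ → 0) , (λ g → gateDepth g (wireDepths gs)) ]′ o ≡
                  [ (λ _ → 0) , (λ h → gateDepth h (wireDepths (gs ▷ g))) ]′ (Sum.map₂ (renameGate suc) o)
    lemma (inj₁ x) = refl
    lemma (inj₂ h) = sym (gateDepth-suc h _ _)

sameᵇ : ∀ {w} → Fin w → Fin w → Bool
sameᵇ i j = does (i Fin.≟ j)

same-refl : ∀ {w} (i : Fin w) → sameᵇ i i ≡ true
same-refl i with i Fin.≟ i
... | yes _ = refl
... | no ≢  = contradiction refl ≢

same⇒≡ : ∀ {w} {i j : Fin w} → sameᵇ i j ≡ true → i ≡ j
same⇒≡ {i = i} {j} eq with i Fin.≟ j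
same⇒≡ _  | yes i≡j = i≡j
same⇒≡ () | no _

-- Multiplicities are forgotten. Conjunction and disjunction are insensitive to them, and a network
-- edge is a single bit.
reads : ∀ {w a} → Vec (Fin w) a → Fin w → Bool
reads []       j = false
reads (i ∷ is) j = sameᵇ i j ∨ reads is j

reads-⊔ : ∀ {w a} (is : Vec (Fin w) a) (ds : Fin w → ℕ) {j} → reads is j ≡ true → ds j ≤ max (Vec.map ds is)
reads-⊔ (i ∷ is) ds {j} eq with sameᵇ i j in same
... | true  = subst (λ i → ds j ≤ ds i ⊔ _) (sym (same⇒≡ same)) (ℕ.m≤m⊔n (ds j) _)
... | false = ℕ.≤-trans (reads-⊔ is ds eq) (ℕ.m≤n⊔m (ds i) _)

private
  ∨-introʳ : ∀ x {y} → y ≡ true → x ∨ y ≡ true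
  ∨-introʳ true  _ = refl
  ∨-introʳ false p = p

⋁-reads : ∀ {w a} (is : Vec (Fin w) a) (f : Fin w → Bool) →
          (Vec.foldr _ _∨_ false (Vec.map f is) ≡ true × ∃[ j ] reads is j ≡ true × f j ≡ true) ⊎
          (Vec.foldr _ _∨_ false (Vec.map f is) ≡ false × (∀ j → reads is j ≡ true → f j ≡ false))
⋁-reads []       f = inj₂ (refl , λ _ ())
⋁-reads (i ∷ is) f with f i in fi
... | true  = inj₁ (refl , i , subst (λ b → b ∨ reads is i ≡ true) (sym (same-refl i)) refl , fi)
... | false with ⋁-reads is f
...   | inj₁ (eq , j , j∈ , fj) = inj₁ (eq , j , ∨-introʳ (sameᵇ i j) j∈ , fj)
...   | inj₂ (eq , none) = inj₂ (eq , all)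
  where
  all : ∀ j → sameᵇ i j ∨ reads is j ≡ true → f j ≡ false
  all j j∈ with sameᵇ i j in same
  ... | true  = subst (λ i → f i ≡ false) (same⇒≡ same) fi
  ... | false = none j j∈

⋀-reads : ∀ {w a} (is : Vec (Fin w) a) (f : Fin w → Bool) →
          (Vec.foldr _ _∧_ true (Vec.map f is) ≡ false × ∃[ j ] reads is j ≡ true × f j ≡ false) ⊎
          (Vec.foldr _ _∧_ true (Vec.map f is) ≡ true × (∀ j → reads is j ≡ true → f j ≡ true))
⋀-reads []       f = inj₂ (refl , λ _ ())
⋀-reads (i ∷ is) f with f i in fi
... | false = inj₁ (refl , i , subst (λ b → b ∨ reads is i ≡ true) (sym (same-refl i)) refl , fi)
... | true with ⋀-reads is f
...   | inj₁ (eq , j , j∈ , fj) = inj₁ (eq , j , ∨-introʳ (sameᵇ i j) j∈ , fj)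
...   | inj₂ (eq , none) = inj₂ (eq , all)
  where
  all : ∀ j → sameᵇ i j ∨ reads is j ≡ true → f j ≡ true
  all j j∈ with sameᵇ i j in same
  ... | true  = subst (λ i → f i ≡ true) (same⇒≡ same) fi
  ... | false = none j j∈

constᶠ : Bool → Formula X V
constᶠ true  = ⋀ {a = 0} λ ()
constᶠ false = ⋁ {a = 0} λ ()

constᶠ-eval : ∀ (I : Interpretation X) (ρ : V → Bool) b → evalᶠ I ρ (constᶠ b) ≡ b
constᶠ-eval I ρ true  = refl
constᶠ-eval I ρ false = refl

-- The bounds met by the formula of each single bit of the query; a negated input attains both of
-- them.
record Cheap {X V} (φ : Formula X V) : Set where
  constructor mkCheap
  field
    size≤2  : sizeᶠ φ ≤ 2
    depth≤1 : depthᶠ φ ≤ 1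

constᶠ-cheap : ∀ b → Cheap (constᶠ {X} {V} b)
constᶠ-cheap true  = mkCheap (s≤s z≤n) (s≤s z≤n)
constᶠ-cheap false = mkCheap (s≤s z≤n) (s≤s z≤n)

if-cheap : ∀ b {φ ψ : Formula X V} → Cheap φ → Cheap ψ → Cheap (if b then φ else ψ)
if-cheap true  p _ = p
if-cheap false _ q = q

-- The vertices inj₁ i and inj₂ i of the network stand for wire i and for its
-- negation.  Each of them is the negated disjunction of other vertices; for an
-- input, which of the two has no predecessor depends on the input's value.
module CircuitNetwork {n s} (gs : Gates ⊥ n s) where

  Literal : Set
  Literal = Fin (s + n) ⊎ Fin (s + n)

  -- One literal of a gate is a negated disjunction of literals of its arguments, for `And` by De
  -- Morgan; the other literal negates this one and so lags one round behind. Only the rows of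
  -- inputs contain a variable.
  positive negative : Fin n ⊎ Gate ⊥ (s + n) → Fin (s + n) → Literal → Formula X (Fin n)
  positive (inj₁ x)          i (inj₂ j) = if sameᵇ i j then neg (var x) else constᶠ false
  positive (inj₂ (And is))   i (inj₂ j) = constᶠ (reads is j)
  positive (inj₂ (Or is))    i (inj₂ j) = constᶠ (sameᵇ i j)
  positive (inj₂ (Not h))    i (inj₁ j) = constᶠ (sameᵇ h j)
  positive (inj₂ (Extra () _))
  positive _                 i _        = constᶠ false
  negative (inj₁ x)          i (inj₁ j) = if sameᵇ i j then var x else constᶠ false
  negative (inj₂ (And is))   i (inj₁ j) = constᶠ (sameᵇ i j)
  negative (inj₂ (Or is))    i (inj₁ j) = constᶠ (reads is j)
  negative (inj₂ (Not h))    i (inj₁ j) = constᶠ (sameᵇ i j)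
  negative (inj₂ (Extra () _))
  negative _                 i _        = constᶠ false

  predecessor : Literal → Literal → Formula X (Fin n)
  predecessor (inj₁ i) = positive (origin gs i) i
  predecessor (inj₂ i) = negative (origin gs i) i


  private
    positive-cheap : ∀ o i u → Cheap (positive {X} o i u)
    positive-cheap (inj₁ x)        i (inj₁ j) = constᶠ-cheap false
    positive-cheap (inj₁ x)        i (inj₂ j) = if-cheap (sameᵇ i j) (mkCheap (s≤s (s≤s z≤n)) (s≤s z≤n)) (constᶠ-cheap false)
    positive-cheap (inj₂ (And is)) i (inj₁ j) = constᶠ-cheap false
    positive-cheap (inj₂ (And is)) i (inj₂ j) = constᶠ-cheap (reads is j)
    positive-cheap (inj₂ (Or is))  i (inj₁ j) = constᶠ-cheap false
    positive-cheap (inj₂ (Or is))  i (inj₂ j) = constᶠ-cheap (sameᵇ i j)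
    positive-cheap (inj₂ (Not h))  i (inj₁ j) = constᶠ-cheap (sameᵇ h j)
    positive-cheap (inj₂ (Not h))  i (inj₂ j) = constᶠ-cheap false

    negative-cheap : ∀ o i u → Cheap (negative {X} o i u)
    negative-cheap (inj₁ x)        i (inj₁ j) = if-cheap (sameᵇ i j) (mkCheap z≤n z≤n) (constᶠ-cheap false)
    negative-cheap (inj₁ x)        i (inj₂ j) = constᶠ-cheap false
    negative-cheap (inj₂ (And is)) i (inj₁ j) = constᶠ-cheap (sameᵇ i j)
    negative-cheap (inj₂ (And is)) i (inj₂ j) = constᶠ-cheap false
    negative-cheap (inj₂ (Or is))  i (inj₁ j) = constᶠ-cheap (reads is j)
    negative-cheap (inj₂ (Or is))  i (inj₂ j) = constᶠ-cheap false
    negative-cheap (inj₂ (Not h))  i (inj₁ j) = constᶠ-cheap (sameᵇ i j)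
    negative-cheap (inj₂ (Not h))  i (inj₂ j) = constᶠ-cheap false

  predecessor-cheap : ∀ v u → Cheap (predecessor {X} v u)
  predecessor-cheap (inj₁ i) u = positive-cheap (origin gs i) i u
  predecessor-cheap (inj₂ i) u = negative-cheap (origin gs i) i u

  -- Nothing is assumed about layer 0, where the truth of a vertex depends on the node numbers and
  -- is meaningless. A vertex without predecessors is true from layer 1 on, and correct values
  -- spread from there.
  module Stabilisation {X : Set} (I : Interpretation X) (x : Vec Bool n) {L : ℕ}
    (Holds : Fin (suc L) → Literal → Bool → Set)
    (nor-true : ∀ {t t′ : Fin (suc L)} v → toℕ t ≡ suc (toℕ t′) →
                (∀ u → evalᶠ I (lookup x) (predecessor v u) ≡ true → Holds t′ u false) → Holds t v true)
    (nor-false : ∀ {t t′ : Fin (suc L)} v → toℕ t ≡ suc (toℕ t′) →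
                 ∀ u → evalᶠ I (lookup x) (predecessor v u) ≡ true → Holds t′ u true → Holds t v false)
    where

    private
      depthOf : Fin (s + n) → ℕ
      depthOf = depthAt gs

      value : Fin (s + n) → Bool
      value = lookup (evalGates noGates gs x)

      S : Literal → Literal → Bool
      S v u = evalᶠ I (lookup x) (predecessor v u)

      previous : ∀ {m} (t : Fin (suc L)) → suc m ≤ toℕ t → Σ[ t′ ∈ Fin (suc L) ] toℕ t ≡ suc (toℕ t′) × m ≤ toℕ t′
      previous (suc t) (s≤s le) = Fin.inject₁ t , cong suc (sym (Fin.toℕ-inject₁ t)) , ℕ.≤-trans le (ℕ.≤-reflexive (sym (Fin.toℕ-inject₁ t)))

      record Negates (v u : Literal) : Set where
        constructor mkNegates
        field
          edge : S v u ≡ true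
          only : ∀ w → S v w ≡ true → w ≡ u

      negates : ∀ {t t′ : Fin (suc L)} {v u β} → toℕ t ≡ suc (toℕ t′) → Negates v u → Holds t′ u β → Holds t v (not β)
      negates {β = true}  eq (mkNegates edge _) holds = nor-false _ eq _ edge holds
      negates {β = false} eq (mkNegates _ only) holds = nor-true _ eq λ w Svw → subst (λ w → Holds _ w false) (sym (only w Svw)) holds

      negates-at : ∀ {m v u β γ} → Negates v u → not β ≡ γ → (∀ (t : Fin (suc L)) → m ≤ toℕ t → Holds t u β) → ∀ (t : Fin (suc L)) → suc m ≤ toℕ t → Holds t v γ
      negates-at negated refl holds t le with previous t le
      ... | t′ , eq , le′ = negates eq negated (holds t′ le′)

      Pos Neg : ℕ → Fin (s + n) → Bool → Set
      Pos m i β = ∀ (t : Fin (suc L)) → m ≤ toℕ t → Holds t (inj₁ i) β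
      Neg m i β = ∀ (t : Fin (suc L)) → m ≤ toℕ t → Holds t (inj₂ i) β

      false≢true : {Y : Set} → false ≡ true → Y
      false≢true ()

      module _ {i o} (eqₒ : origin gs i ≡ o) where

        pos-S : ∀ u → S (inj₁ i) u ≡ evalᶠ I (lookup x) (positive o i u)
        pos-S u = cong (λ o → evalᶠ I (lookup x) (positive o i u)) eqₒ

        neg-S : ∀ u → S (inj₂ i) u ≡ evalᶠ I (lookup x) (negative o i u)
        neg-S u = cong (λ o → evalᶠ I (lookup x) (negative o i u)) eqₒ

        value-≡ : value i ≡ [ lookup x , (λ g → evalGate noGates g (evalGates noGates gs x)) ]′ o
        value-≡ = trans (origin-value noGates gs x i) (cong [ lookup x , _ ]′ eqₒ)

        depth-≡ : depthOf i ≡ [ (λ _ → 0) , (λ g → gateDepth g (wireDepths gs)) ]′ o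
        depth-≡ = trans (origin-depth gs i) (cong [ _ , _ ]′ eqₒ)

      const-S : ∀ {b b′} → b ≡ evalᶠ I (lookup x) (constᶠ b′) → b ≡ b′
      const-S {b′ = b′} eq = trans eq (constᶠ-eval I (lookup x) b′)

      negates-inj₁ : ∀ {v j} → (∀ k → S v (inj₁ k) ≡ sameᵇ j k) → (∀ k → S v (inj₂ k) ≡ false) → Negates v (inj₁ j)
      negates-inj₁ {j = j} S₁ S₂ = mkNegates (trans (S₁ j) (same-refl j)) λ
        { (inj₁ k) eq → cong inj₁ (sym (same⇒≡ (trans (sym (S₁ k)) eq)))
        ; (inj₂ k) eq → false≢true (trans (sym (S₂ k)) eq) }

      negates-inj₂ : ∀ {v j} → (∀ k → S v (inj₂ k) ≡ sameᵇ j k) → (∀ k → S v (inj₁ k) ≡ false) → Negates v (inj₂ j)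
      negates-inj₂ {j = j} S₂ S₁ = mkNegates (trans (S₂ j) (same-refl j)) λ
        { (inj₂ k) eq → cong inj₂ (sym (same⇒≡ (trans (sym (S₂ k)) eq)))
        ; (inj₁ k) eq → false≢true (trans (sym (S₁ k)) eq) }

      stable-input : ∀ {i y} → origin gs i ≡ inj₁ y → Pos 2 i (value i) × Neg 2 i (not (value i))
      stable-input {i} {y} eqₒ = subst (λ b → Pos 2 i b × Neg 2 i (not b)) (sym (value-≡ eqₒ)) (cases (lookup x y) refl)
        where
        if-S : ∀ b (φ : Formula X (Fin n)) → evalᶠ I (lookup x) (if b then φ else constᶠ false) ≡ b ∧ evalᶠ I (lookup x) φ
        if-S true  φ = refl
        if-S false φ = refl
        ∧-false : ∀ b {c} → c ≡ false → b ∧ c ≡ false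
        ∧-false true  p = p
        ∧-false false p = refl
        ∧-true : ∀ b {c} → c ≡ true → b ∧ c ≡ b
        ∧-true true  p = p
        ∧-true false p = refl
        pos₂ : ∀ k → S (inj₁ i) (inj₂ k) ≡ sameᵇ i k ∧ not (lookup x y)
        pos₂ k = trans (pos-S eqₒ (inj₂ k)) (if-S (sameᵇ i k) (neg (var y)))
        neg₁ : ∀ k → S (inj₂ i) (inj₁ k) ≡ sameᵇ i k ∧ lookup x y
        neg₁ k = trans (neg-S eqₒ (inj₁ k)) (if-S (sameᵇ i k) (var y))
        source : ∀ {v} → (∀ w → S v w ≡ false) → ∀ (t : Fin (suc L)) → 1 ≤ toℕ t → Holds t v true
        source none t le with previous t le
        ... | t′ , eq , _ = nor-true _ eq λ w Svw → false≢true (trans (sym (none w)) Svw)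
        cases : ∀ b → lookup x y ≡ b → Pos 2 i b × Neg 2 i (not b)
        cases true  xy = (λ t le → pos t (ℕ.≤-trans (s≤s z≤n) le)) ,
          negates-at (negates-inj₁ (λ k → trans (neg₁ k) (∧-true (sameᵇ i k) xy)) (λ k → neg-S eqₒ (inj₂ k))) refl pos
          where
          pos : ∀ (t : Fin (suc L)) → 1 ≤ toℕ t → Holds t (inj₁ i) true
          pos = source λ { (inj₁ k) → pos-S eqₒ (inj₁ k) ; (inj₂ k) → trans (pos₂ k) (∧-false (sameᵇ i k) (cong not xy)) }
        cases false xy = negates-at (negates-inj₂ (λ k → trans (pos₂ k) (∧-true (sameᵇ i k) (cong not xy))) (λ k → pos-S eqₒ (inj₁ k))) refl neg′ ,
          (λ t le → neg′ t (ℕ.≤-trans (s≤s z≤n) le))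
          where
          neg′ : ∀ (t : Fin (suc L)) → 1 ≤ toℕ t → Holds t (inj₂ i) true
          neg′ = source λ { (inj₁ k) → trans (neg₁ k) (∧-false (sameᵇ i k) xy) ; (inj₂ k) → neg-S eqₒ (inj₂ k) }

      weakenᵗ : ∀ {v m β} → (∀ (t : Fin (suc L)) → suc m ≤ toℕ t → Holds t v β) → ∀ (t : Fin (suc L)) → 2 + m ≤ toℕ t → Holds t v β
      weakenᵗ holds t le = holds t (ℕ.≤-trans (ℕ.n≤1+n _) le)

      stable-or : ∀ {i a m} {is : Vec (Fin (s + n)) a} → origin gs i ≡ inj₂ (Or is) →
                  (∀ {j} → reads is j ≡ true → Pos m j (value j) × Neg m j (not (value j))) →
                  Pos (2 + m) i (value i) × Neg (2 + m) i (not (value i))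
      stable-or {i} {m = m} {is} eqₒ ih = negates-at pos-negates (not-not (value i)) neg-holds , weakenᵗ neg-holds
        where
        not-not : ∀ b → not (not b) ≡ b
        not-not true  = refl
        not-not false = refl
        pos-negates : Negates (inj₁ i) (inj₂ i)
        pos-negates = negates-inj₂ (λ k → const-S (pos-S eqₒ (inj₂ k))) (λ k → pos-S eqₒ (inj₁ k))
        neg-S₁ : ∀ k → S (inj₂ i) (inj₁ k) ≡ reads is k
        neg-S₁ k = const-S (neg-S eqₒ (inj₁ k))
        neg-holds : Neg (suc m) i (not (value i))
        neg-holds t le with previous t le
        ... | t′ , eq , le′ = subst (Holds t (inj₂ i) ∘ not) (sym (value-≡ eqₒ)) (case ⋁-reads is value of λ
          { (inj₁ (v≡ , j , j∈ , vj)) → subst (Holds t (inj₂ i) ∘ not) (sym v≡)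
              (nor-false _ eq (inj₁ j) (trans (neg-S₁ j) j∈) (subst (Holds t′ (inj₁ j)) vj (proj₁ (ih j∈) t′ le′)))
          ; (inj₂ (v≡ , none)) → subst (Holds t (inj₂ i) ∘ not) (sym v≡)
              (nor-true _ eq λ
                { (inj₁ j) Sj → let j∈ = trans (sym (neg-S₁ j)) Sj in subst (Holds t′ (inj₁ j)) (none j j∈) (proj₁ (ih j∈) t′ le′)
                ; (inj₂ j) Sj → false≢true (trans (sym (neg-S eqₒ (inj₂ j))) Sj) }) })

      stable-and : ∀ {i a m} {is : Vec (Fin (s + n)) a} → origin gs i ≡ inj₂ (And is) →
                   (∀ {j} → reads is j ≡ true → Pos m j (value j) × Neg m j (not (value j))) →
                   Pos (2 + m) i (value i) × Neg (2 + m) i (not (value i))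
      stable-and {i} {m = m} {is} eqₒ ih = weakenᵗ pos-holds , negates-at neg-negates refl pos-holds
        where
        neg-negates : Negates (inj₂ i) (inj₁ i)
        neg-negates = negates-inj₁ (λ k → const-S (neg-S eqₒ (inj₁ k))) (λ k → neg-S eqₒ (inj₂ k))
        pos-S₂ : ∀ k → S (inj₁ i) (inj₂ k) ≡ reads is k
        pos-S₂ k = const-S (pos-S eqₒ (inj₂ k))
        pos-holds : Pos (suc m) i (value i)
        pos-holds t le with previous t le
        ... | t′ , eq , le′ = subst (Holds t (inj₁ i)) (sym (value-≡ eqₒ)) (case ⋀-reads is value of λ
          { (inj₁ (v≡ , j , j∈ , vj)) → subst (Holds t (inj₁ i)) (sym v≡)
              (nor-false _ eq (inj₂ j) (trans (pos-S₂ j) j∈) (subst (Holds t′ (inj₂ j) ∘ not) vj (proj₂ (ih j∈) t′ le′)))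
          ; (inj₂ (v≡ , all)) → subst (Holds t (inj₁ i)) (sym v≡)
              (nor-true _ eq λ
                { (inj₂ j) Sj → let j∈ = trans (sym (pos-S₂ j)) Sj in subst (Holds t′ (inj₂ j) ∘ not) (all j j∈) (proj₂ (ih j∈) t′ le′)
                ; (inj₁ j) Sj → false≢true (trans (sym (pos-S eqₒ (inj₁ j))) Sj) }) })

      stable-not : ∀ {i h m} → origin gs i ≡ inj₂ (Not h) → Pos m h (value h) →
                   Pos (2 + m) i (value i) × Neg (2 + m) i (not (value i))
      stable-not {i} {h} {m} eqₒ ih = weakenᵗ pos-holds ,
        negates-at (negates-inj₁ (λ k → const-S (neg-S eqₒ (inj₁ k))) (λ k → neg-S eqₒ (inj₂ k))) refl pos-holds
        where
        pos-holds : Pos (suc m) i (value i)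
        pos-holds = negates-at (negates-inj₁ (λ k → const-S (pos-S eqₒ (inj₁ k))) (λ k → pos-S eqₒ (inj₂ k))) (sym (value-≡ eqₒ)) ih

    -- An input has one literal right from layer 1 and the other, its negation, from layer 2. Each
    -- further level of gates costs two rounds for the same reason. `D` bounds the depth for the
    -- induction, since the arguments of a gate are not structurally smaller.
    stable : ∀ D {i} → depthOf i < D → Pos (2 + 2 * depthOf i) i (value i) × Neg (2 + 2 * depthOf i) i (not (value i))
    stable (suc D) {i} depthOf<D = cases (origin gs i) refl
      where
      later : ∀ {j} → depthOf j < depthOf i → Pos (2 * depthOf i) j (value j) × Neg (2 * depthOf i) j (not (value j))
      later {j} lt with stable D {j} (ℕ.<-≤-trans lt (s≤s⁻¹ depthOf<D))
      ... | pos , neg′ = (λ t le → pos t (ℕ.≤-trans earlier le)) , (λ t le → neg′ t (ℕ.≤-trans earlier le))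
        where
        earlier : 2 + 2 * depthOf j ≤ 2 * depthOf i
        earlier = ℕ.≤-trans (ℕ.≤-reflexive (sym (ℕ.*-suc 2 (depthOf j)))) (ℕ.*-monoʳ-≤ 2 lt)
      reads-< : ∀ {a} {is : Vec (Fin (s + n)) a} → depthOf i ≡ suc (max (Vec.map depthOf is)) → ∀ {j} → reads is j ≡ true → depthOf j < depthOf i
      reads-< {is = is} eq j∈ = subst (_ <_) (sym eq) (s≤s (reads-⊔ is depthOf j∈))
      cases : ∀ o → origin gs i ≡ o → Pos (2 + 2 * depthOf i) i (value i) × Neg (2 + 2 * depthOf i) i (not (value i))
      cases (inj₁ y)            eqₒ = (λ t le → proj₁ (stable-input eqₒ) t (ℕ.≤-trans (ℕ.m≤m+n 2 _) le)) ,
                                      (λ t le → proj₂ (stable-input eqₒ) t (ℕ.≤-trans (ℕ.m≤m+n 2 _) le))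
      cases (inj₂ (And is))     eqₒ = stable-and eqₒ λ j∈ → later (reads-< {is = is} (depth-≡ eqₒ) j∈)
      cases (inj₂ (Or is))      eqₒ = stable-or eqₒ λ j∈ → later (reads-< {is = is} (depth-≡ eqₒ) j∈)
      cases (inj₂ (Not h))      eqₒ = stable-not eqₒ (proj₁ (later (ℕ.≤-reflexive (sym (depth-≡ eqₒ)))))
      cases (inj₂ (Extra () _)) eqₒ

-- The reduction

module Reduce {n k : ℕ} (C : Circuit ⊥ n) (b : ℕ) where

  open Circuit C
  open CircuitNetwork gates

  N L : ℕ
  N = (gateCount + n) + (gateCount + n)
  -- The first layer in which `stable` applies to all wires, whatever their depth.
  L = 2 + 2 * depth C

  module _ (fits : 4 + b + suc L * (2 + N) ≤ 3 ^ b) where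

    open Layout N L b fits

    private
      literal : Fin N → Literal
      literal = Fin.splitAt (gateCount + n)

      vertexOf : Literal → Fin N
      vertexOf = Fin.join (gateCount + n) (gateCount + n)

      literal-vertexOf : ∀ v → literal (vertexOf v) ≡ v
      literal-vertexOf = Fin.splitAt-join (gateCount + n) (gateCount + n)

      vertexOf-literal : ∀ v → vertexOf (literal v) ≡ v
      vertexOf-literal = Fin.join-splitAt (gateCount + n) (gateCount + n)

    edgeᶠ : Fin N → Fin N → Formula ⊤ (Fin n)
    edgeᶠ v u = predecessor (literal v) (literal u)

    -- The threshold and the output literal in the last layer. Their values differ, so asking for ≤
    -- is the same as asking for <.
    first second : Node
    first  = slotAt (Fin.fromℕ L) θ
    second = slotAt (Fin.fromℕ L) (vertex (vertexOf (inj₁ output)))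

    bitᶠ : Coefficient → Fin 2 → Formula ⊤ (Fin n)
    bitᶠ c β = constᶠ (lookup (bits c) β)

    -- An edge makes the coefficient −𝟏, whose two bits are both set.
    weightᶠ : Fin width → Fin width → Fin 2 → Formula ⊤ (Fin n)
    weightᶠ H          H          β = bitᶠ 𝟏 β
    weightᶠ H          θ          β = bitᶠ 𝟏 β
    weightᶠ H          (vertex u) β = bitᶠ 𝟎 β
    weightᶠ θ          H          β = bitᶠ 𝟏 β
    weightᶠ θ          θ          β = bitᶠ −𝟏 β
    weightᶠ θ          (vertex u) β = bitᶠ 𝟎 β
    weightᶠ (vertex v) H          β = bitᶠ 𝟏 β
    weightᶠ (vertex v) θ          β = bitᶠ 𝟎 β
    weightᶠ (vertex v) (vertex u) β = edgeᶠ v u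

    coefficientᶠ : Node → Kind → Kind → Fin 2 → Formula ⊤ (Fin n)
    coefficientᶠ P (chain i)  (chain j)    β = bitᶠ (if toℕ i ≡ᵇ suc (toℕ j) then 𝟏 else 𝟎) β
    coefficientᶠ P (slot t u) (chain j)    β = bitᶠ (label P (slot t u) j) β
    coefficientᶠ P pad        (chain j)    β = bitᶠ (label P pad j) β
    coefficientᶠ P (slot t u) (slot t′ u′) β = if toℕ t ≡ᵇ suc (toℕ t′) then weightᶠ u u′ β else bitᶠ 𝟎 β
    coefficientᶠ P _          _            β = bitᶠ 𝟎 β

    entryᶠ : Node → Node → Fin 2 → Formula ⊤ (Fin n)
    entryᶠ P Q = coefficientᶠ P (kind P) (kind Q)

    wordᶠ′ : Fin (3 ^ b * (3 ^ b * 2)) ⊎ Fin (3 ^ b + 3 ^ b) → Formula ⊤ (Fin n)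
    wordᶠ′ (inj₁ i) = let (P , j) = Fin.remQuot {3 ^ b} (3 ^ b * 2) i ; (Q , β) = Fin.remQuot {3 ^ b} 2 j in entryᶠ P Q β
    wordᶠ′ (inj₂ i) = constᶠ (lookup (oneHot first Vec.++ oneHot second) i)

    wordᶠ : Fin (len (3 ^ b)) → Formula ⊤ (Fin n)
    wordᶠ i = wordᶠ′ (Fin.splitAt (3 ^ b * (3 ^ b * 2)) i)

    query : Formula ⊤ (Fin n)
    query = extra tt wordᶠ

    private
      bit-cheap : ∀ c β → Cheap (bitᶠ c β)
      bit-cheap c β = constᶠ-cheap (lookup (bits c) β)

      weight-cheap : ∀ u u′ β → Cheap (weightᶠ u u′ β)
      weight-cheap H          H          β = bit-cheap 𝟏 β
      weight-cheap H          θ          β = bit-cheap 𝟏 β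
      weight-cheap H          (vertex u) β = bit-cheap 𝟎 β
      weight-cheap θ          H          β = bit-cheap 𝟏 β
      weight-cheap θ          θ          β = bit-cheap −𝟏 β
      weight-cheap θ          (vertex u) β = bit-cheap 𝟎 β
      weight-cheap (vertex v) H          β = bit-cheap 𝟏 β
      weight-cheap (vertex v) θ          β = bit-cheap 𝟎 β
      weight-cheap (vertex v) (vertex u) β = predecessor-cheap (literal v) (literal u)

      coefficient-cheap : ∀ P κ κ′ β → Cheap (coefficientᶠ P κ κ′ β)
      coefficient-cheap P (chain i)  (chain j)    β = bit-cheap (if toℕ i ≡ᵇ suc (toℕ j) then 𝟏 else 𝟎) β
      coefficient-cheap P (chain i)  (slot _ _)   β = bit-cheap 𝟎 β
      coefficient-cheap P (chain i)  pad          β = bit-cheap 𝟎 β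
      coefficient-cheap P (slot t u) (chain j)    β = bit-cheap (label P (slot t u) j) β
      coefficient-cheap P (slot t u) (slot t′ u′) β = if-cheap (toℕ t ≡ᵇ suc (toℕ t′)) (weight-cheap u u′ β) (bit-cheap 𝟎 β)
      coefficient-cheap P (slot t u) pad          β = bit-cheap 𝟎 β
      coefficient-cheap P pad        (chain j)    β = bit-cheap (label P pad j) β
      coefficient-cheap P pad        (slot _ _)   β = bit-cheap 𝟎 β
      coefficient-cheap P pad        pad          β = bit-cheap 𝟎 β

      word-cheap : ∀ i → Cheap (wordᶠ′ i)
      word-cheap (inj₁ i) = let (P , j) = Fin.remQuot {3 ^ b} (3 ^ b * 2) i ; (Q , β) = Fin.remQuot {3 ^ b} 2 j in
        coefficient-cheap P (kind P) (kind Q) β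
      word-cheap (inj₂ i) = constᶠ-cheap (lookup (oneHot first Vec.++ oneHot second) i)

    query-size : sizeᶠ query ≤ suc (len (3 ^ b)) + len (3 ^ b) * 2
    query-size = ℕ.+-monoʳ-≤ (suc (len (3 ^ b))) (sum-tabulate-≤ (sizeᶠ ∘ wordᶠ) λ i → Cheap.size≤2 (word-cheap (Fin.splitAt _ i)))

    query-depth : depthᶠ query ≤ 2
    query-depth = s≤s (max-tabulate-≤ (depthᶠ ∘ wordᶠ) λ i → Cheap.depth≤1 (word-cheap (Fin.splitAt _ i)))

    -- The input affects only the coefficients between vertices of consecutive layers. The number of
    -- nodes, their kinds and the two compared nodes are the same for all inputs of one length.
    module Instance (I : Interpretation ⊤) (x : Vec Bool n) (depthBound : ∀ d → d ≡ r + L → d ≤ 1 ·log^ k ⟨ 3 ^ b ⟩) where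

      S : Fin N → Fin N → Bool
      S v u = evalᶠ I (lookup x) (edgeᶠ v u)

      module Network = NorNetwork N L b S fits

      comparisonInstance : ComparisonInstance k
      comparisonInstance = record
        { Π              = Network.Π
        ; A              = first
        ; B              = second
        ; isPowerCircuit = Network.isPowerCircuit
        ; depthBound     = r + L , Network.depth≡r+L , depthBound (r + L) refl
        ; compact        = Network.compact
        ; distinct       = Network.distinct
        }

      private
        bit-eval : ∀ c β → evalᶠ I (lookup x) (bitᶠ c β) ≡ lookup (bits c) β
        bit-eval c β = constᶠ-eval I (lookup x) (lookup (bits c) β)

        edge-bits : ∀ c β → c ≡ lookup (bits (if c then −𝟏 else 𝟎)) β
        edge-bits true  zero       = refl
        edge-bits true  (suc zero) = refl
        edge-bits false zero       = refl
        edge-bits false (suc zero) = refl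

        weight-eval : ∀ u u′ β → evalᶠ I (lookup x) (weightᶠ u u′ β) ≡ lookup (bits (Network.weight u u′)) β
        weight-eval H          H          β = bit-eval 𝟏 β
        weight-eval H          θ          β = bit-eval 𝟏 β
        weight-eval H          (vertex u) β = bit-eval 𝟎 β
        weight-eval θ          H          β = bit-eval 𝟏 β
        weight-eval θ          θ          β = bit-eval −𝟏 β
        weight-eval θ          (vertex u) β = bit-eval 𝟎 β
        weight-eval (vertex v) H          β = bit-eval 𝟏 β
        weight-eval (vertex v) θ          β = bit-eval 𝟎 β
        weight-eval (vertex v) (vertex u) β = edge-bits (S v u) β

        coefficient-eval : ∀ P κ κ′ β → evalᶠ I (lookup x) (coefficientᶠ P κ κ′ β) ≡ lookup (bits (Network.coefficient P κ κ′)) β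
        coefficient-eval P (chain i)  (chain j)    β = bit-eval (if toℕ i ≡ᵇ suc (toℕ j) then 𝟏 else 𝟎) β
        coefficient-eval P (chain i)  (slot _ _)   β = bit-eval 𝟎 β
        coefficient-eval P (chain i)  pad          β = bit-eval 𝟎 β
        coefficient-eval P (slot t u) (chain j)    β = bit-eval (label P (slot t u) j) β
        coefficient-eval P (slot t u) (slot t′ u′) β with toℕ t ≡ᵇ suc (toℕ t′)
        ... | true  = weight-eval u u′ β
        ... | false = bit-eval 𝟎 β
        coefficient-eval P (slot t u) pad          β = bit-eval 𝟎 β
        coefficient-eval P pad        (chain j)    β = bit-eval (label P pad j) β
        coefficient-eval P pad        (slot _ _)   β = bit-eval 𝟎 β
        coefficient-eval P pad        pad          β = bit-eval 𝟎 β

        entry-eval : ∀ P Q β → evalᶠ I (lookup x) (entryᶠ P Q β) ≡ lookup (bits (Network.δ P Q)) β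
        entry-eval P Q β = trans (coefficient-eval P (kind P) (kind Q) β)
          (cong (λ c → lookup (bits c) β) (sym (Network.δ-at {P} {Q} refl refl)))

        word : Vec Bool (len (3 ^ b))
        word = Problem.encode (Comparison k) comparisonInstance

        matrix : Vec Bool (3 ^ b * (3 ^ b * 2))
        matrix = Vec.concat (tabulate λ P → Vec.concat (tabulate λ Q → bits (Network.δ P Q)))

        word-eval : ∀ i o → Fin.splitAt (3 ^ b * (3 ^ b * 2)) i ≡ o → evalᶠ I (lookup x) (wordᶠ′ o) ≡ lookup word i
        word-eval i (inj₁ y) eq = begin
          evalᶠ I (lookup x) (entryᶠ P Q β)      ≡⟨ entry-eval P Q β ⟩
          lookup (bits (Network.δ P Q)) β         ≡⟨ Decide.lookup-entry {k = k} comparisonInstance I P Q β ⟨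
          lookup word (Fin.combine P (Fin.combine Q β) Fin.↑ˡ (3 ^ b + 3 ^ b))
            ≡⟨ cong (λ j → lookup word (j Fin.↑ˡ (3 ^ b + 3 ^ b)))
                 (trans (cong (Fin.combine P) (Fin.combine-remQuot {3 ^ b} 2 j)) (Fin.combine-remQuot {3 ^ b} (3 ^ b * 2) y)) ⟩
          lookup word (y Fin.↑ˡ (3 ^ b + 3 ^ b)) ≡⟨ cong (lookup word) (Fin.splitAt⁻¹-↑ˡ eq) ⟩
          lookup word i                           ∎
          where
          open ≡-Reasoning
          P = proj₁ (Fin.remQuot {3 ^ b} (3 ^ b * 2) y)
          j = proj₂ (Fin.remQuot {3 ^ b} (3 ^ b * 2) y)
          Q = proj₁ (Fin.remQuot {3 ^ b} 2 j)
          β = proj₂ (Fin.remQuot {3 ^ b} 2 j)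
        word-eval i (inj₂ y) eq = begin
          evalᶠ I (lookup x) (constᶠ (lookup (oneHot first Vec.++ oneHot second) y)) ≡⟨ constᶠ-eval I (lookup x) _ ⟩
          lookup (oneHot first Vec.++ oneHot second) y ≡⟨ Vec.lookup-++ʳ matrix (oneHot first Vec.++ oneHot second) y ⟨
          lookup word ((3 ^ b * (3 ^ b * 2)) Fin.↑ʳ y)  ≡⟨ cong (lookup word) (Fin.splitAt⁻¹-↑ʳ eq) ⟩
          lookup word i                                 ∎
          where open ≡-Reasoning

      query-eval : evalᶠ I (lookup x) query ≡ I tt word
      query-eval = cong (I tt) (trans (Vec.tabulate-cong λ i → word-eval i (Fin.splitAt _ i) refl) (Vec.tabulate∘lookup word))

      private
        Holds : Fin (suc L) → Literal → Bool → Set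
        Holds t v = Network.Holds t (vertexOf v)

        literal-edge : ∀ v u → S (vertexOf v) u ≡ evalᶠ I (lookup x) (predecessor v (literal u))
        literal-edge v u = cong (λ v → evalᶠ I (lookup x) (predecessor v (literal u))) (literal-vertexOf v)

        nor-true : ∀ {t t′ : Fin (suc L)} v → toℕ t ≡ suc (toℕ t′) →
                   (∀ u → evalᶠ I (lookup x) (predecessor v u) ≡ true → Holds t′ u false) → Holds t v true
        nor-true {t} {t′} v eq all-false = Network.nor-true {t} {t′} {vertexOf v} eq λ u edge →
          subst (λ u → Network.Holds t′ u false) (vertexOf-literal u)
            (all-false (literal u) (trans (sym (literal-edge v u)) edge))

        nor-false : ∀ {t t′ : Fin (suc L)} v → toℕ t ≡ suc (toℕ t′) →
                    ∀ u → evalᶠ I (lookup x) (predecessor v u) ≡ true → Holds t′ u true → Holds t v false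
        nor-false {t} {t′} v eq u edge = Network.nor-false {t} {t′} {vertexOf v} eq (vertexOf u)
          (trans (literal-edge v (vertexOf u))
            (trans (cong (λ u → evalᶠ I (lookup x) (predecessor v u)) (literal-vertexOf u)) edge))

        open Stabilisation I x Holds nor-true nor-false

        output-depth : depthAt gates output ≤ depth C
        output-depth = subst (λ ds → depthAt gates output ≤ max ds) (Vec.tabulate∘lookup (wireDepths gates)) (≤-max-tabulate (depthAt gates) output)

        output-holds : Holds (Fin.fromℕ L) (inj₁ output) (eval noGates C x)
        output-holds = proj₁ (stable (suc (depthAt gates output)) {output} ℕ.≤-refl) (Fin.fromℕ L)
          (subst (2 + 2 * depthAt gates output ≤_) (sym (Fin.toℕ-fromℕ L)) (ℕ.+-monoʳ-≤ 2 (ℕ.*-monoʳ-≤ 2 output-depth)))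

      question : eval noGates C x ≡ true ⇔ Problem.Question (Comparison k) comparisonInstance
      question = mk⇔ (λ eq → Network.ε-mono (Network.all-valid first) (Network.all-valid second) (ℕ.<⇒≤ (subst (Holds (Fin.fromℕ L) (inj₁ output)) eq output-holds)))
                     (λ le → decide (eval noGates C x) refl (Network.ε-mono⁻ (Network.all-valid first) (Network.all-valid second) le))
        where
        decide : ∀ β → eval noGates C x ≡ β → Network.e first ≤ Network.e second → eval noGates C x ≡ true
        decide true  eq _  = eq
        decide false eq le = contradiction le (ℕ.<⇒≱ (subst (Holds (Fin.fromℕ L) (inj₁ output)) eq output-holds))

    -- The queried word encodes a genuine instance for every input, so the answers of the oracle
    -- outside the promise are never seen.
    query-correct : (oracle : ∀ {n} → Vec Bool n → Bool) → Decides oracle (Comparison k) →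
                    (∀ d → d ≡ r + L → d ≤ 1 ·log^ k ⟨ 3 ^ b ⟩) →
                    ∀ x → evalᶠ (λ _ → oracle) (lookup x) query ≡ true ⇔ eval noGates C x ≡ true
    query-correct oracle oracle-decides depthBound x = mk⇔
      (λ eq → from question (to decides (trans (sym query-eval) eq)))
      (λ eq → trans query-eval (from decides (to question eq)))
      where
      open Equivalence
      open Instance (λ _ → oracle) x depthBound
      decides : oracle (Problem.encode (Comparison k) comparisonInstance) ≡ true ⇔ Problem.Question (Comparison k) comparisonInstance
      decides = oracle-decides comparisonInstance

-- Choosing the number of nodes

n≤2^n : ∀ n → n ≤ 2 ^ n
n≤2^n n = ℕ.<⇒≤ (n<2^n n)

-- Leaves room for the chain of 4 + `n` nodes beside 2^`n` slots. The start is 3 because 15 ≤ 27,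
-- whereas 10 > 9 at 2.
4+n+2^n≤3^n : ∀ n → 3 ≤ n → 4 + n + 2 ^ n ≤ 3 ^ n
4+n+2^n≤3^n (suc zero)                  (s≤s ())
4+n+2^n≤3^n (suc (suc zero))            (s≤s (s≤s ()))
4+n+2^n≤3^n (suc (suc (suc zero)))      _ = ℕ.m≤m+n 15 12
4+n+2^n≤3^n (suc n@(suc (suc (suc m)))) _ = begin
  4 + suc n + 2 ^ suc n                       ≤⟨ ℕ.m≤m+n _ (13 + 2 * m + 2 ^ n) ⟩
  4 + suc n + 2 ^ suc n + (13 + 2 * m + 2 ^ n) ≡⟨ arith m (2 ^ n) ⟩
  3 * (4 + n + 2 ^ n)                         ≤⟨ ℕ.*-monoʳ-≤ 3 (4+n+2^n≤3^n n (s≤s (s≤s (s≤s z≤n)))) ⟩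
  3 ^ suc n                                   ∎
  where
  open ℕ.≤-Reasoning
  arith : ∀ m x → 4 + suc (3 + m) + 2 * x + (13 + 2 * m + x) ≡ 3 * (4 + (3 + m) + x)
  arith = solve-∀

k≥1⇒m≤m^k : ∀ {k} m → k ≥ 1 → m ≤ m ^ k
k≥1⇒m≤m^k zero    _   = z≤n
k≥1⇒m≤m^k m@(suc _) k≥1 = ℕ.≤-trans (ℕ.≤-reflexive (sym (ℕ.*-identityʳ m))) (ℕ.^-monoʳ-≤ m k≥1)

8^n≤9^n : ∀ n → 2 ^ (3 * n) ≤ 3 ^ (n * 2)
8^n≤9^n n = begin
  2 ^ (3 * n) ≡⟨ ℕ.^-*-assoc 2 3 n ⟨
  8 ^ n       ≤⟨ ℕ.^-monoˡ-≤ n (ℕ.n≤1+n 8) ⟩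
  9 ^ n       ≡⟨ ℕ.^-*-assoc 3 2 n ⟩
  3 ^ (2 * n) ≡⟨ cong (3 ^_) (ℕ.*-comm 2 n) ⟩
  3 ^ (n * 2) ∎
  where open ℕ.≤-Reasoning

-- log 3 > 3/2 leaves room for the b + 4 nodes of the chain even if k = 1.
≤-log^-3^ : ∀ {k b L} → k ≥ 1 → 2 * (4 + L) ≤ b ^ k → (4 + b + L) ≤ 1 ·log^ k ⟨ 3 ^ b ⟩
≤-log^-3^ {suc k} {b} {L} _ short p q q≥1 3^bq≤2^p = ℕ.*-cancelˡ-≤ (2 ^ suc k) {{ℕ.m^n≢0 2 (suc k)}} (begin
  2 ^ suc k * ((4 + b + L) * q ^ suc k) ≡⟨ ℕ.*-assoc (2 ^ suc k) (4 + b + L) (q ^ suc k) ⟨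
  2 ^ suc k * (4 + b + L) * q ^ suc k   ≤⟨ ℕ.*-monoˡ-≤ (q ^ suc k) chain ⟩
  (3 * b) ^ suc k * q ^ suc k           ≡⟨ ^-distribʳ-* (suc k) (3 * b) q ⟨
  (3 * b * q) ^ suc k                   ≤⟨ ℕ.^-monoˡ-≤ (suc k) 3bq≤2p ⟩
  (2 * p) ^ suc k                       ≡⟨ ^-distribʳ-* (suc k) 2 p ⟩
  2 ^ suc k * p ^ suc k                 ≡⟨ cong (2 ^ suc k *_) (ℕ.*-identityˡ _) ⟨
  2 ^ suc k * (1 * p ^ suc k)           ∎)
  where
  open ℕ.≤-Reasoning
  double : ∀ b L → 2 * (4 + b + L) ≡ 2 * b + 2 * (4 + L)
  double = solve-∀
  triple : ∀ x → 2 * x + x ≡ 3 * x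
  triple = solve-∀
  chain : 2 ^ suc k * (4 + b + L) ≤ (3 * b) ^ suc k
  chain = begin
    2 * 2 ^ k * (4 + b + L)             ≡⟨ cong (_* (4 + b + L)) (ℕ.*-comm 2 (2 ^ k)) ⟩
    2 ^ k * 2 * (4 + b + L)             ≡⟨ ℕ.*-assoc (2 ^ k) 2 (4 + b + L) ⟩
    2 ^ k * (2 * (4 + b + L))           ≡⟨ cong (2 ^ k *_) (double b L) ⟩
    -- Of three shares of the power of `b`, two pay for the digits of the chain and the third pays
    -- for the layers and the four other nodes of the chain.
    2 ^ k * (2 * b + 2 * (4 + L))       ≤⟨ ℕ.*-monoʳ-≤ (2 ^ k) (ℕ.+-mono-≤ (ℕ.*-monoʳ-≤ 2 (k≥1⇒m≤m^k {suc k} b (s≤s z≤n))) short) ⟩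
    2 ^ k * (2 * b ^ suc k + b ^ suc k) ≡⟨ cong (2 ^ k *_) (triple (b ^ suc k)) ⟩
    2 ^ k * (3 * b ^ suc k)             ≤⟨ ℕ.*-monoˡ-≤ (3 * b ^ suc k) (ℕ.^-monoˡ-≤ k (ℕ.n≤1+n 2)) ⟩
    3 ^ k * (3 * b ^ suc k)             ≡⟨ ℕ.*-assoc (3 ^ k) 3 (b ^ suc k) ⟨
    3 ^ k * 3 * b ^ suc k               ≡⟨ cong (_* b ^ suc k) (ℕ.*-comm (3 ^ k) 3) ⟩
    3 ^ suc k * b ^ suc k               ≡⟨ ^-distribʳ-* (suc k) 3 b ⟨
    (3 * b) ^ suc k                     ∎
  3bq≤2p : 3 * b * q ≤ 2 * p
  3bq≤2p = 2^-cancel-≤ (begin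
    2 ^ (3 * b * q)   ≡⟨ cong (2 ^_) (ℕ.*-assoc 3 b q) ⟩
    2 ^ (3 * (b * q)) ≤⟨ 8^n≤9^n (b * q) ⟩
    3 ^ (b * q * 2)   ≡⟨ ℕ.^-*-assoc 3 (b * q) 2 ⟨
    (3 ^ (b * q)) ^ 2 ≡⟨ cong (_^ 2) (ℕ.^-*-assoc 3 b q) ⟨
    ((3 ^ b) ^ q) ^ 2 ≤⟨ ℕ.^-monoˡ-≤ 2 3^bq≤2^p ⟩
    (2 ^ p) ^ 2       ≡⟨ ℕ.^-*-assoc 2 p 2 ⟩
    2 ^ (p * 2)       ≡⟨ cong (2 ^_) (ℕ.*-comm p 2) ⟩
    2 ^ (2 * p)       ∎)

gateCount≤size : ∀ {X n s} (gs : Gates X n s) → s ≤ gatesSize gs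
gateCount≤size []       = z≤n
gateCount≤size (gs ▷ g) = s≤s (ℕ.≤-trans (gateCount≤size gs) (ℕ.m≤n+m _ (fanIn g)))

poly⇒2^ : ∀ c e n → n ≥ 2 → c * n ^ e ≤ 2 ^ ((c + e) * lg n)
poly⇒2^ c e n n≥2 = begin
  c * n ^ e                     ≤⟨ ℕ.*-mono-≤ (ℕ.≤-trans (n≤2^n c) (ℕ.^-monoʳ-≤ 2 (ℕ.≤-trans (ℕ.≤-reflexive (sym (ℕ.*-identityʳ c))) (ℕ.*-monoʳ-≤ c 1≤lg)))) (ℕ.^-monoˡ-≤ e (n≤2^lg n)) ⟩
  2 ^ (c * lg n) * (2 ^ lg n) ^ e ≡⟨ cong (2 ^ (c * lg n) *_) (trans (ℕ.^-*-assoc 2 (lg n) e) (cong (2 ^_) (ℕ.*-comm (lg n) e))) ⟩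
  2 ^ (c * lg n) * 2 ^ (e * lg n) ≡⟨ ℕ.^-distribˡ-+-* 2 (c * lg n) (e * lg n) ⟨
  2 ^ (c * lg n + e * lg n)     ≡⟨ cong (2 ^_) (ℕ.*-distribʳ-+ (lg n) c e) ⟨
  2 ^ ((c + e) * lg n)          ∎
  where
  open ℕ.≤-Reasoning
  1≤lg : 1 ≤ lg n
  1≤lg = 2^-cancel-≤ (ℕ.≤-trans n≥2 (n≤2^lg n))

module Hardness {k} (k≥1 : k ≥ 1) (C : Family ⊥) (bounded : Bounded C k) where

  open Bounded bounded

  private
    c₁ n₁ c₂ e₂ n₂ : ℕ
    c₁ = proj₁ logDepth
    n₁ = proj₁ (proj₂ logDepth)
    c₂ = proj₁ polynomialSize
    e₂ = proj₁ (proj₂ polynomialSize)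
    n₂ = proj₁ (proj₂ (proj₂ polynomialSize))

    module R n = Reduce {n} {k} (C n)

    -- The 0 is a placeholder for the number of digits, on which neither `L` nor `N` depends; that
    -- number is chosen afterwards, from `slots`.
    slots slotsBound : ℕ → ℕ
    slots n = suc (R.L n 0) * (2 + R.N n 0)
    slotsBound n = (3 + 2 * (c₁ * n ^ k)) * (2 + ((c₂ * n ^ e₂ + n) + (c₂ * n ^ e₂ + n)))

    poly-slots : Poly slotsBound
    poly-slots = (poly-const 3 ⊕ poly-const 2 ⊗ (poly-const c₁ ⊗ poly-^ k poly-id)) ⊗ (poly-const 2 ⊕ (half ⊕ half))
      where
      half : Poly (λ n → c₂ * n ^ e₂ + n)
      half = poly-const c₂ ⊗ poly-^ e₂ poly-id ⊕ poly-id

    c₃ e₃ κ n₀ : ℕ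
    c₃ = proj₁ poly-slots
    e₃ = proj₁ (proj₂ poly-slots)
    -- The field `short` needs 12 + 4 · `c₁`, and `slots≤` needs `c₃` + `e₃`.
    κ  = 12 + 4 * c₁ + (c₃ + e₃)
    n₀ = 2 + n₁ + n₂

    -- By `4+n+2^n≤3^n`, the first two fields fit chain and layers into 3^`b` nodes. The third is
    -- the hypothesis of `≤-log^-3^`, which yields the depth bound of the promise.
    record Width (n b : ℕ) : Set where
      field
        slots≤ : slots n ≤ 2 ^ b
        b≥3    : 3 ≤ b
        short  : 2 * (4 + R.L n 0) ≤ b ^ k

    wide : ∀ n → n ≥ n₀ → Width n (κ * lg n)
    wide n n≥n₀ = record
      { slots≤ = begin
          slots n                  ≤⟨ ℕ.*-mono-≤ (ℕ.+-monoʳ-≤ 3 (ℕ.*-monoʳ-≤ 2 depth≤n)) (ℕ.+-monoʳ-≤ 2 (ℕ.+-mono-≤ half≤ half≤)) ⟩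
          slotsBound n             ≤⟨ proj₂ (proj₂ poly-slots) n (ℕ.≤-trans (s≤s z≤n) n≥2) ⟩
          c₃ * n ^ e₃              ≤⟨ poly⇒2^ c₃ e₃ n n≥2 ⟩
          2 ^ ((c₃ + e₃) * lg n)   ≤⟨ ℕ.^-monoʳ-≤ 2 (ℕ.*-monoˡ-≤ (lg n) (ℕ.m≤n+m (c₃ + e₃) (12 + 4 * c₁))) ⟩
          2 ^ (κ * lg n)           ∎
      ; b≥3    = ℕ.*-mono-≤ {3} {κ} (ℕ.m≤m+n 3 _) 1≤lg
      ; short  = begin
          2 * (4 + (2 + 2 * depth (C n))) ≡⟨ arith (depth (C n)) ⟩
          12 + 4 * depth (C n)            ≤⟨ ℕ.+-mono-≤ (ℕ.≤-trans (ℕ.≤-reflexive (sym (ℕ.*-identityʳ 12))) (ℕ.*-monoʳ-≤ 12 1≤lg^k)) (ℕ.*-monoʳ-≤ 4 depth≤) ⟩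
          12 * lg n ^ k + 4 * (c₁ * lg n ^ k) ≡⟨ factor c₁ (lg n ^ k) ⟩
          (12 + 4 * c₁) * lg n ^ k        ≤⟨ ℕ.*-monoˡ-≤ (lg n ^ k) (ℕ.≤-trans (ℕ.m≤m+n (12 + 4 * c₁) (c₃ + e₃)) (k≥1⇒m≤m^k κ k≥1)) ⟩
          κ ^ k * lg n ^ k                ≡⟨ ^-distribʳ-* k κ (lg n) ⟨
          (κ * lg n) ^ k                  ∎
      }
      where
      open ℕ.≤-Reasoning
      n≥2 : n ≥ 2
      n≥2 = ℕ.≤-trans (ℕ.m≤m+n 2 (n₁ + n₂)) n≥n₀
      n≥n₁ : n ≥ n₁
      n≥n₁ = ℕ.≤-trans (ℕ.≤-trans (ℕ.m≤m+n n₁ n₂) (ℕ.m≤n+m (n₁ + n₂) 2)) n≥n₀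
      n≥n₂ : n ≥ n₂
      n≥n₂ = ℕ.≤-trans (ℕ.m≤n+m n₂ (2 + n₁)) n≥n₀
      1≤lg : 1 ≤ lg n
      1≤lg = 2^-cancel-≤ (ℕ.≤-trans n≥2 (n≤2^lg n))
      1≤lg^k : 1 ≤ lg n ^ k
      1≤lg^k = ℕ.≤-trans 1≤lg (k≥1⇒m≤m^k (lg n) k≥1)
      depth≤ : depth (C n) ≤ c₁ * lg n ^ k
      depth≤ = ≤-c·log^⁻ {k} {n} {c₁} (n≤2^lg n) (proj₂ (proj₂ logDepth) n n≥n₁)
      depth≤n : depth (C n) ≤ c₁ * n ^ k
      depth≤n = ℕ.≤-trans depth≤ (ℕ.*-monoʳ-≤ c₁ (ℕ.^-monoˡ-≤ k (lg≤n n)))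
      half≤ : Circuit.gateCount (C n) + n ≤ c₂ * n ^ e₂ + n
      half≤ = ℕ.+-monoˡ-≤ n (ℕ.≤-trans (gateCount≤size (Circuit.gates (C n))) (proj₂ (proj₂ (proj₂ polynomialSize)) n n≥n₂))
      arith : ∀ d → 2 * (4 + (2 + 2 * d)) ≡ 12 + 4 * d
      arith = solve-∀
      factor : ∀ c x → 12 * x + 4 * (c * x) ≡ (12 + 4 * c) * x
      factor = solve-∀

    narrow : ∀ n → Width n (2 * (4 + R.L n 0) + slots n + 3)
    narrow n = record
      { slots≤ = ℕ.≤-trans (ℕ.≤-trans (ℕ.m≤n+m (slots n) y) (ℕ.m≤m+n (y + slots n) 3)) (n≤2^n (y + slots n + 3))
      ; b≥3    = ℕ.m≤n+m 3 (y + slots n)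
      ; short  = ℕ.≤-trans (ℕ.≤-trans (ℕ.m≤m+n y (slots n)) (ℕ.m≤m+n (y + slots n) 3)) (k≥1⇒m≤m^k (y + slots n + 3) k≥1)
      }
      where
      y = 2 * (4 + R.L n 0)

    choose : ∀ n → Dec (n₀ ≤ n) → ∃[ b ] Width n b
    choose n (yes n≥n₀) = κ * lg n , wide n n≥n₀
    choose n (no  _)    = _ , narrow n

    opaque

      b : ℕ → ℕ
      b n = proj₁ (choose n (n₀ ℕ.≤? n))

      width : ∀ n → Width n (b n)
      width n = proj₂ (choose n (n₀ ℕ.≤? n))

      b≡ : ∀ n → n ≥ n₀ → b n ≡ κ * lg n
      b≡ n n≥n₀ with n₀ ℕ.≤? n
      ... | yes _ = refl
      ... | no ≱ = contradiction n≥n₀ ≱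

    fits : ∀ n → 4 + b n + slots n ≤ 3 ^ b n
    fits n = ℕ.≤-trans (ℕ.+-monoʳ-≤ (4 + b n) slots≤) (4+n+2^n≤3^n (b n) b≥3)
      where open Width (width n)

    querying : ∀ n → Block ⊤ (Fin n) ⊤ _ _ _
    querying n = compile (R.query n (b n) (fits n))

  reduction : Family ⊤
  reduction n = ToCircuit.circuit (querying n)

  private
    -- Since `b n` is proportional to `lg n`, the padded power circuit has polynomially many nodes.
    3^b≤ : ∀ n → n ≥ n₀ → 3 ^ b n ≤ (2 * n) ^ (2 * κ)
    3^b≤ n n≥n₀ = begin
      3 ^ b n                ≤⟨ ℕ.^-monoˡ-≤ (b n) (ℕ.n≤1+n 3) ⟩
      4 ^ b n                ≡⟨ ℕ.^-*-assoc 2 2 (b n) ⟩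
      2 ^ (2 * b n)          ≡⟨ cong (λ b → 2 ^ (2 * b)) (b≡ n n≥n₀) ⟩
      2 ^ (2 * (κ * lg n))   ≡⟨ cong (2 ^_) (trans (sym (ℕ.*-assoc 2 κ (lg n))) (ℕ.*-comm (2 * κ) (lg n))) ⟩
      2 ^ (lg n * (2 * κ))   ≡⟨ ℕ.^-*-assoc 2 (lg n) (2 * κ) ⟨
      (2 ^ lg n) ^ (2 * κ)   ≤⟨ ℕ.^-monoˡ-≤ (2 * κ) (2^lg≤2n n (ℕ.≤-trans (s≤s z≤n) n≥n₀)) ⟩
      (2 * n) ^ (2 * κ)      ∎
      where open ℕ.≤-Reasoning

    len-mono-≤ : ∀ {m n} → m ≤ n → len m ≤ len n
    len-mono-≤ le = ℕ.+-mono-≤ (ℕ.*-mono-≤ le (ℕ.*-monoˡ-≤ 2 le)) (ℕ.+-mono-≤ le le)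

    nodes : ℕ → ℕ
    nodes n = (2 * n) ^ (2 * κ)

    poly-query : Poly (λ n → suc (len (nodes n)) + len (nodes n) * 2)
    poly-query = (poly-const 1 ⊕ poly-len) ⊕ poly-len ⊗ poly-const 2
      where
      m : Poly nodes
      m = poly-^ (2 * κ) (poly-const 2 ⊗ poly-id)
      poly-len : Poly (λ n → len (nodes n))
      poly-len = m ⊗ (m ⊗ poly-const 2) ⊕ (m ⊕ m)

  reduction-bounded : Bounded reduction 0
  reduction-bounded = record
    { polynomialSize = proj₁ poly-query , proj₁ (proj₂ poly-query) , n₀ , λ n n≥n₀ → begin
        size (reduction n)
          ≤⟨ ToCircuit.circuit-size (querying n) ⟩
        sizeᶠ (R.query n (b n) (fits n))
          ≤⟨ R.query-size n (b n) (fits n) ⟩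
        suc (len (3 ^ b n)) + len (3 ^ b n) * 2
          ≤⟨ ℕ.+-mono-≤ (s≤s (len-mono-≤ (3^b≤ n n≥n₀))) (ℕ.*-monoˡ-≤ 2 (len-mono-≤ (3^b≤ n n≥n₀))) ⟩
        suc (len (nodes n)) + len (nodes n) * 2
          ≤⟨ proj₂ (proj₂ poly-query) n (ℕ.≤-trans (s≤s z≤n) n≥n₀) ⟩
        proj₁ poly-query * n ^ proj₁ (proj₂ poly-query) ∎
    ; logDepth = 2 , 0 , λ n _ p q _ _ → ℕ.*-monoˡ-≤ 1
        (ℕ.≤-trans (ToCircuit.circuit-depth (querying n)) (R.query-depth n (b n) (fits n)))
    }
    where open ℕ.≤-Reasoning

  reduction-correct : (oracle : ∀ {n} → Vec Bool n → Bool) → Decides oracle (Comparison k) →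
                      ∀ n x → eval (λ _ → oracle) (reduction n) x ≡ true ⇔ eval noGates (C n) x ≡ true
  reduction-correct oracle oracle-decides n x =
    subst (λ β → β ≡ true ⇔ eval noGates (C n) x ≡ true) (sym (ToCircuit.circuit-eval (querying n) (λ _ → oracle) x))
      (R.query-correct n (b n) (fits n) oracle oracle-decides depthBound x)
    where
    depthBound : ∀ d → d ≡ 2 + (b n + 2) + R.L n 0 → d ≤ 1 ·log^ k ⟨ 3 ^ b n ⟩
    depthBound d eq = subst (_≤ 1 ·log^ k ⟨ 3 ^ b n ⟩) (sym (trans eq (cong (λ x → 2 + x + R.L n 0) (ℕ.+-comm (b n) 2))))
      (≤-log^-3^ {k} {b n} {R.L n 0} k≥1 (Width.short (width n)))

  reduction-decides : ∀ {K} → DecidesWith noGates C K →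
    (oracle : ∀ {n} → Vec Bool n → Bool) → Decides oracle (Comparison k) → DecidesWith (λ _ → oracle) reduction K
  reduction-decides {K} C-decides oracle oracle-decides i =
    C-decides i ⇔-∘ reduction-correct oracle oracle-decides (length i) (encode i)
    where open Problem K

comparison-hard : ∀ {k} → k ≥ 1 → ACHard k (Comparison k)
comparison-hard k≥1 K (C , bounded , decides) = reduction , reduction-bounded , reduction-decides {K} decides
  where open Hardness k≥1 C bounded

corollary54 : (k : ℕ) → k ≥ 1 → TC k (Comparison k) × ACHard k (Comparison k)
corollary54 k k≥1 = UpperBound.comparison∈TC k , comparison-hard k≥1
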